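{- $\mathsf{RRT}^3_2$ admits preservation of $\Delta^0_3$-definitions: for every set $Z$ and every $Z$-computable $2$-bounded coloring $f:[\omega]^3\to\omega$, there exists an infinite $f$-rainbow $G$ which preserves $\Delta^0_3$-definitions relative to $Z$.
   Context: A coloring $f:[\omega]^n\to\omega$ is $2$-bounded if each color is assigned to at most two elements of $[\omega]^n$. An $f$-rainbow is a set $H$ such that $f$ is injective on $[H]^n$. $\mathsf{RRT}^n_2$ (Rainbow Ramsey Theorem) states that every $2$-bounded coloring of $[\omega]^n$ has an infinite rainbow. A set is properly $\Delta^0_3$ relative to $X$ if it is $\Delta^0_3$ relative to $X$ but neither $\Sigma^0_2$ nor $\Pi^0_2$ relative to $X$. A set $Y$ preserves $\Delta^0_3$-definitions relative to $X$ if every set that is properly $\Delta^0_3$ relative to $X$ is properly $\Delta^0_3$ relative to $X\oplus Y$. -}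

module Defs where

open import Data.Nat using (ℕ; zero; suc; _+_; _*_; _<_; _≤_)
open import Data.Bool using (Bool; true; false)
open import Data.Product using (Σ; _×_; _,_; ∃)
open import Data.Sum using (_⊎_)
open import Relation.Nullary using (¬_)
open import Relation.Binary.PropositionalEquality using (_≡_)

SetN : Set
SetN = ℕ → Bool

infix 5 _∈_
infix 2 _↔_
_∈_ : ℕ → SetN → Set
n ∈ X = X n ≡ true

_↔_ : Set → Set → Set
A ↔ B = (A → B) × (B → A)

-- Turing join  X ⊕ Y = {2n : n ∈ X} ∪ {2n+1 : n ∈ Y}.
join : SetN → SetN → SetN
join X Y zero = X zero
join X Y (suc zero) = Y zero
join X Y (suc (suc n)) = join (λ k → X (suc k)) (λ k → Y (suc k)) n

-- Bounded (Δ⁰₀) formulas of first-order arithmetic with a set-oracle atom.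
-- Variables are de Bruijn indices into an environment ℕ → ℕ.

Env : Set
Env = ℕ → ℕ

ext : ℕ → Env → Env
ext a ρ zero = a
ext a ρ (suc i) = ρ i

data Term : Set where
  var  : ℕ → Term
  lit  : ℕ → Term
  plus : Term → Term → Term
  times : Term → Term → Term

data BForm : Set where
  eqF    : Term → Term → BForm
  ltF    : Term → Term → BForm
  inX    : Term → BForm
  negF   : BForm → BForm
  andF   : BForm → BForm → BForm
  orF    : BForm → BForm → BForm
  allLt  : Term → BForm → BForm    -- ∀ x < t. φ   (x bound as var 0)
  exLt   : Term → BForm → BForm

evalT : Env → Term → ℕ
evalT ρ (var i) = ρ i
evalT ρ (lit n) = n
evalT ρ (plus s t) = evalT ρ s + evalT ρ t
evalT ρ (times s t) = evalT ρ s * evalT ρ t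

Sat : SetN → Env → BForm → Set
Sat X ρ (eqF s t) = evalT ρ s ≡ evalT ρ t
Sat X ρ (ltF s t) = evalT ρ s < evalT ρ t
Sat X ρ (inX t) = evalT ρ t ∈ X
Sat X ρ (negF φ) = ¬ Sat X ρ φ
Sat X ρ (andF φ ψ) = Sat X ρ φ × Sat X ρ ψ
Sat X ρ (orF φ ψ) = Sat X ρ φ ⊎ Sat X ρ ψ
Sat X ρ (allLt t φ) = (x : ℕ) → x < evalT ρ t → Sat X (ext x ρ) φ
Sat X ρ (exLt t φ) = Σ ℕ λ x → x < evalT ρ t × Sat X (ext x ρ) φ

ρ₀ : Env
ρ₀ _ = 0

Sigma2 : SetN → SetN → Set
Sigma2 X A = Σ BForm λ φ → (n : ℕ) →
  n ∈ A ↔ Σ ℕ (λ a → (b : ℕ) → Sat X (ext b (ext a (ext n ρ₀))) φ)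

Pi2 : SetN → SetN → Set
Pi2 X A = Σ BForm λ φ → (n : ℕ) →
  n ∈ A ↔ ((a : ℕ) → Σ ℕ (λ b → Sat X (ext b (ext a (ext n ρ₀))) φ))

Sigma3 : SetN → SetN → Set
Sigma3 X A = Σ BForm λ φ → (n : ℕ) →
  n ∈ A ↔ Σ ℕ (λ a → (b : ℕ) → Σ ℕ (λ c → Sat X (ext c (ext b (ext a (ext n ρ₀)))) φ))

Pi3 : SetN → SetN → Set
Pi3 X A = Σ BForm λ φ → (n : ℕ) →
  n ∈ A ↔ ((a : ℕ) → Σ ℕ (λ b → (c : ℕ) → Sat X (ext c (ext b (ext a (ext n ρ₀)))) φ))

Delta3 : SetN → SetN → Set
Delta3 X A = Sigma3 X A × Pi3 X A

ProperlyDelta3 : SetN → SetN → Set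
ProperlyDelta3 X A = Delta3 X A × ¬ Sigma2 X A × ¬ Pi2 X A

PreservesDelta3 : SetN → SetN → Set
PreservesDelta3 X Y = (A : SetN) → ProperlyDelta3 X A → ProperlyDelta3 (join X Y) A

-- Colorings of [ω]³ (given as functions on triples; only increasing
-- triples x < y < z matter).

Coloring3 : Set
Coloring3 = ℕ → ℕ → ℕ → ℕ

-- f restricted to [ω]³ is computable in Z: its graph on increasing triples
-- is Σ⁰₁(Z) (equivalent to Z-computability, since f is total).
ComputableIn : SetN → Coloring3 → Set
ComputableIn Z f = Σ BForm λ φ → (x y z c : ℕ) → x < y → y < z →
  (f x y z ≡ c) ↔ Σ ℕ (λ w → Sat Z (ext w (ext c (ext z (ext y (ext x ρ₀))))) φ)

TwoBounded : Coloring3 → Set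
TwoBounded f = (x₁ y₁ z₁ x₂ y₂ z₂ x₃ y₃ z₃ : ℕ) →
  x₁ < y₁ → y₁ < z₁ → x₂ < y₂ → y₂ < z₂ → x₃ < y₃ → y₃ < z₃ →
  f x₁ y₁ z₁ ≡ f x₂ y₂ z₂ → f x₂ y₂ z₂ ≡ f x₃ y₃ z₃ →
  ((x₁ ≡ x₂) × (y₁ ≡ y₂) × (z₁ ≡ z₂)) ⊎
  ((x₁ ≡ x₃) × (y₁ ≡ y₃) × (z₁ ≡ z₃)) ⊎
  ((x₂ ≡ x₃) × (y₂ ≡ y₃) × (z₂ ≡ z₃))

Rainbow : Coloring3 → SetN → Set
Rainbow f H = (x₁ y₁ z₁ x₂ y₂ z₂ : ℕ) →
  x₁ ∈ H → y₁ ∈ H → z₁ ∈ H → x₂ ∈ H → y₂ ∈ H → z₂ ∈ H →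
  x₁ < y₁ → y₁ < z₁ → x₂ < y₂ → y₂ < z₂ →
  f x₁ y₁ z₁ ≡ f x₂ y₂ z₂ → (x₁ ≡ x₂) × (y₁ ≡ y₂) × (z₁ ≡ z₂)

Infinite : SetN → Set
Infinite H = (n : ℕ) → Σ ℕ λ m → n ≤ m × m ∈ H

{-# OPTIONS --safe #-}
module Submission where

open import Defs
open import Level using (0ℓ)
open import Axiom.ExcludedMiddle using (ExcludedMiddle)
open import Data.Product using (Σ; _×_)
open import Data.Bool using (Bool; true; false; not)
open import Data.Empty using (⊥; ⊥-elim)
open import Data.Maybe using (Maybe; just; nothing)
open import Data.Maybe.Properties using (just-injective)
open import Data.Nat using (ℕ; zero; suc; _+_; _*_; _^_; _!; _∸_; _⊔_; _<_; _≤_; z≤n; s≤s; pred)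
open import Data.Nat.Coprimality using (Coprime; coprime-divisor)
open import Data.Nat.Divisibility using (_∣_; divides; ∣-trans; ∣1⇒≡1; ∣m+n∣m⇒∣n; ∣n⇒∣m*n; m∣m*n)
open import Data.Nat.Properties
open import Data.Nat.Tactic.RingSolver using (solve-∀)
open import Data.Product using (_,_; ∃; proj₁; proj₂)
open import Data.Sum using (_⊎_; inj₁; inj₂; map₂)
open import Data.Unit using (⊤; tt)
open import Function using (id)
open import Relation.Binary using (tri<; tri≈; tri>)
open import Relation.Binary.PropositionalEquality using (_≡_; _≢_; refl; sym; trans; cong; cong₂; subst; subst₂)
open import Relation.Nullary using (¬_; Dec; yes; no)

-- Fix a limit, as z → ∞, of the relation "f x y z = f x' y' z" between pairs, chosen by a basis theorem
-- so that no set which is Σ₃ or Π₃ but not Σ₂ in Z becomes Σ₁ in Z' and the limit; a stack P of oracles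
-- with this property is called nice. G is built by forcing. A condition has a finite rainbow F, a
-- constraint Con on its extensions, a set Y of candidates for new elements, and promises, each saying
-- that some T ⊇ F will be extended so as to refute the instance a of ∃a∀b φ(n , a , b). The promises
-- generate an ideal of small sets: those covered by finitely many sets whose subsets, once thinned by
-- hypergraphs in which an element of an edge is determined by the others, fulfil none of the promises.
-- To keep a set B from being {n : ∃a∀b φ(n , a , b ; G)}, ask whether promising all instances at n makes
-- the whole space small, whatever the limiting behaviour M of the constraint on Y is. By compactness
-- the n with a positive answer form a set that is Σ₁ in P, so B differs from it at some n. If n ∈ B,
-- the promises are made, and keeping them puts n outside the Σ₂ set of G. If n ∉ B, a witness of
-- smallness covers Y, and the piece that stays large under all later promises forces ∀b φ(n , a , b ; G)
-- for some a. The limit relation is decidable in P but not low, hence the definition of smallness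
-- quantifies over all hypergraphs instead of mentioning it.

-- Two-boundedness gives every pair at most one partner in the limit relation, and a finite rainbow
-- without partners among its pairs can be extended by suitable large elements. Partners `(a , b)`
-- and `(c , y)` with `b < y` yield the edge of `a`, `b` and `y`, whose last element is determined;
-- partners with the same last element yield an edge in which each of the smaller elements is
-- determined. These two shapes survive the forcing. Fixing the low part of the edges preserves the
-- shape up to singletons; passing to the limit of the last element along `Y` leaves nothing of the
-- first shape, and of the second an edge of the same shape without its last element. A singleton
-- edge is determined by the empty set, so a thin hypergraph has at most one and excludes hardly any
-- points. Smallness of the whole space mentions arbitrary hypergraphs and no oracle. By compactness
-- it is, for given finitely many promises, the negation of a Σ₁(Z) statement, hence an atom of the
-- formulas over `P`; this is why the question to be compared with B stays Σ₁ in P.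

module Classical (em : ExcludedMiddle 0ℓ) where

  dne : {A : Set} → ¬ ¬ A → A
  dne {A} h with em {A}
  ... | yes a = a
  ... | no na = ⊥-elim (h na)

  ¬∀⇒∃¬ : {A : Set} {P : A → Set} → ¬ ((x : A) → P x) → Σ A λ x → ¬ P x
  ¬∀⇒∃¬ h = dne λ k → h λ x → dne λ np → k (x , np)

  ¬∃⇒∀ : {A : Set} {P : A → Set} → ¬ (Σ A λ x → ¬ P x) → (x : A) → P x
  ¬∃⇒∀ h x = dne λ np → h (x , np)

  or-else : {A B : Set} → (¬ A → B) → A ⊎ B
  or-else {A} h with em {A}
  ... | yes a = inj₁ a
  ... | no na = inj₂ (h na)

  infixr 4 _×↔_
  infixr 3 _⊎↔_
  _×↔_ : {A B C D : Set} → A ↔ B → C ↔ D → (A × C) ↔ (B × D)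
  (f , g) ×↔ (h , k) = (λ { (a , c) → f a , h c }) , (λ { (b , d) → g b , k d })

  _⊎↔_ : {A B C D : Set} → A ↔ B → C ↔ D → (A ⊎ C) ↔ (B ⊎ D)
  (f , g) ⊎↔ (h , k) = (λ { (inj₁ a) → inj₁ (f a) ; (inj₂ c) → inj₂ (h c) }) , (λ { (inj₁ b) → inj₁ (g b) ; (inj₂ d) → inj₂ (k d) })

  ¬↔ : {A B : Set} → A ↔ B → (¬ A) ↔ (¬ B)
  ¬↔ (f , g) = (λ n b → n (g b)) , (λ n a → n (f a))

  opaque
    chr : (ℕ → Set) → SetN
    chr Q n with em {Q n}
    ... | yes _ = true
    ... | no _ = false

    chr⁺ : ∀ {Q n} → Q n → n ∈ chr Q
    chr⁺ {Q} {n} q with em {Q n}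
    ... | yes _ = refl
    ... | no nq = ⊥-elim (nq q)

    chr⁻ : ∀ {Q n} → n ∈ chr Q → Q n
    chr⁻ {Q} {n} e with em {Q n}
    chr⁻ e | yes q = q
    chr⁻ () | no _

  true≢false : {A : Set} {b : Bool} → b ≡ true → b ≡ false → A
  true≢false refl ()

  bool-cases : (b : Bool) → b ≡ true ⊎ b ≡ false
  bool-cases true = inj₁ refl
  bool-cases false = inj₂ refl

  not-true : {b : Bool} → ¬ b ≡ true → b ≡ false
  not-true {true} h = ⊥-elim (h refl)
  not-true {false} h = refl

  bool-ext : {b c : Bool} → (b ≡ true → c ≡ true) → (c ≡ true → b ≡ true) → b ≡ c
  bool-ext {true} f g = sym (f refl)
  bool-ext {false} {true} f g = g refl
  bool-ext {false} {false} f g = refl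

  -- Pairing and codes of finite sets

  opaque
    -- A polynomial, so that pairing is a `Term`. It is not onto; the projections `left` and `right`
    -- are defined by cases and never enter a formula.
    pr : ℕ → ℕ → ℕ
    pr x y = (x + y) * (x + y) + x

    square-gap : ∀ {s s'} x → x ≤ s → s < s' → s * s + x < s' * s'
    square-gap {s} {s'} x x≤s s<s' = begin-strict
        s * s + x ≤⟨ +-monoʳ-≤ (s * s) x≤s ⟩
        s * s + s <⟨ s≤s (m≤n+m (s * s + s) s) ⟩
        suc (s + (s * s + s)) ≡⟨ e s ⟩
        suc s * suc s ≤⟨ *-mono-≤ s<s' s<s' ⟩
        s' * s' ∎
      where
        open ≤-Reasoning
        e : ∀ s → suc (s + (s * s + s)) ≡ suc s * suc s
        e = solve-∀

    pr-inj : ∀ x y x' y' → pr x y ≡ pr x' y' → x ≡ x' × y ≡ y'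
    pr-inj x y x' y' e with <-cmp (x + y) (x' + y')
    ... | tri< lt _ _ = ⊥-elim (<-irrefl e (<-≤-trans (square-gap x (m≤m+n x y) lt) (m≤m+n _ x')))
    ... | tri> _ _ gt = ⊥-elim (<-irrefl (sym e) (<-≤-trans (square-gap x' (m≤m+n x' y') gt) (m≤m+n _ x)))
    ... | tri≈ _ s≡ _ = x≡ , +-cancelˡ-≡ x y y' (trans s≡ (cong (_+ y') (sym x≡)))
      where
        x≡ : x ≡ x'
        x≡ = +-cancelˡ-≡ ((x + y) * (x + y)) x x' (trans e (cong (λ s → s * s + x') (sym s≡)))

    pr-inj₁ : ∀ {x y x' y'} → pr x y ≡ pr x' y' → x ≡ x'
    pr-inj₁ {x} {y} {x'} {y'} e = proj₁ (pr-inj x y x' y' e)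

    pr-inj₂ : ∀ {x y x' y'} → pr x y ≡ pr x' y' → y ≡ y'
    pr-inj₂ {x} {y} {x'} {y'} e = proj₂ (pr-inj x y x' y' e)

    x≤pr : ∀ x y → x ≤ pr x y
    x≤pr x y = m≤n+m x _

    y≤pr : ∀ x y → y ≤ pr x y
    y≤pr x y = ≤-trans (≤-trans (m≤n+m y x) (self (x + y))) (m≤m+n _ x)
      where
        self : ∀ n → n ≤ n * n
        self zero = z≤n
        self (suc n) = m≤m*n (suc n) (suc n)

    pr-def : ∀ x y → pr x y ≡ (x + y) * (x + y) + x
    pr-def x y = refl

  opaque
    left right : ℕ → ℕ
    left n with em {∃ λ x → ∃ λ y → n ≡ pr x y}
    ... | yes (x , _) = x
    ... | no _ = 0
    right n with em {∃ λ x → ∃ λ y → n ≡ pr x y}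
    ... | yes (_ , y , _) = y
    ... | no _ = 0

    left-pr : ∀ x y → left (pr x y) ≡ x
    left-pr x y with em {∃ λ a → ∃ λ b → pr x y ≡ pr a b}
    ... | yes (_ , _ , e) = sym (pr-inj₁ e)
    ... | no h = ⊥-elim (h (x , y , refl))

    right-pr : ∀ x y → right (pr x y) ≡ y
    right-pr x y with em {∃ λ a → ∃ λ b → pr x y ≡ pr a b}
    ... | yes (_ , _ , e) = sym (pr-inj₂ e)
    ... | no h = ⊥-elim (h (x , y , refl))

  -- Finite sets are coded in binary.

  b2n : Bool → ℕ
  b2n true = 1
  b2n false = 0

  par : ℕ → Bool
  par zero = false
  par (suc n) = not (par n)

  half : ℕ → ℕ
  half zero = zero
  half (suc zero) = zero
  half (suc (suc n)) = suc (half n)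

  par-ss : ∀ n → not (not (par n)) ≡ par n
  par-ss n with par n
  ... | true = refl
  ... | false = refl

  half-eq : ∀ e → e ≡ half e + half e + b2n (par e)
  half-eq zero = refl
  half-eq (suc zero) = refl
  half-eq (suc (suc n)) rewrite par-ss n =
    cong suc (trans (cong suc (half-eq n)) (cong (_+ b2n (par n)) (sym (+-suc (half n) (half n)))))

  half-double : ∀ k b → half (k + k + b2n b) ≡ k
  half-double zero true = refl
  half-double zero false = refl
  half-double (suc k) b rewrite +-suc k k = cong suc (half-double k b)

  par-double : ∀ k b → par (k + k + b2n b) ≡ b
  par-double zero true = refl
  par-double zero false = refl
  par-double (suc k) b rewrite +-suc k k = trans (par-ss (k + k + b2n b)) (par-double k b)

  opaque
    bit : ℕ → SetN
    bit e zero = par e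
    bit e (suc x) = bit (half e) x

    half≤ : ∀ e → half e ≤ pred e
    half≤ zero = z≤n
    half≤ (suc zero) = z≤n
    half≤ (suc (suc zero)) = s≤s z≤n
    half≤ (suc (suc (suc n))) = s≤s (≤-trans (half≤ (suc n)) (n≤1+n n))

    bit-zero : ∀ x → bit 0 x ≡ false
    bit-zero zero = refl
    bit-zero (suc x) = bit-zero x

    bit-ext : ∀ e e' → (∀ x → bit e x ≡ bit e' x) → e ≡ e'
    bit-ext e e' h = go (e + e') e e' (m≤m+n e e') (m≤n+m e' e) h
      where
        step : ∀ {n} e → e ≤ suc n → half e ≤ n
        step e le = ≤-trans (half≤ e) (pred-mono-≤ le)
        go : ∀ n e e' → e ≤ n → e' ≤ n → (∀ x → bit e x ≡ bit e' x) → e ≡ e'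
        go zero zero zero _ _ _ = refl
        go (suc n) e e' le le' h = trans (half-eq e) (trans (cong₂ (λ k b → k + k + b2n b)
            (go n (half e) (half e') (step e le) (step e' le') (λ x → h (suc x))) (h 0)) (sym (half-eq e')))

    -- Inclusion bounds codes, so a quantifier over the subsets of a coded set is a bounded
    -- quantifier over numbers.
    bit-mono : ∀ e e' → (∀ x → x ∈ bit e → x ∈ bit e') → e ≤ e'
    bit-mono e e' h = go e e e' ≤-refl h
      where
        b≤ : ∀ {b c} → (b ≡ true → c ≡ true) → b2n b ≤ b2n c
        b≤ {false} _ = z≤n
        b≤ {true} k rewrite k refl = ≤-refl
        go : ∀ n e e' → e ≤ n → (∀ x → x ∈ bit e → x ∈ bit e') → e ≤ e'
        go zero zero e' _ _ = z≤n
        go (suc n) e e' le h = subst₂ _≤_ (sym (half-eq e)) (sym (half-eq e'))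
          (+-mono-≤ (+-mono-≤ r r) (b≤ (h 0)))
          where
            r : half e ≤ half e'
            r = go n (half e) (half e') (≤-trans (half≤ e) (pred-mono-≤ le)) (λ x → h (suc x))

    bit< : ∀ e x → x ∈ bit e → x < e
    bit< zero x p = true≢false p (bit-zero x)
    bit< (suc e) zero p = s≤s z≤n
    bit< (suc e) (suc x) p = ≤-trans (s≤s (bit< (half (suc e)) x p)) (s≤s (half≤ (suc e)))

    mk : SetN → ℕ → ℕ
    mk Q zero = 0
    mk Q (suc m) = mk (λ x → Q (suc x)) m + mk (λ x → Q (suc x)) m + b2n (Q 0)

    mk-bit : ∀ Q m x → x < m → bit (mk Q m) x ≡ Q x
    mk-bit Q (suc m) zero _ = par-double (mk (λ x → Q (suc x)) m) (Q 0)
    mk-bit Q (suc m) (suc x) (s≤s lt) =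
      trans (cong (λ e → bit e x) (half-double (mk (λ x → Q (suc x)) m) (Q 0))) (mk-bit (λ x → Q (suc x)) m x lt)

    mk-out : ∀ Q m x → m ≤ x → bit (mk Q m) x ≡ false
    mk-out Q zero x _ = bit-zero x
    mk-out Q (suc m) (suc x) (s≤s le) =
      trans (cong (λ e → bit e x) (half-double (mk (λ x → Q (suc x)) m) (Q 0))) (mk-out (λ x → Q (suc x)) m x le)

    mk<2^ : ∀ Q m → mk Q m < 2 ^ m
    mk<2^ Q zero = s≤s z≤n
    mk<2^ Q (suc m) = begin-strict
        k + k + b2n (Q 0) ≤⟨ +-monoʳ-≤ (k + k) (b≤1 (Q 0)) ⟩
        k + k + 1 <⟨ ≤-reflexive (e k) ⟩
        suc k + (suc k + 0) ≤⟨ +-mono-≤ lt (+-monoˡ-≤ 0 lt) ⟩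
        2 ^ suc m ∎
      where
        open ≤-Reasoning
        k : ℕ
        k = mk (λ x → Q (suc x)) m
        lt : k < 2 ^ m
        lt = mk<2^ (λ x → Q (suc x)) m
        b≤1 : ∀ b → b2n b ≤ 1
        b≤1 true = ≤-refl
        b≤1 false = z≤n
        e : ∀ k → suc (k + k + 1) ≡ suc k + (suc k + 0)
        e = solve-∀

    bit-0 : ∀ e → bit e 0 ≡ par e
    bit-0 e = refl

    bit-suc : ∀ e x → bit e (suc x) ≡ bit (half e) x
    bit-suc e x = refl

  opaque
    fset : (ℕ → Set) → ℕ → ℕ
    fset Q m = mk (chr Q) m

    fset⁺ : ∀ {Q m x} → x < m → Q x → x ∈ bit (fset Q m)
    fset⁺ {Q} {m} {x} lt q = trans (mk-bit (chr Q) m x lt) (chr⁺ q)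

    fset⁻ : ∀ {Q m x} → x ∈ bit (fset Q m) → x < m × Q x
    fset⁻ {Q} {m} {x} p with x <? m
    ... | yes lt = lt , chr⁻ (trans (sym (mk-bit (chr Q) m x lt)) p)
    ... | no nlt = true≢false p (mk-out (chr Q) m x (≮⇒≥ nlt))

  infix 4 _⊆ₑ_
  _⊆ₑ_ : ℕ → ℕ → Set
  e ⊆ₑ e' = ∀ x → x ∈ bit e → x ∈ bit e'

  ⊆-antisym : ∀ {e e'} → e ⊆ₑ e' → e' ⊆ₑ e → e ≡ e'
  ⊆-antisym {e} {e'} h k = bit-ext e e' λ x → bool-ext (h x) (k x)

  opaque
    ins : ℕ → ℕ → ℕ
    ins e x = fset (λ z → z ≡ x ⊎ z ∈ bit e) (suc (x + e))

    ins-here : ∀ e x → x ∈ bit (ins e x)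
    ins-here e x = fset⁺ (s≤s (m≤m+n x e)) (inj₁ refl)

    ins-there : ∀ {e x z} → z ∈ bit e → z ∈ bit (ins e x)
    ins-there {e} {x} {z} p = fset⁺ (s≤s (≤-trans (<⇒≤ (bit< e z p)) (m≤n+m e x))) (inj₂ p)

    ins⁻ : ∀ {e x z} → z ∈ bit (ins e x) → z ≡ x ⊎ z ∈ bit e
    ins⁻ p = proj₂ (fset⁻ p)

    uni : ℕ → ℕ → ℕ
    uni e e' = fset (λ z → z ∈ bit e ⊎ z ∈ bit e') (e + e')

    uniˡ : ∀ {e e' z} → z ∈ bit e → z ∈ bit (uni e e')
    uniˡ {e} {e'} {z} p = fset⁺ (≤-trans (bit< e z p) (m≤m+n e e')) (inj₁ p)

    uniʳ : ∀ {e e' z} → z ∈ bit e' → z ∈ bit (uni e e')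
    uniʳ {e} {e'} {z} p = fset⁺ (≤-trans (bit< e' z p) (m≤n+m e' e)) (inj₂ p)

    uni⁻ : ∀ {e e' z} → z ∈ bit (uni e e') → z ∈ bit e ⊎ z ∈ bit e'
    uni⁻ p = proj₂ (fset⁻ p)

  ∅-empty : ∀ {A : Set} {z} → z ∈ bit 0 → A
  ∅-empty {z = z} p = true≢false p (bit-zero z)

  nonempty : ∀ e → e ≢ 0 → ∃ λ x → x ∈ bit e
  nonempty e ne = dne λ h → ne (⊆-antisym (λ x p → ⊥-elim (h (x , p))) (λ x p → ∅-empty p))

  nonempty⁻ : ∀ {e x} → x ∈ bit e → e ≢ 0
  nonempty⁻ p refl = ∅-empty p

  ∅-or : ∀ {e x} → x ∈ bit 0 ⊎ x ∈ bit e → x ∈ bit e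
  ∅-or (inj₁ q) = ∅-empty q
  ∅-or (inj₂ q) = q

  uni-∅ : ∀ e → uni 0 e ≡ e
  uni-∅ e = ⊆-antisym (λ x p → ∅-or (uni⁻ {0} {e} p)) (λ x p → uniʳ {0} {e} p)

  uni-assoc : ∀ a b c → uni (uni a b) c ≡ uni a (uni b c)
  uni-assoc a b c = ⊆-antisym f g
    where
      f : uni (uni a b) c ⊆ₑ uni a (uni b c)
      f x p with uni⁻ {uni a b} {c} p
      ... | inj₂ q = uniʳ {a} (uniʳ {b} q)
      ... | inj₁ q with uni⁻ {a} {b} q
      ...   | inj₁ r = uniˡ {a} r
      ...   | inj₂ r = uniʳ {a} (uniˡ {b} r)
      g : uni a (uni b c) ⊆ₑ uni (uni a b) c
      g x p with uni⁻ {a} {uni b c} p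
      ... | inj₁ q = uniˡ {uni a b} (uniˡ {a} q)
      ... | inj₂ q with uni⁻ {b} {c} q
      ...   | inj₁ r = uniˡ {uni a b} (uniʳ {a} r)
      ...   | inj₂ r = uniʳ {uni a b} r

  opaque
    bounded : {R : ℕ → ℕ → Set} → (∀ {x m m'} → m ≤ m' → R x m → R x m') →
      ∀ t → (∀ x → x < t → ∃ (R x)) → ∃ λ m → ∀ x → x < t → R x m
    bounded mono zero h = 0 , λ x ()
    bounded {R} mono (suc t) h with bounded mono t (λ x lt → h x (m<n⇒m<1+n lt)) | h t ≤-refl
    ... | m , k | m' , k' = m ⊔ m' , go
      where
        go : ∀ x → x < suc t → R x (m ⊔ m')
        go x lt with m<1+n⇒m<n∨m≡n lt
        ... | inj₁ lt' = mono (m≤m⊔n m m') (k x lt')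
        ... | inj₂ refl = mono (m≤n⊔m m m') k'

  -- If every `x < t` failed at some `b`, it would fail from there on, and a common bound for the
  -- finitely many `x` would contradict the hypothesis.
  pigeonhole : {R : ℕ → ℕ → Set} → (∀ {x b b'} → b ≤ b' → R x b' → R x b) →
    ∀ t → (∀ b → ∃ λ x → x < t × R x b) → ∃ λ x → x < t × (∀ b → R x b)
  pigeonhole {R} anti t h = dne refute
    where
      mono : ∀ {x m m'} → m ≤ m' → ¬ R x m → ¬ R x m'
      mono le nr r = nr (anti le r)
      refute : ¬ ¬ (∃ λ x → x < t × (∀ b → R x b))
      refute k with bounded {λ x b → ¬ R x b} mono t (λ x lt → ¬∀⇒∃¬ λ all → k (x , lt , all))
      ... | m , q with h m
      ...   | x , lt , r = q x lt r

-- Substitution in bounded formulas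

module Definability (em : ExcludedMiddle 0ℓ) (Z : SetN) where

  open Classical em

  liftn : (ℕ → ℕ) → ℕ → ℕ
  liftn σ zero = zero
  liftn σ (suc i) = suc (σ i)

  subT : (ℕ → Term) → Term → Term
  subT σ (var i) = σ i
  subT σ (lit n) = lit n
  subT σ (plus s t) = plus (subT σ s) (subT σ t)
  subT σ (times s t) = times (subT σ s) (subT σ t)

  wk : Term → Term
  wk = subT (λ i → var (suc i))

  lift : (ℕ → Term) → ℕ → Term
  lift σ zero = var zero
  lift σ (suc i) = wk (σ i)

  subB : (ℕ → Term) → BForm → BForm
  subB σ (eqF s t) = eqF (subT σ s) (subT σ t)
  subB σ (ltF s t) = ltF (subT σ s) (subT σ t)
  subB σ (inX t) = inX (subT σ t)
  subB σ (negF φ) = negF (subB σ φ)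
  subB σ (andF φ ψ) = andF (subB σ φ) (subB σ ψ)
  subB σ (orF φ ψ) = orF (subB σ φ) (subB σ ψ)
  subB σ (allLt t φ) = allLt (subT σ t) (subB (lift σ) φ)
  subB σ (exLt t φ) = exLt (subT σ t) (subB (lift σ) φ)

  evalT-cong : ∀ t {ρ ρ'} → (∀ i → ρ i ≡ ρ' i) → evalT ρ t ≡ evalT ρ' t
  evalT-cong (var i) h = h i
  evalT-cong (lit n) h = refl
  evalT-cong (plus s t) h = cong₂ _+_ (evalT-cong s h) (evalT-cong t h)
  evalT-cong (times s t) h = cong₂ _*_ (evalT-cong s h) (evalT-cong t h)

  evalT-sub : ∀ σ ρ t → evalT ρ (subT σ t) ≡ evalT (λ i → evalT ρ (σ i)) t
  evalT-sub σ ρ (var i) = refl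
  evalT-sub σ ρ (lit n) = refl
  evalT-sub σ ρ (plus s t) = cong₂ _+_ (evalT-sub σ ρ s) (evalT-sub σ ρ t)
  evalT-sub σ ρ (times s t) = cong₂ _*_ (evalT-sub σ ρ s) (evalT-sub σ ρ t)

  evalT-wk : ∀ x ρ t → evalT (ext x ρ) (wk t) ≡ evalT ρ t
  evalT-wk x ρ t = evalT-sub (λ i → var (suc i)) (ext x ρ) t

  ext-cong : ∀ {ρ ρ'} x → (∀ i → ρ i ≡ ρ' i) → ∀ i → ext x ρ i ≡ ext x ρ' i
  ext-cong x h zero = refl
  ext-cong x h (suc i) = h i

  ext-lift : ∀ σ x ρ i → evalT (ext x ρ) (lift σ i) ≡ ext x (λ j → evalT ρ (σ j)) i
  ext-lift σ x ρ zero = refl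
  ext-lift σ x ρ (suc i) = evalT-wk x ρ (σ i)

  ext-liftn : ∀ σ x (ρ : Env) i → ext x ρ (liftn σ i) ≡ ext x (λ j → ρ (σ j)) i
  ext-liftn σ x ρ zero = refl
  ext-liftn σ x ρ (suc i) = refl

  Sat-cong : ∀ φ {X Y ρ ρ'} → (∀ n → X n ≡ Y n) → (∀ i → ρ i ≡ ρ' i) → Sat X ρ φ → Sat Y ρ' φ
  Sat-cong (eqF s t) k h p = trans (sym (evalT-cong s h)) (trans p (evalT-cong t h))
  Sat-cong (ltF s t) k h p = subst₂ _<_ (evalT-cong s h) (evalT-cong t h) p
  Sat-cong (inX t) {X} {Y} k h p = trans (sym (k _)) (trans (cong X (sym (evalT-cong t h))) p)
  Sat-cong (negF φ) k h p q = p (Sat-cong φ (λ n → sym (k n)) (λ i → sym (h i)) q)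
  Sat-cong (andF φ ψ) k h (p , q) = Sat-cong φ k h p , Sat-cong ψ k h q
  Sat-cong (orF φ ψ) k h (inj₁ p) = inj₁ (Sat-cong φ k h p)
  Sat-cong (orF φ ψ) k h (inj₂ p) = inj₂ (Sat-cong ψ k h p)
  Sat-cong (allLt t φ) k h p x lt =
    Sat-cong φ k (ext-cong x h) (p x (subst (x <_) (sym (evalT-cong t h)) lt))
  Sat-cong (exLt t φ) k h (x , lt , p) = x , subst (x <_) (evalT-cong t h) lt , Sat-cong φ k (ext-cong x h) p

  Sat-sub : ∀ φ {X} σ ρ → Sat X ρ (subB σ φ) ↔ Sat X (λ i → evalT ρ (σ i)) φ
  Sat-sub (eqF s t) σ ρ = (λ p → trans (sym (evalT-sub σ ρ s)) (trans p (evalT-sub σ ρ t)))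
                        , (λ p → trans (evalT-sub σ ρ s) (trans p (sym (evalT-sub σ ρ t))))
  Sat-sub (ltF s t) σ ρ = subst₂ _<_ (evalT-sub σ ρ s) (evalT-sub σ ρ t)
                        , subst₂ _<_ (sym (evalT-sub σ ρ s)) (sym (evalT-sub σ ρ t))
  Sat-sub (inX t) {X} σ ρ = subst (_∈ X) (evalT-sub σ ρ t) , subst (_∈ X) (sym (evalT-sub σ ρ t))
  Sat-sub (negF φ) σ ρ = ¬↔ (Sat-sub φ σ ρ)
  Sat-sub (andF φ ψ) σ ρ = Sat-sub φ σ ρ ×↔ Sat-sub ψ σ ρ
  Sat-sub (orF φ ψ) σ ρ = Sat-sub φ σ ρ ⊎↔ Sat-sub ψ σ ρ
  Sat-sub (allLt t φ) σ ρ =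
      (λ p x lt → Sat-cong φ (λ _ → refl) (ext-lift σ x ρ)
         (proj₁ (Sat-sub φ (lift σ) (ext x ρ)) (p x (subst (x <_) (sym (evalT-sub σ ρ t)) lt))))
    , (λ p x lt → proj₂ (Sat-sub φ (lift σ) (ext x ρ))
         (Sat-cong φ (λ _ → refl) (λ i → sym (ext-lift σ x ρ i)) (p x (subst (x <_) (evalT-sub σ ρ t) lt))))
  Sat-sub (exLt t φ) σ ρ =
      (λ { (x , lt , p) → x , subst (x <_) (evalT-sub σ ρ t) lt ,
         Sat-cong φ (λ _ → refl) (ext-lift σ x ρ) (proj₁ (Sat-sub φ (lift σ) (ext x ρ)) p) })
    , (λ { (x , lt , p) → x , subst (x <_) (sym (evalT-sub σ ρ t)) lt ,
         proj₂ (Sat-sub φ (lift σ) (ext x ρ)) (Sat-cong φ (λ _ → refl) (λ i → sym (ext-lift σ x ρ i)) p) })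

  -- Formulas with oracles and uniform definability

  -- Formulas over a stack of partial oracles. With flag false they are Σ₁ in Z and the
  -- oracles; with flag true Π₁(Z) atoms are added, so without oracles they are Σ₂ in Z.

  PO : Set
  PO = ℕ → Maybe Bool

  Stack : Set
  Stack = ℕ → PO

  data Fm : Bool → Set where
    bf  : ∀ {l} → BForm → Fm l
    pi  : BForm → Fm true
    op  : ∀ {l} → ℕ → Term → Fm l
    on  : ∀ {l} → ℕ → Term → Fm l
    and : ∀ {l} → Fm l → Fm l → Fm l
    or  : ∀ {l} → Fm l → Fm l → Fm l
    ex  : ∀ {l} → Fm l → Fm l
    al  : ∀ {l} → Term → Fm l → Fm l

  ⟦_⟧ : ∀ {l} → Fm l → Stack → Env → Set
  ⟦ bf φ ⟧ P ρ = Sat Z ρ φ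
  ⟦ pi φ ⟧ P ρ = (x : ℕ) → Sat Z (ext x ρ) φ
  ⟦ op i t ⟧ P ρ = P i (evalT ρ t) ≡ just true
  ⟦ on i t ⟧ P ρ = P i (evalT ρ t) ≡ just false
  ⟦ and φ ψ ⟧ P ρ = ⟦ φ ⟧ P ρ × ⟦ ψ ⟧ P ρ
  ⟦ or φ ψ ⟧ P ρ = ⟦ φ ⟧ P ρ ⊎ ⟦ ψ ⟧ P ρ
  ⟦ ex φ ⟧ P ρ = Σ ℕ λ x → ⟦ φ ⟧ P (ext x ρ)
  ⟦ al t φ ⟧ P ρ = (x : ℕ) → x < evalT ρ t → ⟦ φ ⟧ P (ext x ρ)

  infix 4 _⊑_
  _⊑_ : PO → PO → Set
  O ⊑ O' = ∀ t b → O t ≡ just b → O' t ≡ just b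

  -- Both answers of an oracle are queried positively, so extending a partial oracle loses no truth.
  ⟦⟧-mono : ∀ {l} (φ : Fm l) {P Q ρ ρ'} → (∀ i → P i ⊑ Q i) → (∀ i → ρ i ≡ ρ' i) → ⟦ φ ⟧ P ρ → ⟦ φ ⟧ Q ρ'
  ⟦⟧-mono (bf φ) k h p = Sat-cong φ (λ _ → refl) h p
  ⟦⟧-mono (pi φ) k h p x = Sat-cong φ (λ _ → refl) (ext-cong x h) (p x)
  ⟦⟧-mono (op i t) {P} k h p = k i _ true (trans (cong (P i) (sym (evalT-cong t h))) p)
  ⟦⟧-mono (on i t) {P} k h p = k i _ false (trans (cong (P i) (sym (evalT-cong t h))) p)
  ⟦⟧-mono (and φ ψ) k h (p , q) = ⟦⟧-mono φ k h p , ⟦⟧-mono ψ k h q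
  ⟦⟧-mono (or φ ψ) k h (inj₁ p) = inj₁ (⟦⟧-mono φ k h p)
  ⟦⟧-mono (or φ ψ) k h (inj₂ p) = inj₂ (⟦⟧-mono ψ k h p)
  ⟦⟧-mono (ex φ) k h (x , p) = x , ⟦⟧-mono φ k (ext-cong x h) p
  ⟦⟧-mono (al t φ) k h p x lt = ⟦⟧-mono φ k (ext-cong x h) (p x (subst (x <_) (sym (evalT-cong t h)) lt))

  ⟦⟧-env : ∀ {l} (φ : Fm l) {P ρ ρ'} → (∀ i → ρ i ≡ ρ' i) → ⟦ φ ⟧ P ρ → ⟦ φ ⟧ P ρ'
  ⟦⟧-env φ h = ⟦⟧-mono φ (λ i t b e → e) h

  ⟦⟧-stack : ∀ {l} (φ : Fm l) {P Q ρ} → (∀ i t → P i t ≡ Q i t) → ⟦ φ ⟧ P ρ → ⟦ φ ⟧ Q ρ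
  ⟦⟧-stack φ k = ⟦⟧-mono φ (λ i t b e → trans (sym (k i t)) e) (λ _ → refl)

  subF : ∀ {l} → (ℕ → ℕ) → (ℕ → Term) → Fm l → Fm l
  subF ι σ (bf φ) = bf (subB σ φ)
  subF ι σ (pi φ) = pi (subB (lift σ) φ)
  subF ι σ (op i t) = op (ι i) (subT σ t)
  subF ι σ (on i t) = on (ι i) (subT σ t)
  subF ι σ (and φ ψ) = and (subF ι σ φ) (subF ι σ ψ)
  subF ι σ (or φ ψ) = or (subF ι σ φ) (subF ι σ ψ)
  subF ι σ (ex φ) = ex (subF ι (lift σ) φ)
  subF ι σ (al t φ) = al (subT σ t) (subF ι (lift σ) φ)

  ⟦⟧-sub : ∀ {l} (φ : Fm l) ι σ P ρ → ⟦ subF ι σ φ ⟧ P ρ ↔ ⟦ φ ⟧ (λ i → P (ι i)) (λ i → evalT ρ (σ i))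
  ⟦⟧-sub (bf φ) ι σ P ρ = Sat-sub φ σ ρ
  ⟦⟧-sub (pi φ) ι σ P ρ =
      (λ p x → Sat-cong φ (λ _ → refl) (ext-lift σ x ρ) (proj₁ (Sat-sub φ (lift σ) (ext x ρ)) (p x)))
    , (λ p x → proj₂ (Sat-sub φ (lift σ) (ext x ρ)) (Sat-cong φ (λ _ → refl) (λ i → sym (ext-lift σ x ρ i)) (p x)))
  ⟦⟧-sub (op i t) ι σ P ρ = trans (cong (P (ι i)) (sym (evalT-sub σ ρ t))) , trans (cong (P (ι i)) (evalT-sub σ ρ t))
  ⟦⟧-sub (on i t) ι σ P ρ = trans (cong (P (ι i)) (sym (evalT-sub σ ρ t))) , trans (cong (P (ι i)) (evalT-sub σ ρ t))
  ⟦⟧-sub (and φ ψ) ι σ P ρ = ⟦⟧-sub φ ι σ P ρ ×↔ ⟦⟧-sub ψ ι σ P ρ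
  ⟦⟧-sub (or φ ψ) ι σ P ρ = ⟦⟧-sub φ ι σ P ρ ⊎↔ ⟦⟧-sub ψ ι σ P ρ
  ⟦⟧-sub (ex φ) ι σ P ρ =
      (λ { (x , p) → x , ⟦⟧-env φ (ext-lift σ x ρ) (proj₁ (⟦⟧-sub φ ι (lift σ) P (ext x ρ)) p) })
    , (λ { (x , p) → x , proj₂ (⟦⟧-sub φ ι (lift σ) P (ext x ρ)) (⟦⟧-env φ (λ i → sym (ext-lift σ x ρ i)) p) })
  ⟦⟧-sub (al t φ) ι σ P ρ =
      (λ p x lt → ⟦⟧-env φ (ext-lift σ x ρ)
         (proj₁ (⟦⟧-sub φ ι (lift σ) P (ext x ρ)) (p x (subst (x <_) (sym (evalT-sub σ ρ t)) lt))))
    , (λ p x lt → proj₂ (⟦⟧-sub φ ι (lift σ) P (ext x ρ))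
         (⟦⟧-env φ (λ i → sym (ext-lift σ x ρ i)) (p x (subst (x <_) (evalT-sub σ ρ t) lt))))

  -- One formula serves all indices. With `PO × I` as index type the same formula is read over a
  -- total oracle and over its finite parts, which compactness requires.
  Def : Bool → {I : Set} → (I → Stack) → (I → Env → Set) → Set
  Def l Ps A = Σ (Fm l) λ φ → ∀ i ρ → A i ρ ↔ ⟦ φ ⟧ (Ps i) ρ

  module _ {l : Bool} {I : Set} {Ps : I → Stack} where

    mapD : ∀ {A B : I → Env → Set} → (∀ i ρ → A i ρ ↔ B i ρ) → Def l Ps A → Def l Ps B
    mapD h (φ , k) = φ , λ i ρ → (λ b → proj₁ (k i ρ) (proj₂ (h i ρ) b)) , (λ p → proj₁ (h i ρ) (proj₂ (k i ρ) p))

    bfD : (φ : BForm) → Def l Ps (λ i ρ → Sat Z ρ φ)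
    bfD φ = bf φ , λ i ρ → id , id

    eqD : (s t : Term) → Def l Ps (λ i ρ → evalT ρ s ≡ evalT ρ t)
    eqD s t = bfD (eqF s t)

    neD : (s t : Term) → Def l Ps (λ i ρ → ¬ evalT ρ s ≡ evalT ρ t)
    neD s t = bfD (negF (eqF s t))

    ltD : (s t : Term) → Def l Ps (λ i ρ → evalT ρ s < evalT ρ t)
    ltD s t = bfD (ltF s t)

    nltD : (s t : Term) → Def l Ps (λ i ρ → ¬ evalT ρ s < evalT ρ t)
    nltD s t = bfD (negF (ltF s t))

    andD : ∀ {A B : I → Env → Set} → Def l Ps A → Def l Ps B → Def l Ps (λ i ρ → A i ρ × B i ρ)
    andD (φ , h) (ψ , k) = and φ ψ , λ i ρ → h i ρ ×↔ k i ρ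

    orD : ∀ {A B : I → Env → Set} → Def l Ps A → Def l Ps B → Def l Ps (λ i ρ → A i ρ ⊎ B i ρ)
    orD (φ , h) (ψ , k) = or φ ψ , λ i ρ → h i ρ ⊎↔ k i ρ

    exD : ∀ {A : I → Env → Set} → Def l Ps A → Def l Ps (λ i ρ → Σ ℕ λ x → A i (ext x ρ))
    exD (φ , h) = ex φ , λ i ρ →
      (λ { (x , a) → x , proj₁ (h i (ext x ρ)) a }) , (λ { (x , a) → x , proj₂ (h i (ext x ρ)) a })

    alD : ∀ {A : I → Env → Set} (t : Term) → Def l Ps A → Def l Ps (λ i ρ → (x : ℕ) → x < evalT ρ t → A i (ext x ρ))
    alD t (φ , h) = al t φ , λ i ρ →
      (λ a x lt → proj₁ (h i (ext x ρ)) (a x lt)) , (λ a x lt → proj₂ (h i (ext x ρ)) (a x lt))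

    -- Oracle atoms cannot be negated, so the negated premise must come with a definition `N` of its
    -- own.
    impD : ∀ {N A B : I → Env → Set} → (∀ i ρ → N i ρ ↔ (¬ A i ρ)) → Def l Ps N → Def l Ps B →
      Def l Ps (λ i ρ → A i ρ → B i ρ)
    impD e n b = mapD (λ i ρ →
        (λ { (inj₁ n) a → ⊥-elim (proj₁ (e i ρ) n a) ; (inj₂ b) _ → b })
      , (λ f → or-else λ nn → f (dne λ na → nn (proj₂ (e i ρ) na)))) (orD n b)

    opD : ∀ k (t : Term) → Def l Ps (λ i ρ → Ps i k (evalT ρ t) ≡ just true)
    opD k t = op k t , λ i ρ → id , id

    onD : ∀ k (t : Term) → Def l Ps (λ i ρ → Ps i k (evalT ρ t) ≡ just false)
    onD k t = on k t , λ i ρ → id , id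

    constD : (Q : Set) → Def l Ps (λ _ _ → Q)
    constD Q with em {Q}
    ... | yes q = bf (eqF (lit 0) (lit 0)) , λ i ρ → (λ _ → refl) , (λ _ → q)
    ... | no nq = bf (ltF (lit 0) (lit 0)) , λ i ρ → (λ q → ⊥-elim (nq q)) , (λ ())

    subD : ∀ {A : I → Env → Set} (σ : ℕ → Term) → Def l Ps A → Def l Ps (λ i ρ → A i (λ j → evalT ρ (σ j)))
    subD σ (φ , h) = subF id σ φ , λ i ρ →
        (λ a → proj₂ (⟦⟧-sub φ id σ (Ps i) ρ) (proj₁ (h i _) a))
      , (λ a → proj₂ (h i _) (proj₁ (⟦⟧-sub φ id σ (Ps i) ρ) a))

  reD : ∀ {l I J} {Ps : I → Stack} {Qs : J → Stack} {A : I → Env → Set} (g : J → I) (ι : ℕ → ℕ) →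
    (∀ j k t → Ps (g j) k t ≡ Qs j (ι k) t) → Def l Ps A → Def l Qs (λ j ρ → A (g j) ρ)
  reD {Ps = Ps} {Qs} g ι e (φ , h) = subF ι var φ , λ j ρ →
      (λ a → proj₂ (⟦⟧-sub φ ι var (Qs j) ρ) (⟦⟧-stack φ (e j) (proj₁ (h (g j) ρ) a)))
    , (λ a → proj₂ (h (g j) ρ) (⟦⟧-stack φ (λ k t → sym (e j k t)) (proj₁ (⟦⟧-sub φ ι var (Qs j) ρ) a)))

  -- Prenex normal forms: all unbounded ∃ are bounded by a, all unbounded ∀ by b.

  ∅ˢ : Stack
  ∅ˢ _ _ = nothing

  Ev : ∀ {l} → ℕ → ℕ → Env → Fm l → Set
  Ev a b ρ (bf φ) = Sat Z ρ φ
  Ev a b ρ (pi φ) = (x : ℕ) → x < b → Sat Z (ext x ρ) φ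
  Ev a b ρ (op i t) = ⊥
  Ev a b ρ (on i t) = ⊥
  Ev a b ρ (and φ ψ) = Ev a b ρ φ × Ev a b ρ ψ
  Ev a b ρ (or φ ψ) = Ev a b ρ φ ⊎ Ev a b ρ ψ
  Ev a b ρ (ex φ) = Σ ℕ λ x → x < a × Ev a b (ext x ρ) φ
  Ev a b ρ (al t φ) = (x : ℕ) → x < evalT ρ t → Ev a b (ext x ρ) φ

  bnd : ∀ {l} → Fm l → (ℕ → ℕ) → ℕ → ℕ → BForm
  bnd (bf φ) σ ja jb = subB (λ i → var (σ i)) φ
  bnd (pi φ) σ ja jb = allLt (var jb) (subB (λ i → var (liftn σ i)) φ)
  bnd (op i t) σ ja jb = ltF (lit 0) (lit 0)
  bnd (on i t) σ ja jb = ltF (lit 0) (lit 0)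
  bnd (and φ ψ) σ ja jb = andF (bnd φ σ ja jb) (bnd ψ σ ja jb)
  bnd (or φ ψ) σ ja jb = orF (bnd φ σ ja jb) (bnd ψ σ ja jb)
  bnd (ex φ) σ ja jb = exLt (var ja) (bnd φ (liftn σ) (suc ja) (suc jb))
  bnd (al t φ) σ ja jb = allLt (subT (λ i → var (σ i)) t) (bnd φ (liftn σ) (suc ja) (suc jb))

  Ev-cong : ∀ {l} (φ : Fm l) {a b ρ ρ'} → (∀ i → ρ i ≡ ρ' i) → Ev a b ρ φ → Ev a b ρ' φ
  Ev-cong (bf φ) h p = Sat-cong φ (λ _ → refl) h p
  Ev-cong (pi φ) h p x lt = Sat-cong φ (λ _ → refl) (ext-cong x h) (p x lt)
  Ev-cong (and φ ψ) h (p , q) = Ev-cong φ h p , Ev-cong ψ h q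
  Ev-cong (or φ ψ) h (inj₁ p) = inj₁ (Ev-cong φ h p)
  Ev-cong (or φ ψ) h (inj₂ p) = inj₂ (Ev-cong ψ h p)
  Ev-cong (ex φ) h (x , lt , p) = x , lt , Ev-cong φ (ext-cong x h) p
  Ev-cong (al t φ) h p x lt = Ev-cong φ (ext-cong x h) (p x (subst (x <_) (sym (evalT-cong t h)) lt))

  bnd-ok : ∀ {l} (φ : Fm l) σ ja jb ρ → Sat Z ρ (bnd φ σ ja jb) ↔ Ev (ρ ja) (ρ jb) (λ i → ρ (σ i)) φ
  bnd-ok (bf φ) σ ja jb ρ = Sat-sub φ (λ i → var (σ i)) ρ
  bnd-ok (pi φ) σ ja jb ρ =
      (λ p x lt → Sat-cong φ (λ _ → refl) (ext-liftn σ x ρ) (proj₁ (Sat-sub φ _ (ext x ρ)) (p x lt)))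
    , (λ p x lt → proj₂ (Sat-sub φ _ (ext x ρ)) (Sat-cong φ (λ _ → refl) (λ i → sym (ext-liftn σ x ρ i)) (p x lt)))
  bnd-ok (op i t) σ ja jb ρ = (λ ()) , (λ ())
  bnd-ok (on i t) σ ja jb ρ = (λ ()) , (λ ())
  bnd-ok (and φ ψ) σ ja jb ρ = bnd-ok φ σ ja jb ρ ×↔ bnd-ok ψ σ ja jb ρ
  bnd-ok (or φ ψ) σ ja jb ρ = bnd-ok φ σ ja jb ρ ⊎↔ bnd-ok ψ σ ja jb ρ
  bnd-ok (ex φ) σ ja jb ρ =
      (λ { (x , lt , p) → x , lt , Ev-cong φ (ext-liftn σ x ρ) (proj₁ (bnd-ok φ _ (suc ja) (suc jb) (ext x ρ)) p) })
    , (λ { (x , lt , p) → x , lt ,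
         proj₂ (bnd-ok φ _ (suc ja) (suc jb) (ext x ρ)) (Ev-cong φ (λ i → sym (ext-liftn σ x ρ i)) p) })
  bnd-ok (al t φ) σ ja jb ρ =
      (λ p x lt → Ev-cong φ (ext-liftn σ x ρ)
         (proj₁ (bnd-ok φ _ (suc ja) (suc jb) (ext x ρ)) (p x (subst (x <_) (sym (evalT-sub _ ρ t)) lt))))
    , (λ p x lt → proj₂ (bnd-ok φ _ (suc ja) (suc jb) (ext x ρ))
         (Ev-cong φ (λ i → sym (ext-liftn σ x ρ i)) (p x (subst (x <_) (evalT-sub _ ρ t) lt))))

  Ev-mono : ∀ {l} (φ : Fm l) {a a' b b' ρ} → a ≤ a' → b' ≤ b → Ev a b ρ φ → Ev a' b' ρ φ
  Ev-mono (bf φ) ha hb p = p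
  Ev-mono (pi φ) ha hb p x lt = p x (<-≤-trans lt hb)
  Ev-mono (and φ ψ) ha hb (p , q) = Ev-mono φ ha hb p , Ev-mono ψ ha hb q
  Ev-mono (or φ ψ) ha hb (inj₁ p) = inj₁ (Ev-mono φ ha hb p)
  Ev-mono (or φ ψ) ha hb (inj₂ p) = inj₂ (Ev-mono ψ ha hb p)
  Ev-mono (ex φ) ha hb (x , lt , p) = x , <-≤-trans lt ha , Ev-mono φ ha hb p
  Ev-mono (al t φ) ha hb p x lt = Ev-mono φ ha hb (p x lt)

  -- The witnesses are chosen independently of `b`; only a bounded universal quantifier needs a
  -- maximum of finitely many bounds.
  Ev-complete : ∀ {l} (φ : Fm l) ρ → ⟦ φ ⟧ ∅ˢ ρ → Σ ℕ λ a → ∀ b → Ev a b ρ φ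
  Ev-complete (bf φ) ρ p = 0 , λ b → p
  Ev-complete (pi φ) ρ p = 0 , λ b x lt → p x
  Ev-complete (op i t) ρ ()
  Ev-complete (on i t) ρ ()
  Ev-complete (and φ ψ) ρ (p , q) with Ev-complete φ ρ p | Ev-complete ψ ρ q
  ... | a , f | a' , g = a ⊔ a' , λ b → Ev-mono φ (m≤m⊔n a a') ≤-refl (f b) , Ev-mono ψ (m≤n⊔m a a') ≤-refl (g b)
  Ev-complete (or φ ψ) ρ (inj₁ p) with Ev-complete φ ρ p
  ... | a , f = a , λ b → inj₁ (f b)
  Ev-complete (or φ ψ) ρ (inj₂ p) with Ev-complete ψ ρ p
  ... | a , f = a , λ b → inj₂ (f b)
  Ev-complete (ex φ) ρ (x , p) with Ev-complete φ (ext x ρ) p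
  ... | a , f = a ⊔ suc x , λ b → x , m≤n⊔m a (suc x) , Ev-mono φ (m≤m⊔n a (suc x)) ≤-refl (f b)
  Ev-complete (al t φ) ρ p with bounded {λ x a → ∀ b → Ev a b (ext x ρ) φ} (λ le h b → Ev-mono φ le ≤-refl (h b))
                                 (evalT ρ t) (λ x lt → Ev-complete φ (ext x ρ) (p x lt))
  ... | a , f = a , λ b x lt → f x lt b

  -- Truth for every `b` has to commit to one disjunct and one witness. As truth decreases with `b`,
  -- a disjunct that fails once fails from then on, and one of the finitely many `x < a` works for
  -- all `b`.
  Ev-sound : ∀ {l} (φ : Fm l) P ρ a → (∀ b → Ev a b ρ φ) → ⟦ φ ⟧ P ρ
  Ev-sound (bf φ) P ρ a h = h 0
  Ev-sound (pi φ) P ρ a h x = h (suc x) x ≤-refl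
  Ev-sound (op i t) P ρ a h = ⊥-elim (h 0)
  Ev-sound (on i t) P ρ a h = ⊥-elim (h 0)
  Ev-sound (and φ ψ) P ρ a h = Ev-sound φ P ρ a (λ b → proj₁ (h b)) , Ev-sound ψ P ρ a (λ b → proj₂ (h b))
  Ev-sound (or φ ψ) P ρ a h with em {∀ b → Ev a b ρ φ}
  ... | yes k = inj₁ (Ev-sound φ P ρ a k)
  ... | no nk with ¬∀⇒∃¬ nk
  ...   | b₀ , n₀ = inj₂ (Ev-sound ψ P ρ a λ b → pick b (h (b ⊔ b₀)))
    where
      pick : ∀ b → Ev a (b ⊔ b₀) ρ φ ⊎ Ev a (b ⊔ b₀) ρ ψ → Ev a b ρ ψ
      pick b (inj₁ p) = ⊥-elim (n₀ (Ev-mono φ ≤-refl (m≤n⊔m b b₀) p))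
      pick b (inj₂ p) = Ev-mono ψ ≤-refl (m≤m⊔n b b₀) p
  Ev-sound (ex φ) P ρ a h with pigeonhole {λ x b → Ev a b (ext x ρ) φ} (λ le → Ev-mono φ ≤-refl le) a h
  ... | x , _ , k = x , Ev-sound φ P (ext x ρ) a k
  Ev-sound (al t φ) P ρ a h x lt = Ev-sound φ P (ext x ρ) a (λ b → h b x lt)

  Ev-Σ₁ : (φ : Fm false) → ∀ {ρ a b b'} → Ev a b ρ φ → Ev a b' ρ φ
  Ev-Σ₁ (bf φ) p = p
  Ev-Σ₁ (and φ ψ) (p , q) = Ev-Σ₁ φ p , Ev-Σ₁ ψ q
  Ev-Σ₁ (or φ ψ) (inj₁ p) = inj₁ (Ev-Σ₁ φ p)
  Ev-Σ₁ (or φ ψ) (inj₂ p) = inj₂ (Ev-Σ₁ ψ p)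
  Ev-Σ₁ (ex φ) (x , lt , p) = x , lt , Ev-Σ₁ φ p
  Ev-Σ₁ (al t φ) p x lt = Ev-Σ₁ φ (p x lt)

  -- Without oracles and `pi` atoms a formula is Σ₁ in `Z`, so its negation is a single `pi` atom.
  -- The new variable stands for both bounds of the prenex form, which is harmless by `Ev-Σ₁`.
  negD : ∀ {I} {Ps : I → Stack} {A : Env → Set} → Def false {⊤} (λ _ → ∅ˢ) (λ _ → A) → Def true Ps (λ _ ρ → ¬ A ρ)
  negD {A = A} (φ , h) = pi (negF (bnd φ suc 0 0)) , λ i ρ →
      (λ na x s → na (proj₂ (h tt ρ) (Ev-sound φ ∅ˢ ρ x (λ b → Ev-Σ₁ φ (proj₁ (bnd-ok φ suc 0 0 (ext x ρ)) s)))))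
    , (λ s p → let (a , k) = Ev-complete φ ρ (proj₁ (h tt ρ) p)
                in s a (proj₂ (bnd-ok φ suc 0 0 (ext a ρ)) (k a)))

  Σ₂-of : (φ : Fm true) (ρ : Env) (X : SetN) → (∀ n → n ∈ X ↔ ⟦ φ ⟧ ∅ˢ (ext n ρ)) → Sigma2 Z X
  Σ₂-of φ ρ X h = θ , λ n →
      (λ p → let (a , k) = Ev-complete ψ (ext n ρ₀) (proj₂ (ψ-ok n) (proj₁ (h n) p))
             in a , λ b → proj₂ (bnd-ok ψ σ 1 0 _) (Ev-cong ψ (env≡ n a b) (k b)))
    , (λ { (a , s) → proj₂ (h n) (proj₁ (ψ-ok n) (Ev-sound ψ ∅ˢ (ext n ρ₀) a
             (λ b → Ev-cong ψ (λ i → sym (env≡ n a b i)) (proj₁ (bnd-ok ψ σ 1 0 _) (s b))))) })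
    where
      τ : ℕ → Term
      τ zero = var 0
      τ (suc i) = lit (ρ i)
      ψ : Fm true
      ψ = subF id τ φ
      σ : ℕ → ℕ
      σ i = suc (suc i)
      θ : BForm
      θ = bnd ψ σ 1 0
      env≡ : ∀ n a b i → ext n ρ₀ i ≡ ext b (ext a (ext n ρ₀)) (σ i)
      env≡ n a b i = refl
      τ≡ : ∀ n i → evalT (ext n ρ₀) (τ i) ≡ ext n ρ i
      τ≡ n zero = refl
      τ≡ n (suc i) = refl
      ψ-ok : ∀ n → ⟦ ψ ⟧ ∅ˢ (ext n ρ₀) ↔ ⟦ φ ⟧ ∅ˢ (ext n ρ)
      ψ-ok n = (λ p → ⟦⟧-env φ (τ≡ n) (proj₁ (⟦⟧-sub φ id τ ∅ˢ (ext n ρ₀)) p))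
             , (λ p → proj₂ (⟦⟧-sub φ id τ ∅ˢ (ext n ρ₀)) (⟦⟧-env φ (λ i → sym (τ≡ n i)) p))

  -- Arithmetical definitions of exponentiation and of binary digits

  -- Gödel-style divisibility codes: z belongs to (u , v) iff modulus v z divides u.

  modulus : ℕ → ℕ → ℕ
  modulus v z = 1 + (z + 1) * v

  private
    d∣N! : ∀ N d → 0 < d → d ≤ N → d ∣ N !
    d∣N! zero d pos le = ⊥-elim (<⇒≱ pos le)
    d∣N! (suc N) d pos le with m≤n⇒m<n∨m≡n le
    ... | inj₁ (s≤s lt) = ∣n⇒∣m*n (suc N) (d∣N! N d pos lt)
    ... | inj₂ refl = m∣m*n (N !)

    -- By `cross`, a common divisor of the moduli at `i` and `i + k` divides `k`, hence `N !`, hence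
    -- 1.
    moduli-coprime : ∀ N i j → i < N → j < N → i ≢ j → Coprime (modulus (N !) i) (modulus (N !) j)
    moduli-coprime N i j i<N j<N i≢j {d} (di , dj) = ∣1⇒≡1 (∣m+n∣m⇒∣n (subst (d ∣_) (+-comm 1 ((i + 1) * N !)) di) (∣n⇒∣m*n (i + 1) d∣v))
      where
        v = N !
        cross : ∀ i k v → (i + 1) * (1 + ((i + k) + 1) * v) + k ≡ ((i + k) + 1) * (1 + (i + 1) * v)
        cross = solve-∀
        gap : ∀ i k → d ∣ modulus v i → d ∣ modulus v (i + k) → d ∣ k
        gap i k di dk = ∣m+n∣m⇒∣n (subst (d ∣_) (sym (cross i k v)) (∣n⇒∣m*n ((i + k) + 1) di)) (∣n⇒∣m*n (i + 1) dk)
        use : ∀ i j → i < j → j < N → d ∣ modulus v i → d ∣ modulus v j → d ∣ v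
        use i j i<j j<N di dj = ∣-trans
          (gap i (j ∸ i) di (subst (λ k → d ∣ modulus v k) (sym (m+[n∸m]≡n (<⇒≤ i<j))) dj))
          (d∣N! N (j ∸ i) (m<n⇒0<n∸m i<j) (≤-trans (m∸n≤m j i) (<⇒≤ j<N)))
        d∣v : d ∣ v
        d∣v with <-cmp i j
        ... | tri< lt _ _ = use i j lt j<N di dj
        ... | tri> _ _ gt = use j i gt i<N dj di
        ... | tri≈ _ e _ = ⊥-elim (i≢j e)

  -- `u` is the product of the moduli of the elements; by coprimality no other modulus below `N`
  -- divides it.
  divcode : (Q : ℕ → Set) (N : ℕ) → Σ ℕ λ u → Σ ℕ λ v → ∀ z → z < N → Q z ↔ (modulus v z ∣ u)
  divcode Q N = proj₁ (go N ≤-refl) , N ! , λ z lt → proj₁ (proj₂ (go N ≤-refl)) z lt , proj₂ (proj₂ (go N ≤-refl)) z lt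
    where
      v = N !
      1≤v : 1 ≤ v
      1≤v = n!>0 N
        where
          n!>0 : ∀ n → 1 ≤ n !
          n!>0 zero = ≤-refl
          n!>0 (suc n) = ≤-trans (n!>0 n) (m≤m+n (n !) (n * n !))
      go : ∀ k → k ≤ N → Σ ℕ λ u → (∀ z → z < k → Q z → modulus v z ∣ u) × (∀ z → z < N → modulus v z ∣ u → Q z)
      go zero _ = 1 , (λ z ()) , λ z lt d → ⊥-elim (absurd z (∣1⇒≡1 d))
        where
          absurd : ∀ z → modulus v z ≢ 1
          absurd z e = <-irrefl (sym (suc-injective e)) (*-mono-≤ (m≤n+m 1 z) 1≤v)
      go (suc k) le with go k (<⇒≤ le) | em {Q k}
      ... | u , f , g | no nq = u , f' , g
        where
          f' : ∀ z → z < suc k → Q z → modulus v z ∣ u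
          f' z lt q with m<1+n⇒m<n∨m≡n lt
          ... | inj₁ lt' = f z lt' q
          ... | inj₂ refl = ⊥-elim (nq q)
      ... | u , f , g | yes q = modulus v k * u , f' , g'
        where
          f' : ∀ z → z < suc k → Q z → modulus v z ∣ modulus v k * u
          f' z lt qz with m<1+n⇒m<n∨m≡n lt
          ... | inj₁ lt' = ∣n⇒∣m*n (modulus v k) (f z lt' qz)
          ... | inj₂ refl = m∣m*n u
          g' : ∀ z → z < N → modulus v z ∣ modulus v k * u → Q z
          g' z lt d with z ≟ k
          ... | yes refl = q
          ... | no z≢k = g z lt (coprime-divisor (moduli-coprime N z k lt le z≢k) d)

  prT : Term → Term → Term
  prT s t = plus (times (plus s t) (plus s t)) s

  evalT-prT : ∀ ρ s t → evalT ρ (prT s t) ≡ pr (evalT ρ s) (evalT ρ t)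
  evalT-prT ρ s t = sym (pr-def (evalT ρ s) (evalT ρ t))

  pr-mono : ∀ {x x' y y'} → x ≤ x' → y ≤ y' → pr x y ≤ pr x' y'
  pr-mono {x} {x'} {y} {y'} h k = subst₂ _≤_ (sym (pr-def x y)) (sym (pr-def x' y'))
    (+-mono-≤ (*-mono-≤ (+-mono-≤ h k) (+-mono-≤ h k)) h)

  private
    dvB : Term → ℕ → ℕ → BForm
    dvB t jv ju = exLt (plus (var ju) (lit 1))
      (eqF (var (suc ju)) (times (var 0) (plus (lit 1) (times (plus (wk t) (lit 1)) (var (suc jv))))))

    dvB-ok : ∀ t jv ju ρ → Sat Z ρ (dvB t jv ju) ↔ (modulus (ρ jv) (evalT ρ t) ∣ ρ ju)
    dvB-ok t jv ju ρ =
        (λ { (k , _ , e) → divides k (trans e (cong (λ w → k * (1 + (w + 1) * ρ jv)) (evalT-wk k ρ t))) })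
      , (λ { (divides k e) → k , ≤-<-trans (subst (k ≤_) (sym e) (m≤m*n k (modulus (ρ jv) (evalT ρ t))))
                                (subst (ρ ju <_) (+-comm 1 (ρ ju)) ≤-refl)
           , trans e (cong (λ w → k * (1 + (w + 1) * ρ jv)) (sym (evalT-wk k ρ t))) })

    -- p ≡ 2 ^ x is witnessed by a code of a set containing (x , p) whose elements (i , q)
    -- are (0 , 1) or of the form (i' + 1 , 2 q') with (i' , q') in the set.
    powStep : BForm
    powStep = orF (andF (eqF (var 1) (lit 0)) (eqF (var 0) (lit 1)))
      (exLt (var 1) (exLt (plus (var 1) (lit 1))
        (andF (eqF (var 3) (plus (lit 1) (var 1)))
          (andF (eqF (var 2) (plus (var 0) (var 0))) (dvB (prT (var 1) (var 0)) 4 5)))))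

    powB : BForm
    powB = andF (dvB (prT (var 2) (var 3)) 0 1)
      (allLt (plus (lit 1) (var 2)) (allLt (plus (lit 1) (var 4))
        (orF (negF (dvB (prT (var 1) (var 0)) 2 3)) powStep)))

    powB-sound : ∀ ρ → Sat Z ρ powB → ρ 3 ≡ 2 ^ ρ 2
    powB-sound ρ (top , all) = go (ρ 2) (ρ 3) ≤-refl ≤-refl top
      where
        go : ∀ i q → i ≤ ρ 2 → q ≤ ρ 3 → Sat Z (ext q (ext i ρ)) (dvB (prT (var 1) (var 0)) 2 3) → q ≡ 2 ^ i
        go i q hi hq d with all i (s≤s hi) q (s≤s hq)
        ... | inj₁ nd = ⊥-elim (nd d)
        ... | inj₂ (inj₁ (refl , refl)) = refl
        go (suc i) q hi hq d | inj₂ (inj₂ (i' , i'< , q' , q'< , refl , refl , d')) =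
          subst (λ k → q' + q' ≡ q' + k) (sym (+-identityʳ q')) refl ∙ cong₂ (λ a b → a + (b + 0)) r r
          where
            _∙_ = trans
            r : q' ≡ 2 ^ i
            r = go i q' (<⇒≤ hi) (≤-trans (m≤m+n q' q') hq) d'

    powB-complete : ∀ ρ → ρ 1 ≡ 2 ^ ρ 0 → Σ ℕ λ u → Σ ℕ λ v → Sat Z (ext v (ext u ρ)) powB
    powB-complete ρ e = u , v , inside x ≤-refl p e , λ i hi q hq → body i (≤-pred hi) q (≤-pred hq)
      where
        x = ρ 0
        p = ρ 1
        Q : ℕ → Set
        Q z = Σ ℕ λ i → i ≤ x × z ≡ pr i (2 ^ i)
        N = suc (pr x p)
        u = proj₁ (divcode Q N)
        v = proj₁ (proj₂ (divcode Q N))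
        ok : ∀ z → z < N → Q z ↔ (modulus v z ∣ u)
        ok = proj₂ (proj₂ (divcode Q N))
        σ : Env
        σ = ext v (ext u ρ)
        2^≤ : ∀ {i} → i ≤ x → 2 ^ i ≤ p
        2^≤ h = subst (_ ≤_) (sym e) (^-monoʳ-≤ 2 h)
        inside : ∀ i → i ≤ x → ∀ q → q ≡ 2 ^ i → Sat Z (ext v (ext u (ext i (ext q ρ)))) (dvB (prT (var 2) (var 3)) 0 1)
        inside i hi q refl = proj₂ (dvB-ok (prT (var 2) (var 3)) 0 1 (ext v (ext u (ext i (ext q ρ)))))
          (subst (λ w → modulus v w ∣ u) (pr-def i q) (proj₁ (ok (pr i q) (s≤s (pr-mono hi (2^≤ hi)))) (i , hi , refl)))
        body : ∀ i → i ≤ x → ∀ q → q ≤ p → Sat Z (ext q (ext i σ)) (orF (negF (dvB (prT (var 1) (var 0)) 2 3)) powStep)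
        body i hi q hq with em {Sat Z (ext q (ext i σ)) (dvB (prT (var 1) (var 0)) 2 3)}
        ... | no nd = inj₁ nd
        ... | yes d with proj₂ (ok (pr i q) (s≤s (pr-mono hi hq)))
                (subst (λ w → modulus v w ∣ u) (sym (pr-def i q)) (proj₁ (dvB-ok (prT (var 1) (var 0)) 2 3 (ext q (ext i σ))) d))
        ...   | i₀ , _ , eq with pr-inj₁ {i} {q} eq | pr-inj₂ {i} {q} eq
        body zero hi q hq | yes d | _ | refl | refl = inj₂ (inj₁ (refl , refl))
        body (suc i) hi q hq | yes d | _ | refl | refl = inj₂ (inj₂
          (i , ≤-refl , 2 ^ i , subst (2 ^ i <_) (+-comm 1 q) (s≤s (m≤m+n (2 ^ i) (2 ^ i + 0)))
          , refl , cong (λ k → 2 ^ i + k) (+-identityʳ (2 ^ i))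
          , inside' i (<⇒≤ hi)))
          where
            inside' : ∀ j → j ≤ x → Sat Z (ext (2 ^ j) (ext j (ext q (ext (suc i) σ)))) (dvB (prT (var 1) (var 0)) 4 5)
            inside' j hj = proj₂ (dvB-ok (prT (var 1) (var 0)) 4 5 (ext (2 ^ j) (ext j (ext q (ext (suc i) σ)))))
              (subst (λ w → modulus v w ∣ u) (pr-def j (2 ^ j)) (proj₁ (ok (pr j (2 ^ j)) (s≤s (pr-mono hj (2^≤ hj)))) (j , hj , refl)))

  pair : Term → Term → ℕ → Term
  pair s t zero = s
  pair s t (suc zero) = t
  pair s t (suc (suc i)) = var i

  module _ {l : Bool} {I : Set} {Ps : I → Stack} where

    powD : (s t : Term) → Def l Ps (λ i ρ → evalT ρ t ≡ 2 ^ evalT ρ s)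
    powD s t = subD {A = λ i ρ → ρ 1 ≡ 2 ^ ρ 0} (pair s t) (mapD
      (λ i ρ → (λ { (u , v , h) → powB-sound (ext v (ext u ρ)) h }) , powB-complete ρ) (exD (exD (bfD powB))))

  -- With `bit-exists`, this expresses a binary digit by one division with remainder, so that beyond
  -- the graph of `2 ^ x` no recursion has to be formalized.
  bit-unique : ∀ x e q r b → r < 2 ^ x → e ≡ (q + q + b2n b) * 2 ^ x + r → bit e x ≡ b
  bit-unique zero e q zero b _ refl = trans (bit-0 _) (trans (cong par (trans (+-identityʳ ((q + q + b2n b) * 1)) (*-identityʳ (q + q + b2n b)))) (par-double q b))
  bit-unique zero e q (suc r) b (s≤s ()) _
  bit-unique (suc x) e q r b lt refl =
    trans (bit-suc _ x) (bit-unique x _ q (half r) b half< (trans (cong half e≡) (half-double k (par r))))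
    where
      k = (q + q + b2n b) * 2 ^ x + half r
      eq : ∀ a h w p → a * (w + (w + 0)) + (h + h + p) ≡ (a * w + h) + (a * w + h) + p
      eq = solve-∀
      e≡ : (q + q + b2n b) * 2 ^ suc x + r ≡ k + k + b2n (par r)
      e≡ = trans (cong ((q + q + b2n b) * 2 ^ suc x +_) (half-eq r)) (eq (q + q + b2n b) (half r) (2 ^ x) (b2n (par r)))
      half< : half r < 2 ^ x
      half< = ≰⇒> λ le → <⇒≱ lt (≤-trans (+-mono-≤ le (subst (_≤ half r) (sym (+-identityʳ (2 ^ x))) le))
        (subst (half r + half r ≤_) (sym (half-eq r)) (m≤m+n _ _)))

  bit-exists : ∀ x e → Σ ℕ λ q → Σ ℕ λ r → r < 2 ^ x × e ≡ (q + q + b2n (bit e x)) * 2 ^ x + r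
  bit-exists zero e = half e , 0 , s≤s z≤n , trans (half-eq e) (trans (cong (λ b → half e + half e + b2n b) (sym (bit-0 e)))
    (sym (trans (+-identityʳ _) (*-identityʳ _))))
  bit-exists (suc x) e with bit-exists x (half e)
  ... | q , r , lt , h = q , r + r + b2n (par e) , lt' , trans (half-eq e)
    (trans (cong (λ k → k + k + b2n (par e)) h)
    (trans (eq (q + q + b2n (bit (half e) x)) r (2 ^ x) (b2n (par e)))
           (cong (λ b → (q + q + b2n b) * 2 ^ suc x + (r + r + b2n (par e))) (sym (bit-suc e x)))))
    where
      eq : ∀ a r w p → (a * w + r) + (a * w + r) + p ≡ a * (w + (w + 0)) + (r + r + p)
      eq = solve-∀
      b≤1 : ∀ b → b2n b ≤ 1
      b≤1 true = ≤-refl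
      b≤1 false = z≤n
      re : ∀ r → suc (r + r + 1) ≡ suc r + (suc r + 0)
      re = solve-∀
      lt' : r + r + b2n (par e) < 2 ^ suc x
      lt' = ≤-trans (s≤s (+-monoʳ-≤ (r + r) (b≤1 (par e)))) (≤-trans (≤-reflexive (re r)) (+-mono-≤ lt (+-monoˡ-≤ 0 lt)))

  module _ {l : Bool} {I : Set} {Ps : I → Stack} where

    bitD : (b : Bool) (s t : Term) → Def l Ps (λ i ρ → bit (evalT ρ s) (evalT ρ t) ≡ b)
    bitD b s t = subD {A = λ i ρ → bit (ρ 0) (ρ 1) ≡ b} (pair s t) (mapD
      (λ i ρ → (λ { (q , r , p , p≡ , r< , e) →
                    bit-unique (ρ 1) (ρ 0) q r b (subst (r <_) p≡ r<) (trans e (cong (λ w → (q + q + b2n b) * w + r) p≡)) })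
             , (λ { refl → let (q , r , lt , e) = bit-exists (ρ 1) (ρ 0) in q , r , 2 ^ ρ 1 , refl , lt , e }))
      (exD (exD (exD (andD (powD (var 4) (var 0)) (andD (ltD (var 1) (var 0))
        (eqD (var 3) (plus (times (plus (plus (var 2) (var 2)) (lit (b2n b))) (var 0)) (var 1)))))))))

  -- Compactness for oracles

  tot : SetN → PO
  tot X t = just (X t)

  opaque
    fin : SetN → ℕ → PO
    fin X m t with t <? m
    ... | yes _ = just (X t)
    ... | no _ = nothing

    fin⁺ : ∀ {X m t b} → t < m → X t ≡ b → fin X m t ≡ just b
    fin⁺ {X} {m} {t} lt e with t <? m
    ... | yes _ = cong just e
    ... | no n = ⊥-elim (n lt)

    fin⁻ : ∀ {X m t b} → fin X m t ≡ just b → t < m × X t ≡ b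
    fin⁻ {X} {m} {t} e with t <? m
    fin⁻ e | yes lt = lt , just-injective e
    fin⁻ () | no _

  fin⊑tot : ∀ X m → fin X m ⊑ tot X
  fin⊑tot X m t b e = cong just (proj₂ (fin⁻ {X} {m} e))

  fin-mono : ∀ X {m m'} → m ≤ m' → fin X m ⊑ fin X m'
  fin-mono X {m} le t b e = let (lt , x) = fin⁻ {X} {m} e in fin⁺ (<-≤-trans lt le) x

  fin-agree : ∀ {X Y m} → (∀ t → t < m → X t ≡ Y t) → fin X m ⊑ fin Y m
  fin-agree {X} {Y} {m} h t b e = let (lt , x) = fin⁻ {X} {m} e in fin⁺ lt (trans (sym (h t lt)) x)

  infixr 5 _∷ˢ_
  _∷ˢ_ : PO → Stack → Stack
  (O ∷ˢ P) zero = O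
  (O ∷ˢ P) (suc i) = P i

  ∷-mono : ∀ {O O' P} → O ⊑ O' → ∀ i → (O ∷ˢ P) i ⊑ (O' ∷ˢ P) i
  ∷-mono h zero = h
  ∷-mono h (suc i) t b e = e

  cons-mono : ∀ {l} (φ : Fm l) {O O' P ρ} → O ⊑ O' → ⟦ φ ⟧ (O ∷ˢ P) ρ → ⟦ φ ⟧ (O' ∷ˢ P) ρ
  cons-mono φ {O} {O'} {P} h = ⟦⟧-mono φ (∷-mono {O} {O'} {P} h) (λ _ → refl)

  -- A true formula consults the top oracle finitely often, and by monotonicity the bounds for its
  -- parts can be merged.
  finite-use : ∀ {l} (φ : Fm l) X P ρ → ⟦ φ ⟧ (tot X ∷ˢ P) ρ → ∃ λ m → ⟦ φ ⟧ (fin X m ∷ˢ P) ρ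
  finite-use (bf φ) X P ρ p = 0 , p
  finite-use (pi φ) X P ρ p = 0 , p
  finite-use (op zero t) X P ρ p = suc (evalT ρ t) , fin⁺ ≤-refl (just-injective p)
  finite-use (op (suc i) t) X P ρ p = 0 , p
  finite-use (on zero t) X P ρ p = suc (evalT ρ t) , fin⁺ ≤-refl (just-injective p)
  finite-use (on (suc i) t) X P ρ p = 0 , p
  finite-use (and φ ψ) X P ρ (p , q) with finite-use φ X P ρ p | finite-use ψ X P ρ q
  ... | m , p' | m' , q' = m ⊔ m' , cons-mono φ (fin-mono X (m≤m⊔n m m')) p' , cons-mono ψ (fin-mono X (m≤n⊔m m m')) q'
  finite-use (or φ ψ) X P ρ (inj₁ p) with finite-use φ X P ρ p
  ... | m , p' = m , inj₁ p'
  finite-use (or φ ψ) X P ρ (inj₂ p) with finite-use ψ X P ρ p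
  ... | m , p' = m , inj₂ p'
  finite-use (ex φ) X P ρ (x , p) with finite-use φ X P (ext x ρ) p
  ... | m , p' = m , x , p'
  finite-use (al t φ) X P ρ p = bounded {λ x m → ⟦ φ ⟧ (fin X m ∷ˢ P) (ext x ρ)}
    (λ le → cons-mono φ (fin-mono X le)) (evalT ρ t) (λ x lt → finite-use φ X P (ext x ρ) (p x lt))

  opaque
    upd : SetN → ℕ → Bool → SetN
    upd s k b t with t ≟ k
    ... | yes _ = b
    ... | no _ = s t

    upd-here : ∀ s k b → upd s k b k ≡ b
    upd-here s k b with k ≟ k
    ... | yes _ = refl
    ... | no n = ⊥-elim (n refl)

    upd-there : ∀ {s k b t} → t < k → upd s k b t ≡ s t
    upd-there {s} {k} {b} {t} lt with t ≟ k
    ... | yes refl = ⊥-elim (<-irrefl refl lt)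
    ... | no _ = refl

  -- Weak König's lemma.
  opaque
    konig : ∀ {l} (φ : Fm l) P ρ → (∀ X → ⟦ φ ⟧ (tot X ∷ˢ P) ρ) → ∃ λ m → ∀ X → ⟦ φ ⟧ (fin X m ∷ˢ P) ρ
    konig {l} φ P ρ valid = dne refute
      where
        Bad : SetN → ℕ → Set
        Bad s k = ∀ m → Σ SetN λ X → (∀ t → t < k → X t ≡ s t) × ¬ ⟦ φ ⟧ (fin X m ∷ˢ P) ρ

        extend : ∀ s k → Bad s k → Σ Bool λ b → Bad (upd s k b) (suc k)
        extend s k bad with em {Bad (upd s k true) (suc k)} | em {Bad (upd s k false) (suc k)}
        ... | yes h | _ = true , h
        ... | no _ | yes h = false , h
        ... | no n | no n' with ¬∀⇒∃¬ n | ¬∀⇒∃¬ n'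
        -- A counterexample at the larger level is one at both levels; its bit at `k` decides which
        -- of `h` and `h'` it contradicts.
        ...   | m , h | m' , h' with bad (m ⊔ m')
        ...     | X , agree , fails with X k in eq
        ...       | true = ⊥-elim (h (X , agree' , λ p → fails (cons-mono φ (fin-mono X (m≤m⊔n m m')) p)))
          where
            agree' : ∀ t → t < suc k → X t ≡ upd s k true t
            agree' t lt with m<1+n⇒m<n∨m≡n lt
            ... | inj₁ lt' = trans (agree t lt') (sym (upd-there lt'))
            ... | inj₂ refl = trans eq (sym (upd-here s k true))
        ...       | false = ⊥-elim (h' (X , agree' , λ p → fails (cons-mono φ (fin-mono X (m≤n⊔m m m')) p)))
          where
            agree' : ∀ t → t < suc k → X t ≡ upd s k false t
            agree' t lt with m<1+n⇒m<n∨m≡n lt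
            ... | inj₁ lt' = trans (agree t lt') (sym (upd-there lt'))
            ... | inj₂ refl = trans eq (sym (upd-here s k false))

        refute : ¬ ¬ (∃ λ m → ∀ X → ⟦ φ ⟧ (fin X m ∷ˢ P) ρ)
        refute none = clash
          where
            seq : ∀ k → Σ SetN λ s → Bad s k
            seq zero = (λ _ → true) , λ m → let (X , h) = ¬∀⇒∃¬ (λ h → none (m , h)) in X , (λ t ()) , h
            seq (suc k) = let (s , bad) = seq k ; (b , bad') = extend s k bad in upd s k b , bad'
            V : SetN
            V t = proj₁ (seq (suc t)) t
            coh : ∀ k t → t < k → proj₁ (seq k) t ≡ V t
            coh (suc k) t lt with m<1+n⇒m<n∨m≡n lt
            ... | inj₁ lt' = trans (upd-there lt') (coh k t lt')
            ... | inj₂ refl = refl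
            clash : ⊥
            clash with finite-use φ V P ρ (valid V)
            ... | m , p with proj₂ (seq m) m
            ...   | X , agree , fails =
              fails (cons-mono φ (fin-agree λ t lt → trans (sym (coh m t lt)) (sym (agree t lt))) p)

  module _ {I : Set} {Ps : I → Stack} where

    -- A finite top oracle becomes data: it leaves the stack and enters the environment as a code
    -- `ρ jc` with a length `ρ jm`.
    finD : ∀ {l} (φ : Fm l) (σ : ℕ → Term) (jc jm : ℕ) →
      Def l Ps (λ i ρ → ⟦ φ ⟧ (fin (bit (ρ jc)) (ρ jm) ∷ˢ Ps i) (λ k → evalT ρ (σ k)))
    finD (bf φ) σ jc jm = mapD (λ i ρ → Sat-sub φ σ ρ) (bfD (subB σ φ))
    finD (pi φ) σ jc jm = pi (subB (lift σ) φ) , λ i ρ →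
      let (f , g) = ⟦⟧-sub (pi φ) id σ (Ps i) ρ in g , f
    finD (op zero t) σ jc jm = mapD (λ i ρ →
        (λ { (lt , e) → fin⁺ (subst (_< ρ jm) (evalT-sub σ ρ t) lt) (trans (cong (bit (ρ jc)) (sym (evalT-sub σ ρ t))) e) })
      , (λ e → let (lt , e') = fin⁻ {bit (ρ jc)} {ρ jm} e in subst (_< ρ jm) (sym (evalT-sub σ ρ t)) lt
                                                          , trans (cong (bit (ρ jc)) (evalT-sub σ ρ t)) e'))
      (andD (ltD (subT σ t) (var jm)) (bitD true (var jc) (subT σ t)))
    finD (on zero t) σ jc jm = mapD (λ i ρ →
        (λ { (lt , e) → fin⁺ (subst (_< ρ jm) (evalT-sub σ ρ t) lt) (trans (cong (bit (ρ jc)) (sym (evalT-sub σ ρ t))) e) })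
      , (λ e → let (lt , e') = fin⁻ {bit (ρ jc)} {ρ jm} e in subst (_< ρ jm) (sym (evalT-sub σ ρ t)) lt
                                                          , trans (cong (bit (ρ jc)) (evalT-sub σ ρ t)) e'))
      (andD (ltD (subT σ t) (var jm)) (bitD false (var jc) (subT σ t)))
    finD (op (suc n) t) σ jc jm = mapD (λ i ρ → trans (cong (Ps i n) (sym (evalT-sub σ ρ t))) , trans (cong (Ps i n) (evalT-sub σ ρ t)))
      (opD n (subT σ t))
    finD (on (suc n) t) σ jc jm = mapD (λ i ρ → trans (cong (Ps i n) (sym (evalT-sub σ ρ t))) , trans (cong (Ps i n) (evalT-sub σ ρ t)))
      (onD n (subT σ t))
    finD (and φ ψ) σ jc jm = andD (finD φ σ jc jm) (finD ψ σ jc jm)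
    finD (or φ ψ) σ jc jm = orD (finD φ σ jc jm) (finD ψ σ jc jm)
    finD (ex φ) σ jc jm = mapD (λ i ρ →
        (λ { (x , p) → x , ⟦⟧-env φ (ext-lift σ x ρ) p }) , (λ { (x , p) → x , ⟦⟧-env φ (λ k → sym (ext-lift σ x ρ k)) p }))
      (exD (finD φ (lift σ) (suc jc) (suc jm)))
    finD (al t φ) σ jc jm = mapD (λ i ρ →
        (λ p x lt → ⟦⟧-env φ (ext-lift σ x ρ) (p x (subst (x <_) (sym (evalT-sub σ ρ t)) lt)))
      , (λ p x lt → ⟦⟧-env φ (λ k → sym (ext-lift σ x ρ k)) (p x (subst (x <_) (evalT-sub σ ρ t) lt))))
      (alD (subT σ t) (finD φ (lift σ) (suc jc) (suc jm)))

    opaque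
      -- By compactness `∀ X` means that for some `m` all `2 ^ m` strings of length `m` suffice, so
      -- a universal set quantifier costs nothing. Every comparison of a forcing question with a
      -- target set rests on this.
      fanD : ∀ {l} {A : PO × I → Env → Set} → Def l {PO × I} (λ Oi → proj₁ Oi ∷ˢ Ps (proj₂ Oi)) A →
        Def l Ps (λ i ρ → ∀ X → A (tot X , i) ρ)
      fanD {l} {A} (φ , h) = mapD (λ i ρ → backward i ρ , forward i ρ)
          (exD (exD (andD (powD (var 1) (var 0)) (alD (var 0) (finD φ (λ k → var (3 + k)) 0 2)))))
        where
          Fin : I → Env → ℕ → ℕ → Set
          Fin i ρ m w = w ≡ 2 ^ m × (∀ c → c < w → ⟦ φ ⟧ (fin (bit c) m ∷ˢ Ps i) ρ)
          forward : ∀ i ρ → (∀ X → A (tot X , i) ρ) → ∃ λ m → ∃ λ w → Fin i ρ m w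
          forward i ρ p with konig φ (Ps i) ρ (λ X → proj₁ (h (tot X , i) ρ) (p X))
          ... | m , k = m , 2 ^ m , refl , λ c _ → k (bit c)
          backward : ∀ i ρ → (∃ λ m → ∃ λ w → Fin i ρ m w) → ∀ X → A (tot X , i) ρ
          backward i ρ (m , _ , refl , k) X = proj₂ (h (tot X , i) ρ)
            (cons-mono φ (fin⊑tot X m) (cons-mono φ (fin-agree (mk-bit X m)) (k (mk X m) (mk<2^ X m))))

  -- Enumeration of formulas

  decT : ℕ → ℕ → Term
  nodeT : ℕ → ℕ → ℕ → Term
  decT zero n = lit 0
  decT (suc f) n = nodeT f (left n) (right n)
  nodeT f 0 n = var n
  nodeT f 1 n = lit n
  nodeT f 2 n = plus (decT f (left n)) (decT f (right n))
  nodeT f _ n = times (decT f (left n)) (decT f (right n))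

  decB : ℕ → ℕ → BForm
  nodeB : ℕ → ℕ → ℕ → BForm
  decB zero n = ltF (lit 0) (lit 0)
  decB (suc f) n = nodeB f (left n) (right n)
  nodeB f 0 n = eqF (decT f (left n)) (decT f (right n))
  nodeB f 1 n = ltF (decT f (left n)) (decT f (right n))
  nodeB f 2 n = inX (decT f n)
  nodeB f 3 n = negF (decB f n)
  nodeB f 4 n = andF (decB f (left n)) (decB f (right n))
  nodeB f 5 n = orF (decB f (left n)) (decB f (right n))
  nodeB f 6 n = allLt (decT f (left n)) (decB f (right n))
  nodeB f _ n = exLt (decT f (left n)) (decB f (right n))

  decF : ℕ → ℕ → Fm true
  nodeF : ℕ → ℕ → ℕ → Fm true
  decF zero n = bf (ltF (lit 0) (lit 0))
  decF (suc f) n = nodeF f (left n) (right n)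
  nodeF f 0 n = bf (decB f n)
  nodeF f 1 n = pi (decB f n)
  nodeF f 2 n = op (left n) (decT f (right n))
  nodeF f 3 n = on (left n) (decT f (right n))
  nodeF f 4 n = and (decF f (left n)) (decF f (right n))
  nodeF f 5 n = or (decF f (left n)) (decF f (right n))
  nodeF f 6 n = ex (decF f n)
  nodeF f _ n = al (decT f (left n)) (decF f (right n))

  -- Decoding is driven by fuel `f`. Success for all larger fuel lets the parts of a formula share
  -- the same amount.
  Decoded : {A : Set} → (ℕ → ℕ → A) → A → Set
  Decoded dec a = Σ ℕ λ n → Σ ℕ λ f₀ → ∀ f → f₀ ≤ f → dec f n ≡ a

  private
    unary : ∀ {A C : Set} {dec : ℕ → ℕ → A} {dec' : ℕ → ℕ → C} (node : ℕ → ℕ → ℕ → C) →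
      (∀ f n → dec' (suc f) n ≡ node f (left n) (right n)) → (tag : ℕ) (con : A → C) →
      (∀ f n → node f tag n ≡ con (dec f n)) → ∀ {a} → Decoded dec a → Decoded dec' (con a)
    unary node unfold tag con e (n , f₀ , h) = pr tag n , suc f₀ , λ { (suc f) (s≤s le) →
      trans (unfold f _) (trans (cong₂ (node f) (left-pr tag n) (right-pr tag n)) (trans (e f n) (cong con (h f le)))) }

    binary : ∀ {A B C : Set} {dec₁ : ℕ → ℕ → A} {dec₂ : ℕ → ℕ → B} {dec' : ℕ → ℕ → C} (node : ℕ → ℕ → ℕ → C) →
      (∀ f n → dec' (suc f) n ≡ node f (left n) (right n)) → (tag : ℕ) (con : A → B → C) →
      (∀ f n → node f tag n ≡ con (dec₁ f (left n)) (dec₂ f (right n))) →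
      ∀ {a b} → Decoded dec₁ a → Decoded dec₂ b → Decoded dec' (con a b)
    binary {dec₁ = dec₁} {dec₂} node unfold tag con e (n , f₀ , h) (n' , f₁ , h') = pr tag (pr n n') , suc (f₀ ⊔ f₁) , λ { (suc f) (s≤s le) →
      trans (unfold f _) (trans (cong₂ (node f) (left-pr tag _) (right-pr tag _)) (trans (e f _) (cong₂ con
        (trans (cong (dec₁ f) (left-pr n n')) (h f (≤-trans (m≤m⊔n f₀ f₁) le)))
        (trans (cong (dec₂ f) (right-pr n n')) (h' f (≤-trans (m≤n⊔m f₀ f₁) le)))))) }

    numeral : ∀ k → Decoded (λ f n → n) k
    numeral k = k , 0 , λ f _ → refl

    unfoldT : ∀ f n → decT (suc f) n ≡ nodeT f (left n) (right n)
    unfoldT f n = refl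

    unfoldB : ∀ f n → decB (suc f) n ≡ nodeB f (left n) (right n)
    unfoldB f n = refl

    unfoldF : ∀ f n → decF (suc f) n ≡ nodeF f (left n) (right n)
    unfoldF f n = refl

    by-def : ∀ {A : Set} {g : ℕ → ℕ → A} → ∀ f n → g f n ≡ g f n
    by-def f n = refl

  decT-onto : ∀ t → Decoded decT t
  decT-onto (var i) = unary nodeT unfoldT 0 var by-def (numeral i)
  decT-onto (lit i) = unary nodeT unfoldT 1 lit by-def (numeral i)
  decT-onto (plus s t) = binary nodeT unfoldT 2 plus by-def (decT-onto s) (decT-onto t)
  decT-onto (times s t) = binary nodeT unfoldT 3 times by-def (decT-onto s) (decT-onto t)

  decB-onto : ∀ φ → Decoded decB φ
  decB-onto (eqF s t) = binary nodeB unfoldB 0 eqF by-def (decT-onto s) (decT-onto t)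
  decB-onto (ltF s t) = binary nodeB unfoldB 1 ltF by-def (decT-onto s) (decT-onto t)
  decB-onto (inX t) = unary nodeB unfoldB 2 inX by-def (decT-onto t)
  decB-onto (negF φ) = unary nodeB unfoldB 3 negF by-def (decB-onto φ)
  decB-onto (andF φ ψ) = binary nodeB unfoldB 4 andF by-def (decB-onto φ) (decB-onto ψ)
  decB-onto (orF φ ψ) = binary nodeB unfoldB 5 orF by-def (decB-onto φ) (decB-onto ψ)
  decB-onto (allLt t φ) = binary nodeB unfoldB 6 allLt by-def (decT-onto t) (decB-onto φ)
  decB-onto (exLt t φ) = binary nodeB unfoldB 7 exLt by-def (decT-onto t) (decB-onto φ)

  decF-onto : ∀ φ → Decoded decF φ
  decF-onto (bf φ) = unary nodeF unfoldF 0 bf by-def (decB-onto φ)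
  decF-onto (pi φ) = unary nodeF unfoldF 1 pi by-def (decB-onto φ)
  decF-onto (op i t) = binary nodeF unfoldF 2 op by-def (numeral i) (decT-onto t)
  decF-onto (on i t) = binary nodeF unfoldF 3 on by-def (numeral i) (decT-onto t)
  decF-onto (and φ ψ) = binary nodeF unfoldF 4 and by-def (decF-onto φ) (decF-onto ψ)
  decF-onto (or φ ψ) = binary nodeF unfoldF 5 or by-def (decF-onto φ) (decF-onto ψ)
  decF-onto (ex φ) = unary nodeF unfoldF 6 ex by-def (decF-onto φ)
  decF-onto (al t φ) = binary nodeF unfoldF 7 al by-def (decT-onto t) (decF-onto φ)

  enum : {A : Set} → (ℕ → ℕ → A) → ℕ → A
  enum dec n = dec (left n) (right n)

  enum-onto : {A : Set} {dec : ℕ → ℕ → A} {a : A} → Decoded dec a → ∃ λ n → enum dec n ≡ a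
  enum-onto {dec = dec} (n , f , h) = pr f n , trans (cong₂ dec (left-pr f n) (right-pr f n)) (h f ≤-refl)

  -- Nice stacks and the basis theorem

  -- The sets that must not become Σ₂: all Σ₃(Z) sets and their complements.

  Req : Set
  Req = BForm × Bool

  Σ₃-sat : BForm → ℕ → Set
  Σ₃-sat φ n = Σ ℕ (λ a → (b : ℕ) → Σ ℕ (λ c → Sat Z (ext c (ext b (ext a (ext n ρ₀)))) φ))

  target : Req → SetN
  target (φ , true) = chr (Σ₃-sat φ)
  target (φ , false) = chr (λ n → ¬ Σ₃-sat φ n)

  Nice : Stack → Set
  Nice P = ∀ β → ¬ Sigma2 Z (target β) → (φ : Fm true) → ¬ (∀ n → n ∈ target β ↔ ⟦ φ ⟧ P (ext n ρ₀))

  closeT : Env → ℕ → Term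
  closeT ρ zero = var 0
  closeT ρ (suc i) = lit (ρ i)

  close : Env → Fm true → Fm true
  close ρ = subF id (closeT ρ)

  close-ok : ∀ ρ φ P n → ⟦ close ρ φ ⟧ P (ext n ρ₀) ↔ ⟦ φ ⟧ P (ext n ρ)
  close-ok ρ φ P n = (λ p → ⟦⟧-env φ env≡ (proj₁ (⟦⟧-sub φ id (closeT ρ) P (ext n ρ₀)) p))
                   , (λ p → proj₂ (⟦⟧-sub φ id (closeT ρ) P (ext n ρ₀)) (⟦⟧-env φ (λ i → sym (env≡ i)) p))
    where
      env≡ : ∀ i → evalT (ext n ρ₀) (closeT ρ i) ≡ ext n ρ i
      env≡ zero = refl
      env≡ (suc i) = refl

  nice-diff : ∀ {P} → Nice P → ∀ β → ¬ Sigma2 Z (target β) → {A : ℕ → Set} {I : Set} {Ps : I → Stack} {A' : I → Env → Set} →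
    (i : I) → (∀ k t → Ps i k t ≡ P k t) → Def true Ps A' → (ρ : Env) → (∀ n → A n ↔ A' i (ext n ρ)) →
    Σ ℕ λ n → (n ∈ target β × ¬ A n) ⊎ (¬ n ∈ target β × A n)
  nice-diff {P} nice β nΣ {A} {Ps = Ps} i e (φ , h) ρ k with ¬∀⇒∃¬ {P = λ n → n ∈ target β ↔ A n} no-all
    where
      no-all : ¬ (∀ n → n ∈ target β ↔ A n)
      no-all all = nice β nΣ (close ρ φ) λ n →
          (λ p → proj₂ (close-ok ρ φ P n) (⟦⟧-stack φ e (proj₁ (h i (ext n ρ)) (proj₁ (k n) (proj₁ (all n) p)))))
        , (λ p → proj₂ (all n) (proj₂ (k n) (proj₂ (h i (ext n ρ)) (⟦⟧-stack φ (λ j t → sym (e j t)) (proj₁ (close-ok ρ φ P n) p)))))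
  ... | n , ne with em {n ∈ target β} | em {A n}
  ...   | yes b | yes a = ⊥-elim (ne ((λ _ → a) , (λ _ → b)))
  ...   | yes b | no na = n , inj₁ (b , na)
  ...   | no nb | yes a = n , inj₂ (nb , a)
  ...   | no nb | no na = ⊥-elim (ne ((λ b → ⊥-elim (nb b)) , (λ a → ⊥-elim (na a))))

  nice-∅ : Nice ∅ˢ
  nice-∅ β nΣ φ h = nΣ (Σ₂-of φ ρ₀ (target β) h)

  -- Forcing with nonempty Π₁ classes. By compactness the n at which a class forces ψ are definable
  -- over P, so they differ from the target at some n.
  module Basis (P : Stack) (nice : Nice P) (φ : Fm true) (ρ : Env) where

    Holds : Fm true → SetN → Set
    Holds χ X = ⟦ χ ⟧ (tot X ∷ˢ P) ρ

    -- A nonempty Π₁ class, given by a formula for its complement and one member.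
    State : Set
    State = Σ (Fm true) λ χ → Σ SetN λ X → ¬ Holds χ X

    instT : ℕ → ℕ → Term
    instT n zero = lit n
    instT n (suc i) = lit 0

    inst : Fm true → ℕ → Fm true
    inst ψ n = subF id (instT n) ψ

    inst-ok : ∀ ψ n X → Holds (inst ψ n) X ↔ ⟦ ψ ⟧ (tot X ∷ˢ P) (ext n ρ₀)
    inst-ok ψ n X = (λ p → ⟦⟧-env ψ env≡ (proj₁ (⟦⟧-sub ψ id (instT n) (tot X ∷ˢ P) ρ) p))
                  , (λ p → proj₂ (⟦⟧-sub ψ id (instT n) (tot X ∷ˢ P) ρ) (⟦⟧-env ψ (λ i → sym (env≡ i)) p))
      where
        env≡ : ∀ i → evalT ρ (instT n i) ≡ ext n ρ₀ i
        env≡ zero = refl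
        env≡ (suc i) = refl

    Forced : Fm true → Req → Fm true → ℕ → Set
    Forced χ β ψ n = (n ∈ target β × (∀ X → ¬ Holds χ X → ¬ ⟦ ψ ⟧ (tot X ∷ˢ P) (ext n ρ₀)))
                   ⊎ (¬ n ∈ target β × (∀ X → ¬ Holds χ X → ⟦ ψ ⟧ (tot X ∷ˢ P) (ext n ρ₀)))

    _≼_ : State → State → Set
    s ≼ s' = ∀ X → Holds (proj₁ s) X → Holds (proj₁ s') X

    module Decision (χ ψ : Fm true) where

      A : ℕ → Set
      A n = ∀ X → Holds χ X ⊎ ⟦ ψ ⟧ (tot X ∷ˢ P) (ext n ρ₀)

      Ps : PO × ⊤ → Stack
      Ps Oi = proj₁ Oi ∷ˢ P

      χ-def : Def true Ps (λ Oi ρ' → ⟦ χ ⟧ (Ps Oi) ρ)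
      χ-def = subF id (λ i → lit (ρ i)) χ , λ Oi ρ' → let (f , g) = ⟦⟧-sub χ id (λ i → lit (ρ i)) (Ps Oi) ρ' in g , f

      ψ-def : Def true Ps (λ Oi ρ' → ⟦ ψ ⟧ (Ps Oi) (λ j → evalT ρ' (closeT ρ₀ j)))
      ψ-def = subF id (closeT ρ₀) ψ , λ Oi ρ' → let (f , g) = ⟦⟧-sub ψ id (closeT ρ₀) (Ps Oi) ρ' in g , f

      A-def : Def true {⊤} (λ _ → P) (λ _ ρ' → ∀ X → Holds χ X ⊎ ⟦ ψ ⟧ (tot X ∷ˢ P) (λ j → evalT ρ' (closeT ρ₀ j)))
      A-def = fanD {A = λ Oi ρ' → ⟦ χ ⟧ (Ps Oi) ρ ⊎ ⟦ ψ ⟧ (Ps Oi) (λ j → evalT ρ' (closeT ρ₀ j))} (orD χ-def ψ-def)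

      env≡ : ∀ n i → evalT (ext n ρ₀) (closeT ρ₀ i) ≡ ext n ρ₀ i
      env≡ n zero = refl
      env≡ n (suc i) = refl

      A-ok : ∀ n → A n ↔ (∀ X → Holds χ X ⊎ ⟦ ψ ⟧ (tot X ∷ˢ P) (λ j → evalT (ext n ρ₀) (closeT ρ₀ j)))
      A-ok n = (λ a X → map₂ (⟦⟧-env ψ (λ i → sym (env≡ n i))) (a X)) , (λ a X → map₂ (⟦⟧-env ψ (env≡ n)) (a X))

      outcome : ∀ β → ¬ Sigma2 Z (target β) → Σ ℕ λ n → (n ∈ target β × ¬ A n) ⊎ (¬ n ∈ target β × A n)
      outcome β nσ = nice-diff nice β nσ tt (λ _ _ → refl) A-def ρ₀ A-ok

    Step : State → Req → Fm true → Set
    Step s β ψ = Σ State λ s' → s ≼ s' × (¬ Sigma2 Z (target β) → ∃ (Forced (proj₁ s') β ψ))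

    -- If the class does not force `ψ` at an element of the target, it is cut down to the members at
    -- which `ψ` fails there; if it forces `ψ` outside the target, nothing remains to be done.
    act : ∀ s β ψ n → (n ∈ target β × ¬ Decision.A (proj₁ s) ψ n) ⊎ (¬ n ∈ target β × Decision.A (proj₁ s) ψ n) → Step s β ψ
    act (χ , X₀ , nX₀) β ψ n (inj₁ (b , na)) = split (¬∀⇒∃¬ na)
      where
        split : (Σ SetN λ X → ¬ (Holds χ X ⊎ ⟦ ψ ⟧ (tot X ∷ˢ P) (ext n ρ₀))) → Step (χ , X₀ , nX₀) β ψ
        split (X , h) = (or χ (inst ψ n) , X , (λ { (inj₁ p) → h (inj₁ p) ; (inj₂ p) → h (inj₂ (proj₁ (inst-ok ψ n X) p)) }))
          , (λ X p → inj₁ p)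
          , λ _ → n , inj₁ (b , λ X h p → h (inj₂ (proj₂ (inst-ok ψ n X) p)))
    act (χ , X₀ , nX₀) β ψ n (inj₂ (nb , a)) = (χ , X₀ , nX₀) , (λ X h → h) , λ _ → n , inj₂ (nb , λ X h → right-of (a X) h)
      where
        right-of : ∀ {A C : Set} → A ⊎ C → ¬ A → C
        right-of (inj₁ a) na = ⊥-elim (na a)
        right-of (inj₂ c) na = c

    opaque
      require : (s : State) (β : Req) (ψ : Fm true) → Step s β ψ
      require s β ψ = cases em
        where
          cases : Dec (Sigma2 Z (target β)) → Step s β ψ
          cases (yes σ₂) = s , (λ X h → h) , λ nσ → ⊥-elim (nσ σ₂)
          cases (no nσ) = let (n , o) = Decision.outcome (proj₁ s) ψ β nσ in act s β ψ n o

    differs : Bool → ℕ → Fm true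
    differs true t = on 0 (lit t)
    differs false t = op 0 (lit t)

    differs-no : ∀ {b t X} → X t ≡ b → ¬ Holds (differs b t) X
    differs-no {true} e h = true≢false e (just-injective h)
    differs-no {false} e h = true≢false (just-injective h) e

    differs-yes : ∀ {b t X} → X t ≢ b → Holds (differs b t) X
    differs-yes {true} n = cong just (not-true n)
    differs-yes {false} {t} {X} n with X t
    ... | true = refl
    ... | false = ⊥-elim (n refl)

    opaque
     decide : (s : State) (t : ℕ) → Σ Bool λ b → Σ State λ s' → s ≼ s' × (∀ X → X t ≢ b → Holds (proj₁ s') X)
     decide (χ , X , nX) t = X t , (or χ (differs (X t) t) , X , λ { (inj₁ p) → nX p ; (inj₂ p) → differs-no {X t} {t} {X} refl p })
       , (λ Y p → inj₁ p) , λ Y n → inj₂ (differs-yes {X t} {t} {Y} n)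

    reqOf : ℕ → Req
    reqOf s = enum decB (left (left s)) , par (right (left s))

    formOf : ℕ → Fm true
    formOf s = enum decF (right s)

    task-onto : ∀ β ψ → ∃ λ s → reqOf s ≡ β × formOf s ≡ ψ
    task-onto (φ , b) ψ with enum-onto (decB-onto φ) | enum-onto (decF-onto ψ)
    ... | i , refl | j , refl = pr (pr i (b2n b)) j ,
        cong₂ _,_ (cong (enum decB) (trans (cong left (left-pr _ j)) (left-pr i _)))
                  (trans (cong par (trans (cong right (left-pr _ j)) (right-pr i _))) (par-double 0 b))
      , cong (enum decF) (right-pr _ j)

    stage : ¬ (∀ X → Holds φ X) → ℕ → State
    mid : ¬ (∀ X → Holds φ X) → ℕ → State
    stage nv zero = φ , ¬∀⇒∃¬ nv
    stage nv (suc s) = proj₁ (proj₂ (decide (mid nv s) s))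
    mid nv s = proj₁ (require (stage nv s) (reqOf s) (formOf s))

    opaque
      basis : ¬ (∀ X → Holds φ X) → Σ SetN λ X → ¬ Holds φ X × Nice (tot X ∷ˢ P)
      basis nv = V , never 0 , nice-V
        where
          st : ℕ → State
          st = stage nv
          V : SetN
          V t = proj₁ (decide (mid nv t) t)
          st≼mid : ∀ s → st s ≼ mid nv s
          st≼mid s = proj₁ (proj₂ (require (st s) (reqOf s) (formOf s)))
          mid≼st : ∀ s → mid nv s ≼ st (suc s)
          mid≼st s = proj₁ (proj₂ (proj₂ (decide (mid nv s) s)))
          mono : ∀ s k X → Holds (proj₁ (st s)) X → Holds (proj₁ (st (k + s))) X
          mono s zero X h = h
          mono s (suc k) X h = mid≼st (k + s) X (st≼mid (k + s) X (mono s k X h))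
          off : ∀ t k X → X t ≢ V t → Holds (proj₁ (st (k + suc t))) X
          off t k X ne = mono (suc t) k X (proj₂ (proj₂ (proj₂ (decide (mid nv t) t))) X ne)
          -- If `V` satisfied the formula of stage `s`, finitely many bits, say those below `m`,
          -- would be responsible. The member kept at stage `m + s` agrees with `V` on them, since a
          -- disagreement satisfies a formula by `off`; so it would satisfy the formula of its own
          -- stage.
          never : ∀ s → ¬ Holds (proj₁ (st s)) V
          never s h with finite-use (proj₁ (st s)) V P ρ h
          ... | m , h' = proj₂ (proj₂ (st (m + s))) all
            where
              X : SetN
              X = proj₁ (proj₂ (st (m + s)))
              all : Holds (proj₁ (st (m + s))) X
              all with em {∀ t → t < m → V t ≡ X t}
              ... | yes agree = mono s m X (cons-mono (proj₁ (st s)) (fin⊑tot X m) (cons-mono (proj₁ (st s)) (fin-agree agree) h'))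
              ... | no na with ¬∀⇒∃¬ na
              ...   | t , nt with ¬∀⇒∃¬ nt
              ...     | t<m , ne = subst (λ k → Holds (proj₁ (st k)) X) e (off t ((m + s) ∸ suc t) X (λ q → ne (sym q)))
                where
                  e : (m + s) ∸ suc t + suc t ≡ m + s
                  e = m∸n+n≡m (≤-trans t<m (m≤m+n m s))
          never-mid : ∀ s → ¬ Holds (proj₁ (mid nv s)) V
          never-mid s h = never (suc s) (mid≼st s V h)
          nice-V : Nice (tot V ∷ˢ P)
          nice-V β nσ ψ all with task-onto β ψ
          ... | s , refl , refl with proj₂ (proj₂ (require (st s) (reqOf s) (formOf s))) nσ
          ...   | n , inj₁ (b , h) = h V (never-mid s) (proj₁ (all n) b)
          ...   | n , inj₂ (nb , h) = nb (proj₂ (all n) (h V (never-mid s)))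

  open Basis public using (basis)

-- Promises and thin hypergraphs

module Forcing (em : ExcludedMiddle 0ℓ) (Z : SetN) (f : Coloring3) (f-comp : ComputableIn Z f) where

  open Classical em
  open Definability em Z

  -- Formula 0 says that b is not an element above a; meeting its negation makes sets infinite.
  fm : ℕ → BForm
  fm zero = negF (andF (inX (plus (lit 1) (plus (var 0) (var 0)))) (negF (ltF (var 0) (var 1))))
  fm (suc r) = enum decB r

  fm-onto : ∀ φ → ∃ λ r → fm r ≡ φ
  fm-onto φ with enum-onto (decB-onto φ)
  ... | r , e = suc r , e

  instance₂ : SetN → ℕ → ℕ → ℕ → ℕ → Set
  instance₂ G r n a b = Sat (join Z G) (ext b (ext a (ext n ρ₀))) (fm r)

  Vio : ℕ → ℕ → ℕ → ℕ → Set
  Vio r n a T = Σ ℕ λ b → ¬ instance₂ (bit T) r n a b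

  Rb : ℕ → Set
  Rb T = Rainbow f (bit T)

  opaque
    idx : ℕ → ℕ → ℕ → ℕ → ℕ
    idx r n T a = pr r (pr n (pr T a))

    idx-inj : ∀ {r n T a r' n' T' a'} → idx r n T a ≡ idx r' n' T' a' → r ≡ r' × n ≡ n' × T ≡ T' × a ≡ a'
    idx-inj {r} {n} {T} {a} {r'} {n'} {T'} {a'} e =
      let (e₁ , e') = pr-inj r (pr n (pr T a)) r' (pr n' (pr T' a')) e
          (e₂ , e'') = pr-inj n (pr T a) n' (pr T' a') e'
          (e₃ , e₄) = pr-inj T a T' a' e''
      in e₁ , e₂ , e₃ , e₄

    idx-def : ∀ r n T a → idx r n T a ≡ pr r (pr n (pr T a))
    idx-def r n T a = refl

  -- U i E : adding E to the finite set named in i leaves a rainbow refuting the instance named in i.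
  U : ℕ → ℕ → Set
  U i E = Σ ℕ λ r → Σ ℕ λ n → Σ ℕ λ T → Σ ℕ λ a → i ≡ idx r n T a × Rb (uni T E) × Vio r n a (uni T E)

  -- A hypergraph is the set of codes of its edges.

  Ind : SetN → ℕ → Set
  Ind h E = ∀ e → e ≢ 0 → e ⊆ₑ E → h e ≡ false

  Above : ℕ → ℕ → Set
  Above S y = ∀ x → x ∈ bit S → x < y

  -- For nonempty `S` the new element is not the last of the edge. For empty `S` every `x` is
  -- allowed, so that `TB` too permits at most one singleton edge.
  Side : ℕ → ℕ → Set
  Side S x = bit S x ≡ false × (S ≡ 0 ⊎ Σ ℕ λ z → z ∈ bit S × x < z)

  -- The last element of an edge is determined by the others, or any element but the last is.
  TA TB : (ℕ → Set) → SetN → Set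
  TA G h = ∀ S y y' → G S → Above S y → Above S y' → ins S y ∈ h → ins S y' ∈ h → y ≡ y'
  TB G h = ∀ S x x' → G S → Side S x → Side S x' → ins S x ∈ h → ins S x' ∈ h → x ≡ x'

  -- `WThin` leaves singleton edges free, and they are used to forbid whole sets of points. In a
  -- witness of smallness they would be fatal: only the empty set is independent of the hypergraph
  -- of all singletons.
  Thin WThin : SetN → Set
  Thin h = TA (λ _ → ⊤) h ⊎ TB (λ _ → ⊤) h
  WThin h = TA (λ S → S ≢ 0) h ⊎ TB (λ S → S ≢ 0) h

  edge : PO → ℕ → ℕ → Bool → Set
  edge O l e b = O (pr 1 (pr l e)) ≡ just b

  cov : PO → ℕ → ℕ → Bool → Set
  cov O ε y b = O (pr 0 (pr ε y)) ≡ just b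

  edges : SetN → ℕ → SetN
  edges X l e = X (pr 1 (pr l e))

  IndO : PO → ℕ → ℕ → Set
  IndO O k E = ∀ l → l < k → ∀ e → e ≢ 0 → e ⊆ₑ E → edge O l e false

  -- Failure of thinness in a form that is positive in the oracle, as formulas require.
  ViolA ViolB : PO → ℕ → Set
  ViolA O l = Σ ℕ λ S → Σ ℕ λ y → Σ ℕ λ y' → ¬ y ≡ y' × Above S y × Above S y' ×
    Σ ℕ λ e → Σ ℕ λ e' → e ≡ ins S y × e' ≡ ins S y' × edge O l e true × edge O l e' true
  ViolB O l = Σ ℕ λ S → Σ ℕ λ x → Σ ℕ λ x' → ¬ x ≡ x' × Side S x × Side S x' ×
    Σ ℕ λ e → Σ ℕ λ e' → e ≡ ins S x × e' ≡ ins S x' × edge O l e true × edge O l e' true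

  ViolThin : PO → ℕ → Set
  ViolThin O k = Σ ℕ λ l → l < k × ViolA O l × ViolB O l

  ¬ViolThin : ∀ X k → ¬ ViolThin (tot X) k → ∀ l → l < k → Thin (edges X l)
  ¬ViolThin X k h l lt = or-else λ na S x x' _ s s' e e' → dne λ ne → na λ T y y' _ t t' d d' → dne λ ne' →
    h (l , lt , (T , y , y' , ne' , t , t' , _ , _ , refl , refl , cong just d , cong just d')
              , (S , x , x' , ne , s , s' , _ , _ , refl , refl , cong just e , cong just e'))

  Thin⇒¬ViolThin : ∀ X k → (∀ l → l < k → Thin (edges X l)) → ¬ ViolThin (tot X) k
  Thin⇒¬ViolThin X k thin (l , lt , (S , y , y' , ne , s , s' , _ , _ , refl , refl , d , d') , vb) with thin l lt
  ... | inj₁ ta = ne (ta S y y' tt s s' (just-injective d) (just-injective d'))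
  Thin⇒¬ViolThin X k thin (l , lt , va , (S , x , x' , ne , s , s' , _ , _ , refl , refl , d , d')) | inj₂ tb =
    ne (tb S x x' tt s s' (just-injective d) (just-injective d'))

  ViolThin-mono : ∀ {O O' k} → O ⊑ O' → ViolThin O k → ViolThin O' k
  ViolThin-mono h (l , lt , (S , y , y' , ne , s , s' , e , e' , i , i' , d , d') , (S₁ , y₁ , y₁' , ne₁ , s₁ , s₁' , e₁ , e₁' , i₁ , i₁' , d₁ , d₁')) =
    l , lt , (S , y , y' , ne , s , s' , e , e' , i , i' , h _ _ d , h _ _ d')
           , (S₁ , y₁ , y₁' , ne₁ , s₁ , s₁' , e₁ , e₁' , i₁ , i₁' , h _ _ d₁ , h _ _ d₁')

  -- Definability of the combinatorial notions

  -- The arguments of the definability lemmas are variable indices.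

  module _ {l : Bool} {I : Set} {Ps : I → Stack} where

    prD : (t s u : Term) → Def l Ps (λ i ρ → evalT ρ t ≡ pr (evalT ρ s) (evalT ρ u))
    prD t s u = mapD (λ i ρ → (λ e → trans e (evalT-prT ρ s u)) , (λ e → trans e (sym (evalT-prT ρ s u)))) (eqD t (prT s u))

    idxD : ∀ i r n T a → Def l Ps (λ _ ρ → ρ i ≡ idx (ρ r) (ρ n) (ρ T) (ρ a))
    idxD i r n T a = mapD (λ _ ρ → (λ { (_ , refl , _ , refl , e) → trans e (sym (idx-def (ρ r) (ρ n) (ρ T) (ρ a))) })
        , (λ e → _ , refl , _ , refl , trans e (idx-def (ρ r) (ρ n) (ρ T) (ρ a))))
      (exD (andD (prD (var 0) (var (1 + T)) (var (1 + a)))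
        (exD (andD (prD (var 0) (var (2 + n)) (var 1)) (prD (var (2 + i)) (var (2 + r)) (var 0))))))

    memD nmemD : ∀ e x → Def l Ps _
    memD e x = bitD true (var e) (var x)
    nmemD e x = bitD false (var e) (var x)

    memImpD : ∀ {A : I → Env → Set} e x → Def l Ps A → Def l Ps (λ i ρ → ρ x ∈ bit (ρ e) → A i ρ)
    memImpD e x = impD (λ i ρ → (λ q p → true≢false p q) , not-true) (nmemD e x)

    allInD : ∀ {A : I → Env → Set} e → Def l Ps A → Def l Ps (λ i ρ → ∀ z → z ∈ bit (ρ e) → A i (ext z ρ))
    allInD e d = mapD (λ i ρ → (λ h z p → h z (bit< (ρ e) z p) p) , (λ h z _ p → h z p)) (alD (var e) (memImpD (suc e) 0 d))

    subD' : ∀ e E → Def l Ps (λ i ρ → ρ e ⊆ₑ ρ E)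
    subD' e E = allInD e (memD (suc E) 0)

    nsubD : ∀ e E → Def l Ps (λ i ρ → Σ ℕ λ z → z ∈ bit (ρ e) × bit (ρ E) z ≡ false)
    nsubD e E = exD (andD (memD (suc e) 0) (nmemD (suc E) 0))

    aboveD : ∀ S y → Def l Ps (λ i ρ → Above (ρ S) (ρ y))
    aboveD S y = allInD S (ltD (var 0) (var (suc y)))

    sideD : ∀ S x → Def l Ps (λ i ρ → Side (ρ S) (ρ x))
    sideD S x = andD (nmemD S x) (orD (eqD (var S) (lit 0)) (exD (andD (memD (suc S) 0) (ltD (var (suc x)) (var 0)))))

    insD : ∀ e S x → Def l Ps (λ i ρ → ρ e ≡ ins (ρ S) (ρ x))
    insD e S x = mapD (λ i ρ →
        (λ { (p , q , r) → ⊆-antisym (λ z m → into ρ z (q z m)) (λ z m → outof ρ p r z (ins⁻ m)) })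
      , (λ h → subst (λ w → ρ x ∈ bit w) (sym h) (ins-here (ρ S) (ρ x))
             , (λ z m → ins⁻ (subst (λ w → z ∈ bit w) h m)) , (λ z m → subst (λ w → z ∈ bit w) (sym h) (ins-there m))))
      (andD (memD e x) (andD (allInD e (orD (eqD (var 0) (var (suc x))) (memD (suc S) 0))) (subD' S e)))
      where
        into : ∀ ρ z → z ≡ ρ x ⊎ z ∈ bit (ρ S) → z ∈ bit (ins (ρ S) (ρ x))
        into ρ z (inj₁ refl) = ins-here (ρ S) z
        into ρ z (inj₂ m) = ins-there m
        outof : ∀ (ρ : Env) → ρ x ∈ bit (ρ e) → ρ S ⊆ₑ ρ e → ∀ z → z ≡ ρ x ⊎ z ∈ bit (ρ S) → z ∈ bit (ρ e)
        outof ρ p r z (inj₁ refl) = p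
        outof ρ p r z (inj₂ m) = r z m

    uniD : ∀ e A B → Def l Ps (λ i ρ → ρ e ≡ uni (ρ A) (ρ B))
    uniD e A B = mapD (λ i ρ →
        (λ { (p , q , r) → ⊆-antisym (λ z m → into ρ z (p z m)) (λ z m → outof ρ q r z (uni⁻ m)) })
      , (λ h → (λ z m → uni⁻ (subst (λ w → z ∈ bit w) h m)) , (λ z m → subst (λ w → z ∈ bit w) (sym h) (uniˡ m))
             , (λ z m → subst (λ w → z ∈ bit w) (sym h) (uniʳ {ρ A} m))))
      (andD (allInD e (orD (memD (suc A) 0) (memD (suc B) 0))) (andD (subD' A e) (subD' B e)))
      where
        into : ∀ (ρ : Env) z → z ∈ bit (ρ A) ⊎ z ∈ bit (ρ B) → z ∈ bit (uni (ρ A) (ρ B))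
        into ρ z (inj₁ m) = uniˡ m
        into ρ z (inj₂ m) = uniʳ {ρ A} m
        outof : ∀ (ρ : Env) → ρ A ⊆ₑ ρ e → ρ B ⊆ₑ ρ e → ∀ z → z ∈ bit (ρ A) ⊎ z ∈ bit (ρ B) → z ∈ bit (ρ e)
        outof ρ q r z (inj₁ m) = q z m
        outof ρ q r z (inj₂ m) = r z m

    fD : ∀ x y z c → Def l Ps (λ i ρ → (ρ x < ρ y × ρ y < ρ z) × f (ρ x) (ρ y) (ρ z) ≡ ρ c)
    fD x y z c = mapD (λ i ρ →
        (λ { ((xy , yz) , w , s) → (xy , yz) , proj₂ (proj₂ f-comp (ρ x) (ρ y) (ρ z) (ρ c) xy yz) (w , Sat-cong φ (λ _ → refl) (env≡ w ρ) s) })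
      , (λ { ((xy , yz) , e) → let (w , s) = proj₁ (proj₂ f-comp (ρ x) (ρ y) (ρ z) (ρ c) xy yz) e
                               in (xy , yz) , w , Sat-cong φ (λ _ → refl) (λ i → sym (env≡ w ρ i)) s }))
      (andD (andD (ltD (var x) (var y)) (ltD (var y) (var z))) (exD (subD σ (bfD φ))))
      where
        φ = proj₁ f-comp
        σ : ℕ → Term
        σ 0 = var 0
        σ 1 = var (suc c)
        σ 2 = var (suc z)
        σ 3 = var (suc y)
        σ 4 = var (suc x)
        σ (suc (suc (suc (suc (suc _))))) = lit 0
        env≡ : ∀ w (ρ : Env) i → evalT (ext w ρ) (σ i) ≡ ext w (ext (ρ c) (ext (ρ z) (ext (ρ y) (ext (ρ x) ρ₀)))) i
        env≡ w ρ 0 = refl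
        env≡ w ρ 1 = refl
        env≡ w ρ 2 = refl
        env≡ w ρ 3 = refl
        env≡ w ρ 4 = refl
        env≡ w ρ (suc (suc (suc (suc (suc _))))) = refl

    Increasing : ℕ → ℕ → ℕ → Set
    Increasing x y z = x < y × y < z

    feqD : ∀ x y z x' y' z' → Def l Ps (λ i ρ → (Increasing (ρ x) (ρ y) (ρ z) × Increasing (ρ x') (ρ y') (ρ z')) ×
      f (ρ x) (ρ y) (ρ z) ≡ f (ρ x') (ρ y') (ρ z'))
    feqD x y z x' y' z' = mapD (λ i ρ → (λ { (c , (h , e) , (h' , e')) → (h , h') , trans e (sym e') })
                                      , (λ { ((h , h') , e) → _ , (h , e) , (h' , refl) }))
      (exD (andD (fD (suc x) (suc y) (suc z) 0) (fD (suc x') (suc y') (suc z') 0)))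

    -- As `f` is total, inequality is Σ₁ as well: it says that two existing values differ.
    fneD : ∀ x y z x' y' z' → Def l Ps (λ i ρ → (Increasing (ρ x) (ρ y) (ρ z) × Increasing (ρ x') (ρ y') (ρ z')) ×
      (¬ f (ρ x) (ρ y) (ρ z) ≡ f (ρ x') (ρ y') (ρ z')))
    fneD x y z x' y' z' = mapD (λ i ρ →
        (λ { (c , c' , (h , e) , (h' , e') , ne) → (h , h') , λ q → ne (trans (sym e) (trans q e')) })
      , (λ { ((h , h') , ne) → _ , _ , (h , refl) , (h' , refl) , ne }))
      (exD (exD (andD (fD (2 + x) (2 + y) (2 + z) 1) (andD (fD (2 + x') (2 + y') (2 + z') 0) (neD (var 1) (var 0))))))

    nincD : ∀ x y z → Def l Ps (λ i ρ → (¬ ρ x < ρ y) ⊎ (¬ ρ y < ρ z))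
    nincD x y z = orD (nltD (var x) (var y)) (nltD (var y) (var z))

    opaque
      rbD : ∀ T → Def l Ps (λ i ρ → Rb (ρ T))
      rbD T = mapD (λ i ρ →
          (λ h x y z x' y' z' p q r p' q' r' a b a' b' e → fwd (h x p y q z r x' p' y' q' z' r') a b a' b' e)
        , (λ h x p y q z r x' p' y' q' z' r' → bwd (h x y z x' y' z' p q r p' q' r')))
        (allInD T (allInD (1 + T) (allInD (2 + T) (allInD (3 + T) (allInD (4 + T) (allInD (5 + T)
          (orD (nincD 5 4 3) (orD (nincD 2 1 0) (orD (fneD 5 4 3 2 1 0)
            (andD (eqD (var 5) (var 2)) (andD (eqD (var 4) (var 1)) (eqD (var 3) (var 0)))))))))))))
        where
          Body : (x y z x' y' z' : ℕ) → Set
          Body x y z x' y' z' = ((¬ x < y) ⊎ (¬ y < z)) ⊎ (((¬ x' < y') ⊎ (¬ y' < z')) ⊎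
            ((((Increasing x y z × Increasing x' y' z') × (¬ f x y z ≡ f x' y' z')) ⊎ (x ≡ x' × y ≡ y' × z ≡ z'))))
          fwd : ∀ {x y z x' y' z'} → Body x y z x' y' z' → x < y → y < z → x' < y' → y' < z' → f x y z ≡ f x' y' z' →
            x ≡ x' × y ≡ y' × z ≡ z'
          fwd (inj₁ (inj₁ n)) a b a' b' e = ⊥-elim (n a)
          fwd (inj₁ (inj₂ n)) a b a' b' e = ⊥-elim (n b)
          fwd (inj₂ (inj₁ (inj₁ n))) a b a' b' e = ⊥-elim (n a')
          fwd (inj₂ (inj₁ (inj₂ n))) a b a' b' e = ⊥-elim (n b')
          fwd (inj₂ (inj₂ (inj₁ (_ , ne)))) a b a' b' e = ⊥-elim (ne e)
          fwd (inj₂ (inj₂ (inj₂ eqs))) a b a' b' e = eqs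
          bwd : ∀ {x y z x' y' z'} → (x < y → y < z → x' < y' → y' < z' → f x y z ≡ f x' y' z' → x ≡ x' × y ≡ y' × z ≡ z') →
            Body x y z x' y' z'
          bwd {x} {y} {z} {x'} {y'} {z'} h with x <? y | y <? z | x' <? y' | y' <? z' | f x y z ≟ f x' y' z'
          ... | no n | _ | _ | _ | _ = inj₁ (inj₁ n)
          ... | yes _ | no n | _ | _ | _ = inj₁ (inj₂ n)
          ... | yes _ | yes _ | no n | _ | _ = inj₂ (inj₁ (inj₁ n))
          ... | yes _ | yes _ | yes _ | no n | _ = inj₂ (inj₁ (inj₂ n))
          ... | yes a | yes b | yes a' | yes b' | yes e = inj₂ (inj₂ (inj₂ (h a b a' b' e)))
          ... | yes a | yes b | yes a' | yes b' | no ne = inj₂ (inj₂ (inj₁ (((a , b) , (a' , b')) , ne)))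

  join-even : ∀ X Y v → join X Y (v + v) ≡ X v
  join-even X Y zero = refl
  join-even X Y (suc v) rewrite +-suc v v = join-even (λ k → X (suc k)) (λ k → Y (suc k)) v

  join-odd : ∀ X Y v → join X Y (suc (v + v)) ≡ Y v
  join-odd X Y zero = refl
  join-odd X Y (suc v) rewrite +-suc v v = join-odd (λ k → X (suc k)) (λ k → Y (suc k)) v

  parity : ∀ u → Σ ℕ λ v → u ≡ v + v ⊎ u ≡ suc (v + v)
  parity u with par u in eq | half-eq u
  ... | true | h = half u , inj₂ (trans h (+-comm _ 1))
  ... | false | h = half u , inj₁ (trans h (+-identityʳ _))

  module _ {l : Bool} {I : Set} {Ps : I → Stack} where

    joinD : ∀ b → Def l Ps (λ i ρ → join Z (bit (ρ 1)) (ρ 0) ≡ b)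
    joinD b = mapD (λ i ρ → fwd ρ , bwd ρ)
        (exD (orD (andD (eqD (var 1) (plus (var 0) (var 0))) (zD b))
                  (andD (eqD (var 1) (plus (lit 1) (plus (var 0) (var 0)))) (bitD b (var 2) (var 0)))))
      where
        zD : ∀ b → Def l Ps (λ i ρ → Z (ρ 0) ≡ b)
        zD true = bfD (inX (var 0))
        zD false = mapD (λ i ρ → not-true , λ e t → true≢false t e) (bfD (negF (inX (var 0))))
        fwd : ∀ (ρ : Env) → (Σ ℕ λ v → (ρ 0 ≡ v + v × Z v ≡ b) ⊎ (ρ 0 ≡ suc (v + v) × bit (ρ 1) v ≡ b)) → join Z (bit (ρ 1)) (ρ 0) ≡ b
        fwd ρ (v , inj₁ (e , z)) = trans (cong (join Z (bit (ρ 1))) e) (trans (join-even Z (bit (ρ 1)) v) z)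
        fwd ρ (v , inj₂ (e , z)) = trans (cong (join Z (bit (ρ 1))) e) (trans (join-odd Z (bit (ρ 1)) v) z)
        bwd : ∀ (ρ : Env) → join Z (bit (ρ 1)) (ρ 0) ≡ b → Σ ℕ λ v → (ρ 0 ≡ v + v × Z v ≡ b) ⊎ (ρ 0 ≡ suc (v + v) × bit (ρ 1) v ≡ b)
        bwd ρ h with parity (ρ 0)
        ... | v , inj₁ e = v , inj₁ (e , trans (sym (trans (cong (join Z (bit (ρ 1))) e) (join-even Z (bit (ρ 1)) v))) h)
        ... | v , inj₂ e = v , inj₂ (e , trans (sym (trans (cong (join Z (bit (ρ 1))) e) (join-odd Z (bit (ρ 1)) v))) h)

    private
      Tr : (Env → ℕ → Set) → Set
      Tr A = ∀ (σ : ℕ → Term) (T : ℕ) → Def l Ps (λ i ρ → A (λ k → evalT ρ (σ k)) (ρ T))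

    -- Bounded formulas about a finite set are decided, so both they and their negations translate.
    satD : ∀ φ → Tr (λ ρ T → Sat (join Z (bit T)) ρ φ)
    nsatD : ∀ φ → Tr (λ ρ T → ¬ Sat (join Z (bit T)) ρ φ)

    satD (eqF s t) σ T = mapD (λ i ρ → Sat-sub (eqF s t) {Z} σ ρ) (bfD (subB σ (eqF s t)))
    satD (ltF s t) σ T = mapD (λ i ρ → Sat-sub (ltF s t) {Z} σ ρ) (bfD (subB σ (ltF s t)))
    satD (inX t) σ T = mapD (λ i ρ → subst (_∈ join Z (bit (ρ T))) (evalT-sub σ ρ t) , subst (_∈ join Z (bit (ρ T))) (sym (evalT-sub σ ρ t)))
      (subD (pair (subT σ t) (var T)) (joinD true))
    satD (negF φ) σ T = nsatD φ σ T
    satD (andF φ ψ) σ T = andD (satD φ σ T) (satD ψ σ T)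
    satD (orF φ ψ) σ T = orD (satD φ σ T) (satD ψ σ T)
    satD (allLt t φ) σ T = mapD (λ i ρ →
        (λ p x lt → Sat-cong φ (λ _ → refl) (ext-lift σ x ρ) (p x (subst (x <_) (sym (evalT-sub σ ρ t)) lt)))
      , (λ p x lt → Sat-cong φ (λ _ → refl) (λ k → sym (ext-lift σ x ρ k)) (p x (subst (x <_) (evalT-sub σ ρ t) lt))))
      (alD (subT σ t) (satD φ (lift σ) (suc T)))
    satD (exLt t φ) σ T = mapD (λ i ρ →
        (λ { (x , lt , p) → x , subst (x <_) (trans (evalT-wk x ρ (subT σ t)) (evalT-sub σ ρ t)) lt , Sat-cong φ (λ _ → refl) (ext-lift σ x ρ) p })
      , (λ { (x , lt , p) → x , subst (x <_) (sym (trans (evalT-wk x ρ (subT σ t)) (evalT-sub σ ρ t))) lt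
                              , Sat-cong φ (λ _ → refl) (λ k → sym (ext-lift σ x ρ k)) p }))
      (exD (andD (ltD (var 0) (wk (subT σ t))) (satD φ (lift σ) (suc T))))
    nsatD (eqF s t) σ T = mapD (λ i ρ → Sat-sub (negF (eqF s t)) {Z} σ ρ) (bfD (subB σ (negF (eqF s t))))
    nsatD (ltF s t) σ T = mapD (λ i ρ → Sat-sub (negF (ltF s t)) {Z} σ ρ) (bfD (subB σ (negF (ltF s t))))
    nsatD (inX t) σ T = mapD (λ i ρ →
        (λ e p → true≢false p (trans (cong (join Z (bit (ρ T))) (sym (evalT-sub σ ρ t))) e))
      , (λ n → trans (cong (join Z (bit (ρ T))) (evalT-sub σ ρ t)) (not-true n)))
      (subD (pair (subT σ t) (var T)) (joinD false))
    nsatD (negF φ) σ T = mapD (λ i ρ → (λ p n → n p) , dne) (satD φ σ T)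
    nsatD (andF φ ψ) σ T = mapD (λ i ρ → (λ { (inj₁ n) (p , q) → n p ; (inj₂ n) (p , q) → n q })
                                        , (λ n → or-else′ (λ p q → n (p , q)))) (orD (nsatD φ σ T) (nsatD ψ σ T))
      where
        or-else′ : ∀ {A B : Set} → (A → ¬ B) → ¬ A ⊎ ¬ B
        or-else′ {A} h with em {A}
        ... | yes a = inj₂ (h a)
        ... | no na = inj₁ na
    nsatD (orF φ ψ) σ T = mapD (λ i ρ → (λ { (n , m) (inj₁ p) → n p ; (n , m) (inj₂ q) → m q })
                                       , (λ n → (λ p → n (inj₁ p)) , (λ q → n (inj₂ q)))) (andD (nsatD φ σ T) (nsatD ψ σ T))
    nsatD (allLt t φ) σ T = mapD (λ i ρ →
        (λ { (x , lt , n) p → n (Sat-cong φ (λ _ → refl) (λ k → sym (ext-lift σ x ρ k))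
                                   (p x (subst (x <_) (trans (evalT-wk x ρ (subT σ t)) (evalT-sub σ ρ t)) lt))) })
      , (λ n → let (x , m) = ¬∀⇒∃¬ n ; (lt , q) = ¬∀⇒∃¬ m
               in x , subst (x <_) (sym (trans (evalT-wk x ρ (subT σ t)) (evalT-sub σ ρ t))) lt
                    , λ p → q (Sat-cong φ (λ _ → refl) (ext-lift σ x ρ) p)))
      (exD (andD (ltD (var 0) (wk (subT σ t))) (nsatD φ (lift σ) (suc T))))
    nsatD (exLt t φ) σ T = mapD (λ i ρ →
        (λ { n (x , lt , p) → n x (subst (x <_) (sym (evalT-sub σ ρ t)) lt) (Sat-cong φ (λ _ → refl) (λ k → sym (ext-lift σ x ρ k)) p) })
      , (λ n x lt p → n (x , subst (x <_) (evalT-sub σ ρ t) lt , Sat-cong φ (λ _ → refl) (ext-lift σ x ρ) p)))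
      (alD (subT σ t) (nsatD φ (lift σ) (suc T)))

    opaque
      vioD : ∀ r n a T → Def l Ps (λ i ρ → Vio r (ρ n) (ρ a) (ρ T))
      vioD r n a T = mapD (λ i ρ →
          (λ { (b , h) → b , λ p → h (Sat-cong (fm r) (λ _ → refl) (λ k → sym (env≡ ρ b k)) p) })
        , (λ { (b , h) → b , λ p → h (Sat-cong (fm r) (λ _ → refl) (env≡ ρ b) p) }))
        (exD (nsatD (fm r) σ (suc T)))
        where
          σ : ℕ → Term
          σ 0 = var 0
          σ 1 = var (suc a)
          σ 2 = var (suc n)
          σ (suc (suc (suc _))) = lit 0
          env≡ : ∀ (ρ : Env) b k → evalT (ext b ρ) (σ k) ≡ ext b (ext (ρ a) (ext (ρ n) ρ₀)) k
          env≡ ρ b 0 = refl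
          env≡ ρ b 1 = refl
          env≡ ρ b 2 = refl
          env≡ ρ b (suc (suc (suc _))) = refl

      -- `s` is a number outside the formula: the definition is a disjunction of `s` fixed formulas,
      -- one for each code.
      vio<D : ∀ s r n a T → Def l Ps (λ i ρ → ρ r < s × Vio (ρ r) (ρ n) (ρ a) (ρ T))
      vio<D zero r n a T = mapD (λ i ρ → (λ ()) , (λ { (() , _) })) (constD ⊥)
      vio<D (suc s) r n a T = mapD (λ i ρ → fwd ρ , bwd ρ)
          (orD (vio<D s r n a T) (andD (eqD (var r) (lit s)) (vioD s n a T)))
        where
          V : Env → ℕ → Set
          V ρ r' = Vio r' (ρ n) (ρ a) (ρ T)
          fwd : ∀ ρ → (ρ r < s × V ρ (ρ r)) ⊎ (ρ r ≡ s × V ρ s) → ρ r < suc s × V ρ (ρ r)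
          fwd ρ (inj₁ (lt , v)) = m<n⇒m<1+n lt , v
          fwd ρ (inj₂ (e , v)) = ≤-reflexive (cong suc e) , subst (V ρ) (sym e) v
          bwd : ∀ ρ → ρ r < suc s × V ρ (ρ r) → (ρ r < s × V ρ (ρ r)) ⊎ (ρ r ≡ s × V ρ s)
          bwd ρ (lt , v) with m<1+n⇒m<n∨m≡n lt
          ... | inj₁ lt' = inj₁ (lt' , v)
          ... | inj₂ e = inj₂ (e , subst (V ρ) e v)

  -- Smallness as a Π₁ statement, and the questions of the forcing

  -- For want of a universal formula, U is definable for finitely many requirements at a time only.
  U< : ℕ → ℕ → ℕ → Set
  U< s i E = Σ ℕ λ r → Σ ℕ λ n → Σ ℕ λ T → Σ ℕ λ a → Σ ℕ λ T' → i ≡ idx r n T a × T' ≡ uni T E × Rb T' × r < s × Vio r n a T'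

  U<⇒U : ∀ {s i E} → U< s i E → U i E
  U<⇒U (r , n , T , a , _ , e , refl , rb , lt , v) = r , n , T , a , e , rb , v

  Below : ℕ → ℕ → Set
  Below s i = ∀ r n T a → i ≡ idx r n T a → r < s

  U⇒U< : ∀ {s i E} → Below s i → U i E → U< s i E
  U⇒U< b (r , n , T , a , e , rb , v) = r , n , T , a , _ , e , refl , rb , b r n T a e , v

  -- Failure of `O` as a witness of smallness, listed so that all oracle atoms occur positively:
  -- `fanD` then makes the absence of a witness Σ₁.
  Covered : ℕ → PO → ℕ → ℕ → Set
  Covered s O L k = ViolThin O k
    ⊎ ((Σ ℕ λ y → ∀ ε → ε ∈ bit L → cov O ε y false)
    ⊎ (Σ ℕ λ ε → Σ ℕ λ E → Σ ℕ λ j → Σ ℕ λ i → ε ∈ bit L × ε ≡ pr j i × (∀ y → y ∈ bit E → cov O ε y true) × IndO O k E × U< s i E))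

  -- X codes a cover of ω by sets indexed by L together with k hypergraphs; Fails says that some X
  -- witnesses that the whole space is small for the promises in L.
  Fails : ℕ → ℕ → ℕ → Set
  Fails s L k = ¬ (∀ X → Covered s (tot X) L k)

  module _ {l : Bool} {I : Set} {Ps : I → Stack} where

    U<D : ∀ s i E → Def l Ps (λ _ ρ → U< s (ρ i) (ρ E))
    U<D s i E = exD (exD (exD (exD (exD (andD (idxD (5 + i) 4 3 2 1) (andD (uniD 0 2 (5 + E)) (andD (rbD 0) (vio<D s 4 3 1 0))))))))

  module _ {l : Bool} {I : Set} {Ps : I → Stack} where

    private
      Qs : PO × I → Stack
      Qs Oi = proj₁ Oi ∷ˢ Ps (proj₂ Oi)

    codeD : ∀ b c x y → Def l Qs (λ Oi ρ → proj₁ Oi (pr c (pr (ρ x) (ρ y))) ≡ just b)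
    codeD b c x y = mapD (λ Oi ρ → (λ { (_ , _ , refl , refl , h) → h }) , (λ h → _ , _ , refl , refl , h))
        (exD (exD (andD (prD (var 1) (var (2 + x)) (var (2 + y))) (andD (prD (var 0) (lit c) (var 1)) (oD b)))))
      where
        oD : ∀ b → Def l Qs (λ Oi ρ → proj₁ Oi (ρ 0) ≡ just b)
        oD true = opD 0 (var 0)
        oD false = onD 0 (var 0)

    edgeD : ∀ b m e → Def l Qs (λ Oi ρ → edge (proj₁ Oi) (ρ m) (ρ e) b)
    edgeD b m e = codeD b 1 m e

    covD : ∀ b ε y → Def l Qs (λ Oi ρ → cov (proj₁ Oi) (ρ ε) (ρ y) b)
    covD b ε y = codeD b 0 ε y

    indD : ∀ (k : Term) E → Def l Qs (λ Oi ρ → IndO (proj₁ Oi) (evalT ρ k) (ρ E))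
    indD k E = mapD (λ Oi ρ → fwd (proj₁ Oi) ρ , bwd (proj₁ Oi) ρ)
        (alD k (alD (plus (lit 1) (var (suc E))) (orD (eqD (var 0) (lit 0)) (orD (nsubD 0 (2 + E)) (edgeD false 1 0)))))
      where
        Body : PO → ℕ → ℕ → ℕ → Set
        Body O m e E = e ≡ 0 ⊎ ((Σ ℕ λ z → z ∈ bit e × bit E z ≡ false) ⊎ edge O m e false)
        fwd : ∀ O ρ → (∀ m → m < evalT ρ k → ∀ e → e < suc (ρ E) → Body O m e (ρ E)) → IndO O (evalT ρ k) (ρ E)
        fwd O ρ h m lt e ne sub with h m lt e (s≤s (bit-mono e (ρ E) sub))
        ... | inj₁ z = ⊥-elim (ne z)
        ... | inj₂ (inj₁ (z , p , q)) = true≢false (sub z p) q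
        ... | inj₂ (inj₂ d) = d
        bwd : ∀ O ρ → IndO O (evalT ρ k) (ρ E) → (∀ m → m < evalT ρ k → ∀ e → e < suc (ρ E) → Body O m e (ρ E))
        bwd O ρ h m lt e _ = or-else λ ne → or-else λ nsub → h m lt e ne λ z p → dne λ nq → nsub (z , p , not-true nq)

    violThinD : ∀ (k : Term) → Def l Qs (λ Oi ρ → ViolThin (proj₁ Oi) (evalT ρ k))
    violThinD k = mapD (λ Oi ρ → (λ { (m , lt , h) → m , subst (m <_) (evalT-wk m ρ k) lt , h })
                                , (λ { (m , lt , h) → m , subst (m <_) (sym (evalT-wk m ρ k)) lt , h }))
      (exD (andD (ltD (var 0) (wk k)) (andD
        (exD (exD (exD (andD (neD (var 1) (var 0)) (andD (aboveD 2 1) (andD (aboveD 2 0)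
          (exD (exD (andD (insD 1 4 3) (andD (insD 0 4 2) (andD (edgeD true 5 1) (edgeD true 5 0))))))))))))
        (exD (exD (exD (andD (neD (var 1) (var 0)) (andD (sideD 2 1) (andD (sideD 2 0)
          (exD (exD (andD (insD 1 4 3) (andD (insD 0 4 2) (andD (edgeD true 5 1) (edgeD true 5 0)))))))))))))))

    coveredD : ∀ s L k → Def l Qs (λ Oi ρ → Covered s (proj₁ Oi) (ρ L) (ρ k))
    coveredD s L k = orD (violThinD (var k)) (orD
      (exD (allInD (1 + L) (covD false 0 1)))
      (exD (exD (exD (exD (andD (memD (4 + L) 3) (andD (prD (var 3) (var 1) (var 0))
        (andD (allInD 2 (covD true 4 0)) (andD (indD (var (4 + k)) 2) (U<D s 0 2))))))))))

  module _ {I : Set} {Ps : I → Stack} where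

    opaque
      -- The formula `Covered` contains no `pi` atom and only the oracle `X`, so after compactness
      -- it is Σ₁ in `Z` alone and its negation is available over every stack.
      failsD : ∀ s L k → Def true Ps (λ _ ρ → Fails s (ρ L) (ρ k))
      failsD s L k = negD (fanD {I = ⊤} {Ps = λ _ → ∅ˢ} {A = λ Oi ρ → Covered s (proj₁ Oi) (ρ L) (ρ k)} (coveredD s L k))

  Enumerable : Stack → SetN → Set
  Enumerable P X = Def true {⊤} (λ _ → P) (λ _ ρ → ρ 0 ∈ X)

  -- O is the limiting behaviour of the edges; Question asks whether the new promises at n make the
  -- whole space small.

  module _ (𝓤 Con : SetN) (F K r : ℕ) where

    New : PO → ℕ → ℕ → Set
    New O n i = Σ ℕ λ T → Σ ℕ λ a → Σ ℕ λ E → i ≡ idx r n T a × T ≡ uni F E × Rb T × E ∈ Con × IndO O K E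

    Question : ℕ → PO → ℕ → Set
    Question s O n = ViolThin O K ⊎ (Σ ℕ λ L → Σ ℕ λ k →
      (∀ ε → ε ∈ bit L → Σ ℕ λ j → Σ ℕ λ i → ε ≡ pr j i × (i ∈ 𝓤 ⊎ New O n i)) × Fails s L k)

    Meets : ℕ → ℕ → PO → Set
    Meets s i O = ViolThin O K ⊎ (Σ ℕ λ E → E ∈ Con × IndO O K E × U< s i E)

    module _ {P : Stack} (𝓤D : Enumerable P 𝓤) (ConD : Enumerable P Con) where

      private
        Qs : PO × ⊤ → Stack
        Qs Oi = proj₁ Oi ∷ˢ P

        liftD : ∀ {X : SetN} → Enumerable P X → ∀ x → Def true Qs (λ _ ρ → ρ x ∈ X)
        liftD d x = subD (pair (var x) (var x)) (reD (λ _ → tt) suc (λ Oi k t → refl) d)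

      newD : ∀ n i → Def true Qs (λ Oi ρ → New (proj₁ Oi) (ρ n) (ρ i))
      newD n i = mapD (λ Oi ρ →
          (λ { (T , a , E , _ , _ , refl , refl , h) → T , a , E , h }) , (λ { (T , a , E , h) → T , a , E , r , F , refl , refl , h }))
        (exD (exD (exD (exD (exD (andD (eqD (var 1) (lit r)) (andD (eqD (var 0) (lit F))
          (andD (idxD (5 + i) 1 (5 + n) 4 3) (andD (uniD 4 0 2) (andD (rbD 4) (andD (liftD ConD 2) (indD (lit K) 2))))))))))))

      opaque
        questionD : ∀ s n → Def true Qs (λ Oi ρ → Question s (proj₁ Oi) (ρ n))
        questionD s n = orD (violThinD (lit K)) (exD (exD (andD
          (allInD 1 (exD (exD (andD (prD (var 2) (var 1) (var 0)) (orD (liftD 𝓤D 0) (newD (5 + n) 0))))))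
          (failsD s 1 0))))

        meetsD : ∀ s i → Def true Qs (λ Oi ρ → Meets s (ρ i) (proj₁ Oi))
        meetsD s i = orD (violThinD (lit K)) (exD (andD (liftD ConD 0) (andD (indD (lit K) 0) (U<D s (suc i) 0))))

  -- The ideal of small sets

  cat : {A : Set} → ℕ → (ℕ → A) → (ℕ → A) → ℕ → A
  cat zero A B l = B l
  cat (suc k) A B zero = A zero
  cat (suc k) A B (suc l) = cat k (λ i → A (suc i)) B l

  cat-left : ∀ {X : Set} k (A B : ℕ → X) l → l < k → cat k A B l ≡ A l
  cat-left (suc k) A B zero lt = refl
  cat-left (suc k) A B (suc l) (s≤s lt) = cat-left k (λ i → A (suc i)) B l lt

  cat-right : ∀ {X : Set} k (A B : ℕ → X) l → cat k A B (k + l) ≡ B l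
  cat-right zero A B l = refl
  cat-right (suc k) A B l = cat-right k (λ i → A (suc i)) B l

  cat-all : ∀ {X : Set} (Q : X → Set) k k' (A B : ℕ → X) → (∀ l → l < k → Q (A l)) → (∀ l → l < k' → Q (B l)) →
    ∀ l → l < k + k' → Q (cat k A B l)
  cat-all Q zero k' A B a b l lt = b l lt
  cat-all Q (suc k) k' A B a b zero lt = a zero (s≤s z≤n)
  cat-all Q (suc k) k' A B a b (suc l) (s≤s lt) = cat-all Q k k' (λ i → A (suc i)) B (λ l lt → a (suc l) (s≤s lt)) b l lt

  cat-allˡ : ∀ {X : Set} (Q : X → Set) k k' (A B : ℕ → X) → (∀ l → l < k + k' → Q (cat k A B l)) → ∀ l → l < k → Q (A l)
  cat-allˡ Q k k' A B h l lt = subst Q (cat-left k A B l lt) (h l (≤-trans lt (m≤m+n k k')))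

  cat-allʳ : ∀ {X : Set} (Q : X → Set) k k' (A B : ℕ → X) → (∀ l → l < k + k' → Q (cat k A B l)) → ∀ l → l < k' → Q (B l)
  cat-allʳ Q k k' A B h l lt = subst Q (cat-right k A B l) (h (k + l) (+-monoʳ-< k lt))

  thin-⊆ : ∀ {h h'} → (∀ e → e ∈ h' → e ∈ h) → Thin h → Thin h'
  thin-⊆ sub (inj₁ ta) = inj₁ λ S y y' g a a' p p' → ta S y y' g a a' (sub _ p) (sub _ p')
  thin-⊆ sub (inj₂ tb) = inj₂ λ S y y' g a a' p p' → tb S y y' g a a' (sub _ p) (sub _ p')

  thin⇒wthin : ∀ {h} → Thin h → WThin h
  thin⇒wthin (inj₁ ta) = inj₁ λ S y y' _ → ta S y y' tt
  thin⇒wthin (inj₂ tb) = inj₂ λ S y y' _ → tb S y y' tt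

  wthin-empty : ∀ {h} → (∀ e → ¬ e ∈ h) → WThin h
  wthin-empty n = inj₁ λ S y y' _ _ _ p _ → ⊥-elim (n _ p)

  -- For empty `S` either shape says that two singleton edges coincide.
  unary-bound : ∀ {h} → Thin h → Σ ℕ λ u → ∀ y → u ≤ y → ¬ ins 0 y ∈ h
  unary-bound {h} th with em {Σ ℕ λ y → ins 0 y ∈ h}
  ... | no n = 0 , λ y _ p → n (y , p)
  ... | yes (y₀ , p₀) = suc y₀ , λ y le p → <⇒≢ le (unique th y p)
    where
      above : ∀ y → Above 0 y
      above y x m = ∅-empty m
      side : ∀ y → Side 0 y
      side y = bit-zero y , inj₁ refl
      unique : Thin h → ∀ y → ins 0 y ∈ h → y₀ ≡ y
      unique (inj₁ ta) y p = ta 0 y₀ y tt (above y₀) (above y) p₀ p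
      unique (inj₂ tb) y p = tb 0 y₀ y tt (side y₀) (side y) p₀ p

  opaque
    unary-bounds : ∀ k (H : ℕ → SetN) → (∀ l → l < k → Thin (H l)) → Σ ℕ λ u → ∀ y → u ≤ y → ∀ l → l < k → ¬ ins 0 y ∈ H l
    unary-bounds k H th = let (u , h) = bounds in u , λ y le l lt → h l lt y le
      where
        bounds : Σ ℕ λ u → ∀ l → l < k → ∀ y → u ≤ y → ¬ ins 0 y ∈ H l
        bounds = bounded {λ l u → ∀ y → u ≤ y → ¬ ins 0 y ∈ H l} (λ le h y le' → h y (≤-trans le le')) k (λ l lt → unary-bound {H l} (th l lt))

  -- Small sets form an ideal.

  _⊆_ : SetN → SetN → Set
  V ⊆ V' = ∀ y → y ∈ V → y ∈ V'

  Avoids : ℕ → (ℕ → SetN) → SetN → ℕ → Set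
  Avoids k H W i = ∀ E → bit E ⊆ W → (∀ l → l < k → Ind (H l) E) → ¬ U i E

  Small : SetN → SetN → Set
  Small 𝓤 V = Σ ℕ λ c → Σ (ℕ → ℕ × SetN) λ W → Σ ℕ λ k → Σ (ℕ → SetN) λ H → (∀ l → l < k → Thin (H l)) ×
    (∀ y → y ∈ V → Σ ℕ λ j → j < c × y ∈ proj₂ (W j)) × (∀ j → j < c → proj₁ (W j) ∈ 𝓤 × Avoids k H (proj₂ (W j)) (proj₁ (W j)))

  small-mono : ∀ {𝓤 𝓤' V V'} → 𝓤 ⊆ 𝓤' → V' ⊆ V → Small 𝓤 V → Small 𝓤' V'
  small-mono s t (c , W , k , H , th , cover , av) =
    c , W , k , H , th , (λ y m → cover y (t y m)) , λ j lt → s _ (proj₁ (av j lt)) , proj₂ (av j lt)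

  -- The two witnesses are put side by side. More hypergraphs leave fewer independent sets, so every
  -- piece still avoids its promise.
  small-∪ : ∀ {𝓤 V V' V''} → (∀ y → y ∈ V'' → y ∈ V ⊎ y ∈ V') → Small 𝓤 V → Small 𝓤 V' → Small 𝓤 V''
  small-∪ {𝓤} {V} {V'} {V''} un (c , W , k , H , th , cover , av) (c' , W' , k' , H' , th' , cover' , av') =
      c + c' , cat c W W' , k + k' , cat k H H' , cat-all Thin k k' H H' th th'
    , (λ y m → place y (un y m))
    , cat-all (λ iW → proj₁ iW ∈ 𝓤 × Avoids (k + k') (cat k H H') (proj₂ iW) (proj₁ iW)) c c' W W'
        (λ j lt → proj₁ (av j lt) , λ E s ind → proj₂ (av j lt) E s (cat-allˡ (λ h → Ind h E) k k' H H' ind))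
        (λ j lt → proj₁ (av' j lt) , λ E s ind → proj₂ (av' j lt) E s (cat-allʳ (λ h → Ind h E) k k' H H' ind))
    where
      place : ∀ y → y ∈ V ⊎ y ∈ V' → Σ ℕ λ j → j < c + c' × y ∈ proj₂ (cat c W W' j)
      place y (inj₁ m) = let (j , lt , p) = cover y m
        in j , ≤-trans lt (m≤m+n c c') , subst (λ w → y ∈ proj₂ w) (sym (cat-left c W W' j lt)) p
      place y (inj₂ m) = let (j , lt , p) = cover' y m
        in c + j , +-monoʳ-< c lt , subst (λ w → y ∈ proj₂ w) (sym (cat-right c W W' j)) p

  small-one : ∀ {𝓤 V} i k H → i ∈ 𝓤 → (∀ l → l < k → Thin (H l)) → Avoids k H V i → Small 𝓤 V
  small-one {𝓤} {V} i k H m th av = 1 , (λ _ → i , V) , k , H , th , (λ y p → 0 , s≤s z≤n , p) , λ j lt → m , av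

  all-true : SetN
  all-true _ = true

  below : ℕ → SetN
  below a = chr (_< a)

  upper : ℕ → SetN
  upper a = chr (a ≤_)

  infixr 6 _∩_
  _∩_ : SetN → SetN → SetN
  A ∩ B = chr (λ y → y ∈ A × y ∈ B)

  ∩ˡ : ∀ {A B} → (A ∩ B) ⊆ A
  ∩ˡ y m = proj₁ (chr⁻ m)

  ∩ʳ : ∀ {A B} → (A ∩ B) ⊆ B
  ∩ʳ y m = proj₂ (chr⁻ m)

  instance₀ : ∀ {G a b} → ¬ instance₂ G 0 0 a b ↔ (b ∈ G × ¬ b < a)
  instance₀ {G} {a} {b} = (λ h → let (p , q) = dne h in trans (sym (join-odd Z G b)) p , q)
                        , (λ { (p , q) h → h (trans (join-odd Z G b) p , q) })

  -- `idx 0 0 0 a` promises an element that is not below `a`, which no subset of `below a` supplies.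
  small-finite : ∀ {𝓤} → (∀ a → idx 0 0 0 a ∈ 𝓤) → ∀ a → Small 𝓤 (below a)
  small-finite {𝓤} base a = small-one {𝓤} (idx 0 0 0 a) 0 (λ _ → all-true) (base a) (λ l ()) avoid
    where
      avoid : Avoids 0 (λ _ → all-true) (below a) (idx 0 0 0 a)
      avoid E s _ (r , n , T , a' , e , rb , b , v) with idx-inj e
      ... | refl , refl , refl , refl = let (p , q) = proj₁ (instance₀ {bit (uni 0 E)}) v
                                        in q (chr⁻ (s b (subst (λ w → b ∈ bit w) (uni-∅ E) p)))

  module _ {𝓤 : SetN} (s : ℕ) where

    -- The witness is coded into one set `X`; the position `j` in `pr j (ix j)` keeps apart pieces
    -- attached to the same promise.
    small⇒fails : Small 𝓤 all-true → Σ ℕ λ L → Σ ℕ λ k → (∀ ε → ε ∈ bit L → Σ ℕ λ j → Σ ℕ λ i → ε ≡ pr j i × i ∈ 𝓤) × Fails s L k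
    small⇒fails (c , W , k , H , th , cover , av) = L , k , (λ ε m → let (j , lt , e) = proj₂ (fset⁻ m) in j , ix j , e , proj₁ (av j lt))
        , λ h → not-covered (h X)
      where
        ix : ℕ → ℕ
        ix j = proj₁ (W j)
        N : ℕ
        N = proj₁ (bounded {λ j m → pr j (ix j) < m} (λ le h → <-≤-trans h le) c (λ j _ → suc (pr j (ix j)) , ≤-refl))
        L : ℕ
        L = fset (λ ε → Σ ℕ λ j → j < c × ε ≡ pr j (ix j)) N
        in-L : ∀ j → j < c → pr j (ix j) ∈ bit L
        in-L j lt = fset⁺ (proj₂ (bounded {λ j m → pr j (ix j) < m} (λ le h → <-≤-trans h le) c (λ j _ → suc (pr j (ix j)) , ≤-refl)) j lt)
                          (j , lt , refl)
        Code : ℕ → Set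
        Code q = (Σ ℕ λ j → Σ ℕ λ y → q ≡ pr 0 (pr (pr j (ix j)) y) × y ∈ proj₂ (W j))
               ⊎ (Σ ℕ λ l → Σ ℕ λ e → q ≡ pr 1 (pr l e) × e ∈ H l)
        X : SetN
        X = chr Code
        X-cov : ∀ j y → X (pr 0 (pr (pr j (ix j)) y)) ≡ true → y ∈ proj₂ (W j)
        X-cov j y p with chr⁻ {Code} p
        ... | inj₂ (_ , _ , e , _) with pr-inj₁ e
        ...   | ()
        X-cov j y p | inj₁ (j' , y' , e , m) with pr-inj₂ {0} e
        ...   | e' with pr-inj₂ {pr j (ix j)} e' | pr-inj₁ {j} (pr-inj₁ {pr j (ix j)} e')
        ...     | refl | refl = m
        X-edge : ∀ l e → e ∈ edges X l → e ∈ H l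
        X-edge l e p with chr⁻ {Code} p
        ... | inj₁ (_ , _ , eq , _) with pr-inj₁ eq
        ...   | ()
        X-edge l e p | inj₂ (l' , e' , eq , m) with pr-inj₂ {1} eq
        ...   | eq' with pr-inj₁ {l} eq' | pr-inj₂ {l} eq'
        ...     | refl | refl = m
        not-covered : ¬ Covered s (tot X) L k
        not-covered (inj₁ v) = Thin⇒¬ViolThin X k (λ l lt → thin-⊆ (X-edge l) (th l lt)) v
        not-covered (inj₂ (inj₁ (y , h))) = let (j , lt , m) = cover y refl
          in true≢false (chr⁺ {Code} (inj₁ (j , y , refl , m))) (just-injective (h (pr j (ix j)) (in-L j lt)))
        not-covered (inj₂ (inj₂ (ε , E , j , i , m , e , cv , ind , u))) with proj₂ (fset⁻ m)
        ... | j' , lt , e' with pr-inj₁ {j} (trans (sym e) e') | pr-inj₂ {j} (trans (sym e) e')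
        ...   | refl | refl = proj₂ (av j lt) E
                (λ y p → X-cov j y (subst (λ w → X (pr 0 (pr w y)) ≡ true) e (just-injective (cv y p))))
                (λ l l< d ne sub → not-true λ p → true≢false (chr⁺ {Code} (inj₂ (l , d , refl , p))) (just-injective (ind l l< d ne sub)))
                (U<⇒U u)

  -- Adding promises: sets that stay large

  -- `bound` makes `U` agree with `U< s` on the promises made so far. `base` makes finite sets
  -- small, and `proper`, demanded of every state, makes the whole space stay large.
  record St : Set where
    field
      P : Stack
      nice : Nice P
      𝓤 : SetN
      𝓤D : Enumerable P 𝓤
      s : ℕ
      bound : ∀ i → i ∈ 𝓤 → Below s i
      proper : ¬ Small 𝓤 all-true
      base : ∀ a → idx 0 0 0 a ∈ 𝓤

  open St public

  infix 4 _⊒_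
  -- New oracles go on top of the stack, so old definitions survive a shift of the oracle numbers by
  -- `n`.
  _⊒_ : St → St → Set
  t' ⊒ t = (Σ ℕ λ n → ∀ k x → P t' (n + k) x ≡ P t k x) × 𝓤 t ⊆ 𝓤 t'

  ⊒-refl : ∀ {t} → t ⊒ t
  ⊒-refl = (0 , λ k x → refl) , λ i m → m

  ⊒-trans : ∀ {t t' t''} → t'' ⊒ t' → t' ⊒ t → t'' ⊒ t
  ⊒-trans {t} {t'} {t''} ((n , h) , s) ((n' , h') , s') =
    (n + n' , λ k x → trans (cong (λ j → P t'' j x) (+-assoc n n' k)) (trans (h (n' + k) x) (h' k x))) , λ i m → s i (s' i m)

  liftSt : ∀ {t t'} {A : Env → Set} → t' ⊒ t → Def true {⊤} (λ _ → P t) (λ _ → A) → Def true {⊤} (λ _ → P t') (λ _ → A)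
  liftSt ((n , h) , _) d = reD (λ _ → tt) (n +_) (λ _ k x → sym (h k x)) d

  -- Y stays large however many promises are added.
  Fv : St → SetN → Set
  Fv t Y = ∀ t' → t' ⊒ t → ¬ Small (𝓤 t') Y

  fv-ext : ∀ {t t' Y} → t' ⊒ t → Fv t Y → Fv t' Y
  fv-ext {t} {t'} e v t'' e' = v t'' (⊒-trans {t} {t'} {t''} e' e)

  fv-mono : ∀ {t Y Y'} → Y ⊆ Y' → Fv t Y → Fv t Y'
  fv-mono s v t' e sm = v t' e (small-mono {𝓤 t'} (λ i m → m) s sm)

  Split : St → SetN → SetN → Set
  Split t A B = Σ St λ t' → t' ⊒ t × (Fv t' A ⊎ Fv t' B)

  -- If `A` does not stay large, some later `t'` makes it small for good, and from `t'` on `B` must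
  -- be large because small sets form an ideal. Largeness at `t` alone would not do: a part that is
  -- large now may become small later.
  split : ∀ {t Y A B} → (∀ y → y ∈ Y → y ∈ A ⊎ y ∈ B) → Fv t Y → Split t A B
  split {t} {Y} {A} {B} un v with em {Fv t A}
  ... | yes va = t , ⊒-refl {t} , inj₁ va
  ... | no na with ¬∀⇒∃¬ na
  ...   | t' , n with ¬∀⇒∃¬ n
  ...     | e , sm = t' , e , inj₂ λ t'' e' smB →
              v t'' (⊒-trans {t} {t'} {t''} e' e) (small-∪ {𝓤 t''} un (small-mono {𝓤 t'} {𝓤 t''} {A} {A} (proj₂ e') (λ y m → m) (dne sm)) smB)

  fv-tail : ∀ {t Y} u → Fv t Y → Fv t (Y ∩ upper u)
  fv-tail {t} {Y} u v t' e sm = v t' e (small-∪ {𝓤 t'} un sm (small-finite {𝓤 t'} (base t') u))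
    where
      un : ∀ y → y ∈ Y → y ∈ Y ∩ upper u ⊎ y ∈ below u
      un y m with u ≤? y
      ... | yes le = inj₁ (chr⁺ (m , chr⁺ le))
      ... | no n = inj₂ (chr⁺ (≰⇒> n))

  -- An empty tail would be covered by no pieces at all, hence be small.
  fv-inhabited : ∀ {t Y} → Fv t Y → ∀ u → Σ ℕ λ y → u ≤ y × y ∈ Y
  fv-inhabited {t} {Y} v u = dne λ none → fv-tail {t} u v t (⊒-refl {t})
    (0 , (λ _ → 0 , all-true) , 0 , (λ _ → all-true) , (λ l ()) , (λ y m → ⊥-elim (none (y , chr⁻ (∩ʳ y m) , ∩ˡ y m))) , λ j ())

  split-cover : ∀ c (W : ℕ → SetN) {t Y} → (∀ y → y ∈ Y → Σ ℕ λ j → j < c × y ∈ W j) → Fv t Y →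
    Σ St λ t' → t' ⊒ t × Σ ℕ λ j → j < c × Fv t' (Y ∩ W j)
  split-cover zero W {t} {Y} cover v = ⊥-elim (none (fv-inhabited {t} v 0))
    where
      none : ¬ Σ ℕ λ y → 0 ≤ y × y ∈ Y
      none (y , _ , m) with cover y m
      ... | _ , () , _
  split-cover (suc c) W {t} {Y} cover v = go (split {t} un v)
    where
      rest : SetN
      rest = chr (λ y → y ∈ Y × Σ ℕ λ j → j < c × y ∈ W j)
      un : ∀ y → y ∈ Y → y ∈ Y ∩ W c ⊎ y ∈ rest
      un y m with cover y m
      ... | j , lt , w with m<1+n⇒m<n∨m≡n lt
      ...   | inj₁ lt' = inj₂ (chr⁺ (m , j , lt' , w))
      ...   | inj₂ refl = inj₁ (chr⁺ (m , w))
      go : Split t (Y ∩ W c) rest → Σ St λ t' → t' ⊒ t × Σ ℕ λ j → j < suc c × Fv t' (Y ∩ W j)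
      go (t' , e , inj₁ va) = t' , e , c , ≤-refl , va
      go (t' , e , inj₂ vb) with split-cover c W {t'} (λ y m → proj₂ (chr⁻ m)) vb
      ... | t'' , e' , j , lt , v' = t'' , ⊒-trans {t} {t'} {t''} e' e , j , m<n⇒m<1+n lt
          , fv-mono {t''} (λ y m → chr⁺ (proj₁ (chr⁻ (∩ˡ y m)) , ∩ʳ y m)) v'

  decide-all : ∀ N (D : ℕ → SetN) {t Y} → Fv t Y → Σ St λ t' → t' ⊒ t × Σ SetN λ Y' → Y' ⊆ Y × Fv t' Y' ×
    (∀ j → j < N → (∀ y → y ∈ Y' → y ∈ D j) ⊎ (∀ y → y ∈ Y' → ¬ y ∈ D j))
  decide-all zero D {t} {Y} v = t , ⊒-refl {t} , Y , (λ y m → m) , v , λ j ()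
  decide-all (suc N) D {t} {Y} v with decide-all N D {t} v
  ... | t₁ , e₁ , Y₁ , s₁ , v₁ , d₁ = go (split {t₁} un v₁)
    where
      out : SetN
      out = chr (λ y → y ∈ Y₁ × ¬ y ∈ D N)
      un : ∀ y → y ∈ Y₁ → y ∈ Y₁ ∩ D N ⊎ y ∈ out
      un y m with em {y ∈ D N}
      ... | yes p = inj₁ (chr⁺ (m , p))
      ... | no n = inj₂ (chr⁺ (m , n))
      Result : Set
      Result = Σ St λ t' → t' ⊒ t × Σ SetN λ Y' → Y' ⊆ Y × Fv t' Y' ×
        (∀ j → j < suc N → (∀ y → y ∈ Y' → y ∈ D j) ⊎ (∀ y → y ∈ Y' → ¬ y ∈ D j))
      finish : ∀ t₂ → t₂ ⊒ t₁ → (Y₂ : SetN) → Y₂ ⊆ Y₁ → Fv t₂ Y₂ → (∀ y → y ∈ Y₂ → y ∈ D N) ⊎ (∀ y → y ∈ Y₂ → ¬ y ∈ D N) → Result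
      finish t₂ e₂ Y₂ s₂ v₂ d = t₂ , ⊒-trans {t} {t₁} {t₂} e₂ e₁ , Y₂ , (λ y m → s₁ y (s₂ y m)) , v₂ , dec
        where
          dec : ∀ j → j < suc N → (∀ y → y ∈ Y₂ → y ∈ D j) ⊎ (∀ y → y ∈ Y₂ → ¬ y ∈ D j)
          dec j lt with m<1+n⇒m<n∨m≡n lt
          ... | inj₂ refl = d
          ... | inj₁ lt' with d₁ j lt'
          ...   | inj₁ p = inj₁ λ y m → p y (s₂ y m)
          ...   | inj₂ n = inj₂ λ y m → n y (s₂ y m)
      go : Split t₁ (Y₁ ∩ D N) out → Result
      go (t₂ , e₂ , inj₁ v₂) = finish t₂ e₂ (Y₁ ∩ D N) ∩ˡ v₂ (inj₁ ∩ʳ)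
      go (t₂ , e₂ , inj₂ v₂) = finish t₂ e₂ out (λ y m → proj₁ (chr⁻ m)) v₂ (inj₂ λ y m → proj₂ (chr⁻ m))

  -- Conditions and their extensions

  join-local : ∀ w {G G' : SetN} → (∀ x → x < suc w → G x ≡ G' x) → join Z G w ≡ join Z G' w
  join-local w {G} {G'} h with parity w
  ... | v , inj₁ refl = trans (join-even Z G v) (sym (join-even Z G' v))
  ... | v , inj₂ refl = trans (join-odd Z G v) (trans (h v (s≤s (≤-trans (m≤m+n v v) (n≤1+n _)))) (sym (join-odd Z G' v)))

  Use : BForm → Env → ℕ → Set
  Use φ ρ u = ∀ G G' → (∀ x → x < u → G x ≡ G' x) → Sat (join Z G) ρ φ → Sat (join Z G') ρ φ

  use-mono : ∀ {φ ρ u u'} → u ≤ u' → Use φ ρ u → Use φ ρ u'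
  use-mono le h G G' a = h G G' (λ x lt → a x (<-≤-trans lt le))

  use : ∀ φ ρ → Σ ℕ (Use φ ρ)
  use (eqF s t) ρ = 0 , λ G G' _ p → p
  use (ltF s t) ρ = 0 , λ G G' _ p → p
  use (inX t) ρ = suc (evalT ρ t) , λ G G' a p → trans (sym (join-local (evalT ρ t) a)) p
  use (negF φ) ρ with use φ ρ
  ... | u , h = u , λ G G' a n p → n (h G' G (λ x lt → sym (a x lt)) p)
  use (andF φ ψ) ρ with use φ ρ | use ψ ρ
  ... | u , h | u' , h' = u ⊔ u' , λ { G G' a (p , q) →
    use-mono {φ} {ρ} (m≤m⊔n u u') h G G' a p , use-mono {ψ} {ρ} (m≤n⊔m u u') h' G G' a q }
  use (orF φ ψ) ρ with use φ ρ | use ψ ρ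
  ... | u , h | u' , h' = u ⊔ u' , λ { G G' a (inj₁ p) → inj₁ (use-mono {φ} {ρ} (m≤m⊔n u u') h G G' a p)
                                    ; G G' a (inj₂ q) → inj₂ (use-mono {ψ} {ρ} (m≤n⊔m u u') h' G G' a q) }
  use (allLt t φ) ρ with bounded {λ x u → Use φ (ext x ρ) u} (λ {x} le → use-mono {φ} {ext x ρ} le) (evalT ρ t) (λ x _ → use φ (ext x ρ))
  ... | u , h = u , λ G G' a p x lt → h x lt G G' a (p x lt)
  use (exLt t φ) ρ with bounded {λ x u → Use φ (ext x ρ) u} (λ {x} le → use-mono {φ} {ext x ρ} le) (evalT ρ t) (λ x _ → use φ (ext x ρ))
  ... | u , h = u , λ { G G' a (x , lt , p) → x , lt , h x lt G G' a p }

  -- `Con` consists of the sets independent of all `H l`. Definability over the stack is demanded of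
  -- `Con` only; the hypergraphs `H` supply its combinatorics.
  record Cond : Set where
    field
      t : St
      F : ℕ
      rb : Rb F
      Con : SetN
      ConD : Enumerable (P t) Con
      k : ℕ
      H : ℕ → SetN
      weak : ∀ l → l < k → WThin (H l)
      con⇒ : ∀ E → E ∈ Con → ∀ l → l < k → Ind (H l) E
      con⇐ : ∀ E → (∀ l → l < k → Ind (H l) E) → E ∈ Con
      Y : SetN
      fv : Fv t Y
      sing : ∀ y → y ∈ Y → ∀ l → l < k → ¬ ins 0 y ∈ H l

  open Cond public

  Ext : Cond → Cond → Set
  Ext q' q = (t q' ⊒ t q) × Σ ℕ λ E → E ∈ Con q × F q' ≡ uni (F q) E × (∀ E' → E' ∈ Con q' → uni E E' ∈ Con q)

  ∅∈Con : ∀ q → 0 ∈ Con q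
  ∅∈Con q = con⇐ q 0 λ l _ e ne sub → ⊥-elim (ne (⊆-antisym sub (λ x m → ∅-empty m)))

  uni-∅ʳ : ∀ e → uni e 0 ≡ e
  uni-∅ʳ e = ⊆-antisym (λ x m → drop (uni⁻ {e} {0} m)) (λ x m → uniˡ {e} {0} m)
    where
      drop : ∀ {x} → x ∈ bit e ⊎ x ∈ bit 0 → x ∈ bit e
      drop (inj₁ m) = m
      drop (inj₂ m) = ∅-empty m

  ext-refl : ∀ q → Ext q q
  ext-refl q = ⊒-refl {t q} , 0 , ∅∈Con q , sym (uni-∅ʳ (F q)) , λ E' m → subst (_∈ Con q) (sym (uni-∅ E')) m

  ext-trans : ∀ {q q' q''} → Ext q'' q' → Ext q' q → Ext q'' q
  ext-trans {q} {q'} {q''} (e' , E' , m' , F' , c') (e , E , m , Fe , c) = ⊒-trans {t q} {t q'} {t q''} e' e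
    , uni E E' , c E' m' , trans F' (trans (cong (λ w → uni w E') Fe) (uni-assoc (F q) E E'))
    , λ D d → subst (_∈ Con q) (sym (uni-assoc E E' D)) (c (uni E' D) (c' D d))

  uni-ins : ∀ w S y → uni w (ins S y) ≡ ins (uni w S) y
  uni-ins w S y = ⊆-antisym (λ x m → fwd (uni⁻ {w} {ins S y} m)) (λ x m → bwd (ins⁻ m))
    where
      fwd : ∀ {x} → x ∈ bit w ⊎ x ∈ bit (ins S y) → x ∈ bit (ins (uni w S) y)
      fwd (inj₁ m) = ins-there (uniˡ {w} m)
      fwd {x} (inj₂ m) with ins⁻ {S} {y} {x} m
      ... | inj₁ refl = ins-here (uni w S) x
      ... | inj₂ m' = ins-there (uniʳ {w} m')
      bwd : ∀ {x} → x ≡ y ⊎ x ∈ bit (uni w S) → x ∈ bit (uni w (ins S y))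
      bwd {x} (inj₁ refl) = uniʳ {w} (ins-here S x)
      bwd {x} (inj₂ m) with uni⁻ {w} {S} {x} m
      ... | inj₁ m' = uniˡ {w} m'
      ... | inj₂ m' = uniʳ {w} (ins-there m')

  -- An edge `ins S y` with `S` nonempty and below `y` has two elements, so singletons never come
  -- under the weak condition.
  unary-weak : ∀ {h} → (∀ e → e ∈ h → Σ ℕ λ y → e ≡ ins 0 y) → WThin h
  unary-weak {h} un = inj₁ λ S y y' ne a a' p p' → ⊥-elim (clash S y ne a (un _ p))
    where
      single : ∀ {x y} → x ∈ bit (ins 0 y) → x ≡ y
      single {x} {y} m with ins⁻ {0} {y} {x} m
      ... | inj₁ e = e
      ... | inj₂ m' = ∅-empty m'
      clash : ∀ S y → S ≢ 0 → Above S y → (Σ ℕ λ y₀ → ins S y ≡ ins 0 y₀) → ⊥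
      clash S y ne a (y₀ , e) with nonempty S ne
      ... | s , m = <-irrefl (trans (single (subst (λ w → s ∈ bit w) e (ins-there m)))
                                    (sym (single (subst (λ w → y ∈ bit w) e (ins-here S y))))) (a s m)

  -- Extending F by E₀: the new constraint on later elements is the quotient of the old one by
  -- E₀, together with an additional constraint Con₂ and the bound u from below.
  module Grow (q : Cond) (t' : St) (e : t' ⊒ t q) (E₀ u : ℕ) (E₀∈ : E₀ ∈ Con q) (E₀< : ∀ x → x ∈ bit E₀ → x < u)
    (rb' : Rb (uni (F q) E₀)) (Y' : SetN) (v : Fv t' Y')
    (clear : ∀ y → y ∈ Y' → u ≤ y → ∀ l → l < k q → ∀ w → w ⊆ₑ E₀ → ¬ ins w y ∈ H q l)
    (Con₂ : SetN) (Con₂D : Enumerable (P t') Con₂) (k₂ : ℕ) (G : ℕ → SetN)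
    (wG : ∀ l → l < k₂ → WThin (G l)) (con₂⇒ : ∀ E → E ∈ Con₂ → ∀ l → l < k₂ → Ind (G l) E)
    (con₂⇐ : ∀ E → (∀ l → l < k₂ → Ind (G l) E) → E ∈ Con₂)
    (clear₂ : ∀ y → y ∈ Y' → u ≤ y → ∀ l → l < k₂ → ¬ ins 0 y ∈ G l) where

    High : ℕ → Set
    High E = ∀ x → x ∈ bit E → u ≤ x

    Q : ℕ
    -- The indices in use are `pr l w` with `l < k q` and `w ⊆ₑ E₀`, and the latter gives `w ≤ E₀`
    -- by `bit-mono`.
    Q = suc (pr (k q) E₀)

    Quot : ℕ → ℕ → Set
    Quot j d = (left j < k q × right j ⊆ₑ E₀) × High d × uni (right j) d ∈ H q (left j)

    quot : ℕ → SetN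
    quot j = chr (Quot j)

    Low : ℕ → Set
    Low d = Σ ℕ λ y → y < u × d ≡ ins 0 y

    low : ℕ → SetN
    low _ = chr Low

    fam : ℕ → SetN
    fam = cat Q quot (cat 1 low G)

    -- `w` lies below `u` and quotient edges do not, so adding `w` to `S` changes neither which
    -- element is last nor which are new. As `S` is nonempty, a side element still has an element of
    -- `S` above it.
    quot-weak : ∀ j → WThin (quot j)
    quot-weak j with em {left j < k q × right j ⊆ₑ E₀}
    ... | no n = wthin-empty {quot j} λ d m → n (proj₁ (chr⁻ {Quot j} {d} m))
    ... | yes (lt , w⊆) = cases (weak q (left j) lt)
      where
        w = right j
        high : ∀ {S y} → ins S y ∈ quot j → u ≤ y
        high {S} {y} m = proj₁ (proj₂ (chr⁻ {Quot j} m)) y (ins-here S y)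
        into : ∀ {S y} → ins S y ∈ quot j → ins (uni w S) y ∈ H q (left j)
        into {S} {y} m = subst (_∈ H q (left j)) (uni-ins w S y) (proj₂ (proj₂ (chr⁻ {Quot j} m)))
        ne' : ∀ {S} → S ≢ 0 → uni w S ≢ 0
        ne' {S} ne = nonempty⁻ (uniʳ {w} (proj₂ (nonempty S ne)))
        abv : ∀ {S y} → Above S y → ins S y ∈ quot j → Above (uni w S) y
        abv {S} {y} a m x p with uni⁻ {w} {S} {x} p
        ... | inj₁ p' = <-≤-trans (E₀< x (w⊆ x p')) (high {S} m)
        ... | inj₂ p' = a x p'
        sd : ∀ {S x} → S ≢ 0 → Side S x → ins S x ∈ quot j → Side (uni w S) x
        sd {S} {x} ne (out , inj₁ z) m = ⊥-elim (ne z)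
        sd {S} {x} ne (out , inj₂ (z , p , lt)) m = not-true fresh , inj₂ (z , uniʳ {w} p , lt)
          where
            fresh : ¬ x ∈ bit (uni w S)
            fresh p with uni⁻ {w} {S} {x} p
            ... | inj₁ p' = <⇒≱ (E₀< x (w⊆ x p')) (high {S} m)
            ... | inj₂ p' = true≢false p' out
        cases : WThin (H q (left j)) → WThin (quot j)
        cases (inj₁ ta) = inj₁ λ S y y' ne a a' p p' → ta (uni w S) y y' (ne' ne) (abv a p) (abv a' p') (into p) (into p')
        cases (inj₂ tb) = inj₂ λ S x x' ne s s' p p' → tb (uni w S) x x' (ne' ne) (sd ne s p) (sd ne s' p') (into p) (into p')

    weak' : ∀ l → l < Q + (1 + k₂) → WThin (fam l)
    weak' = cat-all WThin Q (1 + k₂) quot (cat 1 low G) (λ j _ → quot-weak j)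
      (cat-all WThin 1 k₂ low G (λ _ _ → unary-weak λ d m → let (y , _ , eq) = chr⁻ {Low} m in y , eq) wG)

    Con'-spec : ℕ → Set
    Con'-spec E = High E × uni E₀ E ∈ Con q × E ∈ Con₂

    Con' : SetN
    Con' = chr Con'-spec

    Con'D : Enumerable (P t') Con'
    Con'D = mapD (λ _ ρ → (λ { (h , (_ , _ , refl , refl , c) , c₂) → chr⁺ ((λ x m → ≮⇒≥ (h x m)) , c , c₂) })
                         , (λ m → let (h , c , c₂) = chr⁻ {Con'-spec} m in (λ x p → ≤⇒≯ (h x p)) , (_ , _ , refl , refl , c) , c₂))
      (andD (allInD 0 (nltD (var 0) (lit u)))
        (andD (exD (exD (andD (eqD (var 0) (lit E₀)) (andD (uniD 1 0 2) (subD (pair (var 1) (var 1)) (liftSt {t q} {t'} e (ConD q)))))))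
          Con₂D))

    con'⇒ : ∀ E → E ∈ Con' → ∀ l → l < Q + (1 + k₂) → Ind (fam l) E
    con'⇒ E m = cat-all (λ h → Ind h E) Q (1 + k₂) quot (cat 1 low G) quot-ind
        (cat-all (λ h → Ind h E) 1 k₂ low G (λ _ _ → low-ind) (con₂⇒ E (proj₂ (proj₂ spec))))
      where
        spec : Con'-spec E
        spec = chr⁻ m
        quot-ind : ∀ j → j < Q → Ind (quot j) E
        quot-ind j _ d ne sub = not-true λ p → bad (chr⁻ {Quot j} p)
          where
            bad : ¬ Quot j d
            bad ((lt , w⊆) , _ , hm) = true≢false hm (con⇒ q (uni E₀ E) (proj₁ (proj₂ spec)) (left j) lt (uni (right j) d)
              (nonempty⁻ (uniʳ {right j} (proj₂ (nonempty d ne)))) sub')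
              where
                sub' : uni (right j) d ⊆ₑ uni E₀ E
                sub' x p with uni⁻ {right j} {d} {x} p
                ... | inj₁ p' = uniˡ {E₀} (w⊆ x p')
                ... | inj₂ p' = uniʳ {E₀} (sub x p')
        low-ind : Ind (chr Low) E
        low-ind d ne sub = not-true λ p → bad (chr⁻ {Low} p)
          where
            bad : ¬ Low d
            bad (y , lt , refl) = <⇒≱ lt (proj₁ spec y (sub y (ins-here 0 y)))

    con'⇐ : ∀ E → (∀ l → l < Q + (1 + k₂) → Ind (fam l) E) → E ∈ Con'
    con'⇐ E ind = chr⁺ (high , con⇐ q (uni E₀ E) old , con₂⇐ E (cat-allʳ (λ h → Ind h E) 1 k₂ low G rest))
      where
        quots : ∀ j → j < Q → Ind (quot j) E
        quots = cat-allˡ (λ h → Ind h E) Q (1 + k₂) quot (cat 1 low G) ind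
        rest : ∀ l → l < 1 + k₂ → Ind (cat 1 low G l) E
        rest = cat-allʳ (λ h → Ind h E) Q (1 + k₂) quot (cat 1 low G) ind
        high : High E
        high x m = ≮⇒≥ λ lt → true≢false (chr⁺ {Low} (x , lt , refl))
          (rest 0 (s≤s z≤n) (ins 0 x) (nonempty⁻ (ins-here 0 x)) λ z p → single z (ins⁻ p))
          where
            single : ∀ z → z ≡ x ⊎ z ∈ bit 0 → z ∈ bit E
            single z (inj₁ refl) = m
            single z (inj₂ p) = ∅-empty p
        -- An edge inside the union is split into `w` within `E₀` and `d'` within `E`. If `d'` is
        -- nonempty it is an edge of the quotient `pr l w`; otherwise the edge lies in `E₀`, which
        -- `E₀∈` excludes.
        old : ∀ l → l < k q → Ind (H q l) (uni E₀ E)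
        old l lt d ne sub = not-true λ hm → bad hm
          where
            w d' : ℕ
            w = fset (λ x → x ∈ bit d × x ∈ bit E₀) d
            d' = fset (λ x → x ∈ bit d × x ∈ bit E) d
            w⊆ : w ⊆ₑ E₀
            w⊆ x p = proj₂ (proj₂ (fset⁻ p))
            d'⊆ : d' ⊆ₑ E
            d'⊆ x p = proj₂ (proj₂ (fset⁻ p))
            d≡ : uni w d' ≡ d
            d≡ = ⊆-antisym (λ x p → back x (uni⁻ {w} {d'} p)) (λ x p → forth x p (uni⁻ {E₀} {E} (sub x p)))
              where
                back : ∀ x → x ∈ bit w ⊎ x ∈ bit d' → x ∈ bit d
                back x (inj₁ p) = proj₁ (proj₂ (fset⁻ p))
                back x (inj₂ p) = proj₁ (proj₂ (fset⁻ p))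
                forth : ∀ x → x ∈ bit d → x ∈ bit E₀ ⊎ x ∈ bit E → x ∈ bit (uni w d')
                forth x p (inj₁ m) = uniˡ {w} (fset⁺ (bit< d x p) (p , m))
                forth x p (inj₂ m) = uniʳ {w} (fset⁺ (bit< d x p) (p , m))
            bad : ¬ d ∈ H q l
            bad hm with d' ≟ 0
            ... | yes z = true≢false hm (con⇒ q E₀ E₀∈ l lt d ne λ x p → w⊆ x (subst (λ c → x ∈ bit c) (sym d≡w) p))
              where
                d≡w : w ≡ d
                d≡w = trans (sym (uni-∅ʳ w)) (trans (cong (uni w) (sym z)) d≡)
            ... | no ne' = true≢false (chr⁺ {Quot (pr l w)} ((subst (_< k q) (sym (left-pr l w)) lt
                  , subst (_⊆ₑ E₀) (sym (right-pr l w)) w⊆) , (λ x p → high x (d'⊆ x p))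
                  , subst₂ (λ a b → uni a d' ∈ H q b) (sym (right-pr l w)) (sym (left-pr l w)) (subst (_∈ H q l) (sym d≡) hm)))
                (quots (pr l w) (s≤s (pr-mono (<⇒≤ lt) (bit-mono w E₀ w⊆))) d' ne' d'⊆)

    Y'' : SetN
    Y'' = Y' ∩ upper u

    sing' : ∀ y → y ∈ Y'' → ∀ l → l < Q + (1 + k₂) → ¬ ins 0 y ∈ fam l
    sing' y m = cat-all (λ h → ¬ ins 0 y ∈ h) Q (1 + k₂) quot (cat 1 low G) quot-sing
        (cat-all (λ h → ¬ ins 0 y ∈ h) 1 k₂ low G (λ _ _ → low-sing) (clear₂ y (∩ˡ y m) u≤y))
      where
        u≤y : u ≤ y
        u≤y = chr⁻ (∩ʳ y m)
        quot-sing : ∀ j → j < Q → ¬ ins 0 y ∈ quot j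
        quot-sing j _ p with chr⁻ {Quot j} p
        ... | (lt , w⊆) , _ , hm = clear y (∩ˡ y m) u≤y (left j) lt (right j) w⊆
          (subst (_∈ H q (left j)) (trans (uni-ins (right j) 0 y) (cong (λ c → ins c y) (uni-∅ʳ (right j)))) hm)
        low-sing : ¬ ins 0 y ∈ chr Low
        low-sing p with chr⁻ {Low} p
        ... | y₀ , lt , eq with ins⁻ {0} {y₀} {y} (subst (λ c → y ∈ bit c) eq (ins-here 0 y))
        ...   | inj₁ refl = <⇒≱ lt u≤y
        ...   | inj₂ z = ∅-empty z

    grown : Cond
    grown = record
      { t = t' ; F = uni (F q) E₀ ; rb = rb' ; Con = Con' ; ConD = Con'D ; k = Q + (1 + k₂) ; H = fam ; weak = weak'
      ; con⇒ = con'⇒ ; con⇐ = con'⇐ ; Y = Y'' ; fv = fv-tail {t'} {Y'} u v ; sing = sing' }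

    grown-ext : Ext grown q
    grown-ext = e , E₀ , E₀∈ , refl , λ E m → proj₁ (proj₂ (chr⁻ {Con'-spec} m))

    grown-con : ∀ E → E ∈ Con' → Con'-spec E
    grown-con E m = chr⁻ m

  ins-comm : ∀ S x y → ins (ins S x) y ≡ ins (ins S y) x
  ins-comm S x y = ⊆-antisym (half-comm x y) (half-comm y x)
    where
      half-comm : ∀ x y → ins (ins S x) y ⊆ₑ ins (ins S y) x
      half-comm x y z m with ins⁻ {ins S x} {y} {z} m
      ... | inj₁ refl = ins-there (ins-here S z)
      ... | inj₂ m' with ins⁻ {S} {x} {z} m'
      ...   | inj₁ refl = ins-here (ins S y) z
      ...   | inj₂ m'' = ins-there (ins-there m'')

  -- The limiting behaviour of the constraint

  -- After finitely many decisions on Y, the sets w below m that are completed to an edge by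
  -- every later element of Y form thin hypergraphs M; sets independent of M can be added.
  record Atoms (q : Cond) (m : ℕ) : Set where
    field
      t' : St
      above : t' ⊒ t q
      Y' : SetN
      Y'⊆ : Y' ⊆ Y q
      fv' : Fv t' Y'
      M : SetN
      thin : ∀ l → l < suc (k q) → Thin (edges M l)
      good : ∀ E → (∀ x → x ∈ bit E → x < m) → (∀ l → l < suc (k q) → Ind (edges M l) E) →
        ∀ y → y ∈ Y' → m ≤ y → ∀ l → l < k q → ∀ w → w ⊆ₑ E → ¬ ins w y ∈ H q l

  atoms : ∀ q m → Atoms q m
  atoms q m = build (decide-all N D {t q} {Y q} (fv q))
    where
      full : ℕ
      -- The largest code of a set below `m`, so that `N` exceeds every index `pr l w` to be
      -- decided.
      full = mk (λ _ → true) m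
      N : ℕ
      N = suc (pr (k q) full)
      D : ℕ → SetN
      D j = chr (λ y → ins (right j) y ∈ H q (left j))
      Decided : SetN → Set
      Decided Y' = ∀ j → j < N → (∀ y → y ∈ Y' → y ∈ D j) ⊎ (∀ y → y ∈ Y' → ¬ y ∈ D j)
      build : (Σ St λ t' → t' ⊒ t q × Σ SetN λ Y' → Y' ⊆ Y q × Fv t' Y' × Decided Y') → Atoms q m
      build (t' , e , Y' , Y'⊆ , v , dec) = record
        { t' = t' ; above = e ; Y' = Y' ; Y'⊆ = Y'⊆ ; fv' = v ; M = chr Code ; thin = λ l _ → thin l ; good = good }
        where
          Spec : ℕ → ℕ → Set
          Spec l w = w ≢ 0 × l < k q × (∀ x → x ∈ bit w → x < m) × (∀ y → y ∈ Y' → m ≤ y → ins w y ∈ H q l)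
          Code : ℕ → Set
          Code c = Σ ℕ λ l → Σ ℕ λ w → c ≡ pr 1 (pr l w) × Spec l w
          code⁻ : ∀ {l w} → w ∈ edges (chr Code) l → Spec l w
          code⁻ {l} {w} p with chr⁻ {Code} {pr 1 (pr l w)} p
          ... | l' , w' , eq , sp with pr-inj₂ {1} {pr l w} {1} {pr l' w'} eq
          ...   | eq' with pr-inj₁ {l} {w} {l'} {w'} eq' | pr-inj₂ {l} {w} {l'} {w'} eq'
          ...     | refl | refl = sp
          thin : ∀ l → Thin (edges (chr Code) l)
          thin l with em {l < k q}
          ... | no n = inj₁ λ S y y' _ _ _ p _ → ⊥-elim (n (proj₁ (proj₂ (code⁻ {l} {ins S y} p))))
          ... | yes lt with weak q l lt
          -- For the first shape no `w` qualifies: two different later elements of `Y'` would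
          -- complete the same nonempty `w`.
          ...   | inj₁ ta = inj₁ λ S y y' _ _ _ p _ → ⊥-elim (none (ins S y) (code⁻ {l} p))
            where
              none : ∀ w → ¬ Spec l w
              none w (ne , _ , small , all) with fv-inhabited {t'} {Y'} v m
              ... | y₁ , le₁ , m₁ with fv-inhabited {t'} {Y'} v (suc y₁)
              ...   | y₂ , le₂ , m₂ = <-irrefl (ta w y₁ y₂ ne (λ x p → <-≤-trans (small x p) le₁)
                        (λ x p → <-≤-trans (small x p) (≤-trans le₁ (<⇒≤ le₂))) (all y₁ m₁ le₁) (all y₂ m₂ (≤-trans le₁ (<⇒≤ le₂)))) le₂
          -- For the second shape one later `y` is added to `S`. Now `ins S y` is nonempty and has
          -- `x` below its element `y`, so weak thinness of `H q l` gives full thinness here, empty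
          -- `S` included.
          ...   | inj₂ tb = inj₂ determined
            where
              determined : TB (λ _ → ⊤) (edges (chr Code) l)
              determined S x x' _ s s' p p' with fv-inhabited {t'} {Y'} v m
              ... | y , le , my = tb (ins S y) x x' (nonempty⁻ (ins-here S y)) (side x s p) (side x' s' p') (top x p) (top x' p')
                where
                  top : ∀ x → ins S x ∈ edges (chr Code) l → ins (ins S y) x ∈ H q l
                  top x p = subst (_∈ H q l) (ins-comm S x y) (proj₂ (proj₂ (proj₂ (code⁻ {l} p))) y my le)
                  x<y : ∀ x → ins S x ∈ edges (chr Code) l → x < y
                  x<y x p = <-≤-trans (proj₁ (proj₂ (proj₂ (code⁻ {l} p))) x (ins-here S x)) le
                  side : ∀ x → Side S x → ins S x ∈ edges (chr Code) l → Side (ins S y) x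
                  side x (out , _) p = not-true fresh , inj₂ (y , ins-here S y , x<y x p)
                    where
                      fresh : ¬ x ∈ bit (ins S y)
                      fresh m' with ins⁻ {S} {y} {x} m'
                      ... | inj₁ refl = <-irrefl refl (x<y x p)
                      ... | inj₂ m'' = true≢false m'' out
          good : ∀ E → (∀ x → x ∈ bit E → x < m) → (∀ l → l < suc (k q) → Ind (edges (chr Code) l) E) →
            ∀ y → y ∈ Y' → m ≤ y → ∀ l → l < k q → ∀ w → w ⊆ₑ E → ¬ ins w y ∈ H q l
          good E small ind y my le l lt w sub hm with w ≟ 0
          ... | yes refl = sing q y (Y'⊆ y my) l lt hm
          ... | no ne = decided (dec (pr l w) (s≤s (pr-mono (<⇒≤ lt) (bit-mono w full λ x p → trans (mk-bit _ m x (small x (sub x p))) refl))))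
            where
              D⁻ : ∀ {y} → y ∈ D (pr l w) → ins w y ∈ H q l
              D⁻ {y} p = subst₂ (λ a b → ins a y ∈ H q b) (right-pr l w) (left-pr l w) (chr⁻ {λ y → ins (right (pr l w)) y ∈ H q (left (pr l w))} p)
              decided : ((∀ y → y ∈ Y' → y ∈ D (pr l w)) ⊎ (∀ y → y ∈ Y' → ¬ y ∈ D (pr l w))) → ⊥
              decided (inj₁ all) = true≢false (chr⁺ {Code} (l , w , refl , ne , lt , (λ x p → small x (sub x p)) , λ y m' _ → D⁻ (all y m')))
                                              (ind l (m<n⇒m<1+n lt) w ne sub)
              decided (inj₂ n) = n y my (chr⁺ {λ y → ins (right (pr l w)) y ∈ H q (left (pr l w))}
                (subst₂ (λ a b → ins a y ∈ H q b) (sym (right-pr l w)) (sym (left-pr l w)) hm))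

  -- A finite oracle answers only below `m`, and the query about the singleton of `x` is a number
  -- above `x`; hence independence confines `E` to numbers below `m`. The `suc` ensures that there
  -- is a hypergraph to be queried.
  finite-ind : ∀ M m K E → IndO (fin M m) (suc K) E → (∀ x → x ∈ bit E → x < m) × (∀ l → l < suc K → Ind (edges M l) E)
  finite-ind M m K E ind = small , λ l lt e ne sub → proj₂ (fin⁻ {M} {m} (ind l lt e ne sub))
    where
      small : ∀ x → x ∈ bit E → x < m
      small x p = ≤-<-trans (≤-trans (<⇒≤ (bit< _ x (ins-here 0 x))) (≤-trans (y≤pr 0 _) (y≤pr 1 _)))
        (proj₁ (fin⁻ {M} {m} (ind 0 (s≤s z≤n) (ins 0 x) (nonempty⁻ (ins-here 0 x)) λ z m' → single z (ins⁻ m'))))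
        where
          single : ∀ z → z ≡ x ⊎ z ∈ bit 0 → z ∈ bit E
          single z (inj₁ refl) = p
          single z (inj₂ m') = ∅-empty m'

  -- Keeping promises

  -- All rainbows `T` that the constraint still allows are covered, not only `F q`, so that the
  -- promises at `n` are inherited by every extension.
  Prm : Cond → ℕ → ℕ → Set
  Prm q r n = ∀ E T a → E ∈ Con q → T ≡ uni (F q) E → Rb T → idx r n T a ∈ 𝓤 (t q)

  Neg Met : Cond → ℕ → ℕ → ℕ → Set
  Neg q r n a = ∀ E → E ∈ Con q → Rb (uni (F q) E) → ¬ Vio r n a (uni (F q) E)
  Met q r n a = Σ ℕ λ b → ∀ E → E ∈ Con q → ¬ instance₂ (bit (uni (F q) E)) r n a b

  -- If no admissible E met the promise, Y itself would be small.

  module Meeting (q : Cond) (r n a : ℕ) (promise : idx r n (F q) a ∈ 𝓤 (t q)) where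

    private
      i₀ = idx r n (F q) a
      K = suc (k q)
      S = s (t q)
      𝒰 = 𝓤 (t q)

    restrict : ℕ → SetN
    restrict l = chr (λ e → e ∈ H q l × bit e ⊆ Y q)

    -- On subsets of `Y q` there are no singleton edges by `sing`, so weak thinness becomes the
    -- thinness that a witness of smallness needs.
    restrict-thin : ∀ l → l < k q → Thin (restrict l)
    restrict-thin l lt = go (weak q l lt)
      where
        orig : ∀ {e} → e ∈ restrict l → e ∈ H q l × bit e ⊆ Y q
        orig m = chr⁻ {λ e → e ∈ H q l × bit e ⊆ Y q} m
        nz : ∀ S y → ins S y ∈ restrict l → S ≢ 0
        nz _ y m refl = sing q y (proj₂ (orig m) y (ins-here 0 y)) l lt (proj₁ (orig m))
        go : WThin (H q l) → Thin (restrict l)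
        go (inj₁ ta) = inj₁ λ S y y' _ a a' p p' → ta S y y' (nz S y p) a a' (proj₁ (orig p)) (proj₁ (orig p'))
        go (inj₂ tb) = inj₂ λ S y y' _ a a' p p' → tb S y y' (nz S y p) a a' (proj₁ (orig p)) (proj₁ (orig p'))

    Goal : PO → Set
    Goal O = Meets 𝒰 (Con q) (F q) K r S i₀ O

    valid : ∀ M → Goal (tot M)
    valid M = or-else λ nv → dne λ none →
      fv q (t q) (⊒-refl {t q}) (small-one {𝒰} i₀ (k q + K) (cat (k q) restrict (edges M)) promise
        (cat-all Thin (k q) K restrict (edges M) restrict-thin (¬ViolThin M K nv))
        λ E sub ind u → none (E
          , con⇐ q E (λ l lt e ne e⊆ → not-true λ hm → true≢false
              (chr⁺ {λ e → e ∈ H q l × bit e ⊆ Y q} (hm , λ x p → sub x (e⊆ x p)))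
              (cat-allˡ (λ h → Ind h E) (k q) K restrict (edges M) ind l lt e ne e⊆))
          , (λ l lt e ne e⊆ → cong just (cat-allʳ (λ h → Ind h E) (k q) K restrict (edges M) ind l lt e ne e⊆))
          , U⇒U< (bound (t q) i₀ promise) u))

    Extended : Set
    Extended = Σ Cond λ q' → Ext q' q × Met q' r n a

    extend : ∀ m (at : Atoms q m) → (Σ ℕ λ E → E ∈ Con q × IndO (fin (Atoms.M at) m) K E × U< S i₀ E) → Extended
    extend m at (E , E∈ , ind , (r' , n' , T , a' , T' , e , refl , rb' , _ , b , v)) with idx-inj e
    ... | refl , refl , refl , refl = grown , grown-ext , b , met
      where
        open Atoms at
        θ = fm r
        ρ = ext b (ext a (ext n ρ₀))
        w = proj₁ (use θ ρ)
        -- Later elements must lie above `m` for `good`, and above the use `w` in order not to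
        -- disturb the refutation at `b`.
        u = m ⊔ w
        E< = proj₁ (finite-ind M m (k q) E ind)
        E<u : ∀ x → x ∈ bit E → x < u
        E<u x p = <-≤-trans (E< x p) (m≤m⊔n m w)
        clear : ∀ y → y ∈ Y' → u ≤ y → ∀ l → l < k q → ∀ w → w ⊆ₑ E → ¬ ins w y ∈ H q l
        clear y my le = good E E< (proj₂ (finite-ind M m (k q) E ind)) y my (≤-trans (m≤m⊔n m w) le)
        trivial : Enumerable (P t') all-true
        trivial = mapD (λ _ ρ → (λ _ → refl) , (λ _ → tt)) (constD ⊤)
        no-weak : ∀ l → l < 0 → WThin all-true
        no-weak l ()
        no-ind : ∀ E → E ∈ all-true → ∀ l → l < 0 → Ind all-true E
        no-ind E _ l ()
        all-con : ∀ E → (∀ l → l < 0 → Ind all-true E) → E ∈ all-true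
        all-con E _ = refl
        no-unary : ∀ y → y ∈ Y' → u ≤ y → ∀ l → l < 0 → ¬ ins 0 y ∈ all-true
        no-unary y _ _ l ()
        constant : ℕ → SetN
        constant _ = all-true
        open Grow q t' above E u E∈ E<u rb' Y' fv' clear all-true trivial 0 constant no-weak no-ind all-con no-unary
        met : ∀ E' → E' ∈ Con' → ¬ instance₂ (bit (uni (uni (F q) E) E')) r n a b
        met E' m' p = v (proj₂ (use θ ρ) (bit (uni (uni (F q) E) E')) (bit (uni (F q) E)) agree p)
          where
            agree : ∀ x → x < w → bit (uni (uni (F q) E) E') x ≡ bit (uni (F q) E) x
            agree x lt = bool-ext (λ p → old (uni⁻ {uni (F q) E} p)) (λ p → uniˡ {uni (F q) E} p)
              where
                old : x ∈ bit (uni (F q) E) ⊎ x ∈ bit E' → x ∈ bit (uni (F q) E)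
                old (inj₁ p) = p
                old (inj₂ p) = ⊥-elim (<⇒≱ lt (≤-trans (m≤n⊔m m w) (proj₁ (grown-con E' m') x p)))

    private
      φ = meetsD 𝒰 (Con q) (F q) K r {P (t q)} (𝓤D (t q)) (ConD q) S 0

    opaque
      meet : Extended
      -- Compactness is applied to all conceivable `M` first: its `m` must be known before the
      -- decisions on `Y` that produce the actual `M`.
      meet = finish (konig (proj₁ φ) (P (t q)) (λ _ → i₀) (λ X → proj₁ (proj₂ φ (tot X , tt) (λ _ → i₀)) (valid X)))
        where
          finish : (Σ ℕ λ m → ∀ X → ⟦ proj₁ φ ⟧ (fin X m ∷ˢ P (t q)) (λ _ → i₀)) → Extended
          finish (m , h) = use-atoms (atoms q m)
            where
              use-atoms : Atoms q m → Extended
              use-atoms at = cases (proj₂ (proj₂ φ (fin M m , tt) (λ _ → i₀)) (h M))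
                where
                  open Atoms at
                  cases : Goal (fin M m) → Extended
                  cases (inj₁ vt) = ⊥-elim (Thin⇒¬ViolThin M K thin (ViolThin-mono {fin M m} {tot M} {K} (fin⊑tot M m) vt))
                  cases (inj₂ x) = extend m at x

  open Meeting public using (meet)

  -- Keeping one set from becoming Σ₂

  module Requiring (q : Cond) (β : Req) (nσ : ¬ Sigma2 Z (target β)) (r : ℕ) where

    private
      K S : ℕ
      K = suc (k q)
      -- Room for the requirements already promised and for `r` itself.
      S = s (t q) ⊔ suc r
      𝒰 : SetN
      𝒰 = 𝓤 (t q)
      P₀ : Stack
      P₀ = P (t q)

    Quest : PO → ℕ → Set
    Quest O n = Question 𝒰 (Con q) (F q) K r S O n

    private
      φ : Def true {PO × ⊤} (λ Oi → proj₁ Oi ∷ˢ P₀) (λ Oi ρ → Quest (proj₁ Oi) (ρ 0))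
      φ = questionD 𝒰 (Con q) (F q) K r {P₀} (𝓤D (t q)) (ConD q) S 0

    W : ℕ → Set
    W n = ∀ M → Quest (tot M) n

    W-def : Def true {⊤} (λ _ → P₀) (λ _ ρ → W (ρ 0))
    W-def = fanD {I = ⊤} {Ps = λ _ → P₀} {A = λ Oi ρ → Quest (proj₁ Oi) (ρ 0)} φ

    Promised Refuted Outcome : ℕ → Set
    Promised n = Σ Cond λ q' → Ext q' q × Prm q' r n
    Refuted n = Σ Cond λ q' → Ext q' q × Σ ℕ λ a → Neg q' r n a
    Outcome n = (n ∈ target β × Promised n) ⊎ (¬ n ∈ target β × Refuted n)

    -- The answer is negative: some M keeps all new indices large, and they can be promised.
    module No (n : ℕ) (M : SetN) (negative : ¬ Quest (tot M) n) (nice' : Nice (tot M ∷ˢ P₀)) where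

      NewM : ℕ → Set
      NewM i = New 𝒰 (Con q) (F q) K r (tot M) n i

      𝒰' : SetN
      𝒰' = chr (λ i → i ∈ 𝒰 ⊎ NewM i)

      thinM : ∀ l → l < K → Thin (edges M l)
      thinM = ¬ViolThin M K (λ v → negative (inj₁ v))

      -- If the enlarged promises made everything small, coding the witness would give a positive
      -- answer for `M`.
      proper' : ¬ Small 𝒰' all-true
      proper' sm = let (L , k' , sub , fails) = small⇒fails {𝒰'} S sm
        in negative (inj₂ (L , k' , (λ ε m → let (j , i , e , mi) = sub ε m in j , i , e , chr⁻ mi) , fails))

      lift₀ : ∀ {A : Env → Set} → Def true {⊤} (λ _ → P₀) (λ _ → A) → Def true {⊤} (λ _ → tot M ∷ˢ P₀) (λ _ → A)
      lift₀ d = reD (λ _ → tt) suc (λ _ k x → refl) d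

      𝒰'D : Enumerable (tot M ∷ˢ P₀) 𝒰'
      𝒰'D = mapD (λ _ ρ → chr⁺ , chr⁻) (orD (lift₀ (𝓤D (t q)))
        (subD (pair (lit n) (var 0)) (reD {Qs = λ _ → tot M ∷ˢ P₀} (λ _ → tot M , tt) (λ k → k) (λ _ k x → refl)
          (newD 𝒰 (Con q) (F q) K r {P₀} (𝓤D (t q)) (ConD q) 0 1))))

      bound' : ∀ i → i ∈ 𝒰' → Below S i
      bound' i m r' n' T a e with chr⁻ {λ i → i ∈ 𝒰 ⊎ NewM i} m
      ... | inj₁ old = <-≤-trans (bound (t q) i old r' n' T a e) (m≤m⊔n (s (t q)) (suc r))
      ... | inj₂ (T' , a' , E , e' , _) with idx-inj (trans (sym e') e)
      ...   | refl , _ = m≤n⊔m (s (t q)) (suc r)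

      t' : St
      t' = record { P = tot M ∷ˢ P₀ ; nice = nice' ; 𝓤 = 𝒰' ; 𝓤D = 𝒰'D ; s = S ; bound = bound' ; proper = proper'
                  ; base = λ a → chr⁺ (inj₁ (base (t q) a)) }

      above : t' ⊒ t q
      above = (1 , λ k x → refl) , λ i m → chr⁺ (inj₁ m)

      u : ℕ
      u = proj₁ (unary-bounds K (edges M) thinM)

      -- Later elements have to be independent of `M`, since only the sets `T` arising that way have
      -- been promised.
      Con₂ : SetN
      Con₂ = chr (λ E → IndO (tot M) K E)

      Con₂D : Enumerable (P t') Con₂
      Con₂D = mapD (λ _ ρ → chr⁺ , chr⁻) (reD {Qs = λ _ → tot M ∷ˢ P₀} (λ _ → tot M , tt) (λ k → k) (λ _ k x → refl)
        (indD {I = ⊤} {Ps = λ _ → P₀} (lit K) 0))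

      no-element : ∀ x → x ∈ bit 0 → x < u
      no-element x m = ∅-empty m

      rb' : Rb (uni (F q) 0)
      rb' = subst Rb (sym (uni-∅ʳ (F q))) (rb q)

      clear : ∀ y → y ∈ Y q → u ≤ y → ∀ l → l < k q → ∀ w → w ⊆ₑ 0 → ¬ ins w y ∈ H q l
      clear y m _ l lt w sub hm = sing q y m l lt (subst (λ c → ins c y ∈ H q l) (⊆-antisym sub (λ x p → ∅-empty p)) hm)

      weak₂ : ∀ l → l < K → WThin (edges M l)
      weak₂ l lt = thin⇒wthin {edges M l} (thinM l lt)

      con₂⇒ : ∀ E → E ∈ Con₂ → ∀ l → l < K → Ind (edges M l) E
      con₂⇒ E m l lt e ne sub = just-injective (chr⁻ {λ E → IndO (tot M) K E} m l lt e ne sub)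

      con₂⇐ : ∀ E → (∀ l → l < K → Ind (edges M l) E) → E ∈ Con₂
      con₂⇐ E ind = chr⁺ (λ l lt e ne sub → cong just (ind l lt e ne sub))

      clear₂ : ∀ y → y ∈ Y q → u ≤ y → ∀ l → l < K → ¬ ins 0 y ∈ edges M l
      clear₂ y _ = proj₂ (unary-bounds K (edges M) thinM) y

      fv' : Fv t' (Y q)
      fv' = fv-ext {t q} {t'} {Y q} above (fv q)

      open Grow q t' above 0 u (∅∈Con q) no-element rb' (Y q) fv' clear Con₂ Con₂D K (edges M) weak₂ con₂⇒ con₂⇐ clear₂

      promised : Promised n
      promised = grown , grown-ext , λ E T a m e rbT → let (_ , c , c₂) = grown-con E m
        in chr⁺ (inj₂ (T , a , E , refl , trans e (cong (λ w → uni w E) (uni-∅ʳ (F q))) , rbT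
                      , subst (_∈ Con q) (uni-∅ E) c , chr⁻ {λ E → IndO (tot M) K E} c₂))

    -- The answer is positive: the actual behaviour M of the edges on Y gives a cover by sets
    -- avoiding U; its piece that stays positive is not attached to an old index.
    module Yes (n m : ℕ) (at : Atoms q m) (L k' : ℕ)
      (sub : ∀ ε → ε ∈ bit L → Σ ℕ λ j → Σ ℕ λ i → ε ≡ pr j i × (i ∈ 𝒰 ⊎ New 𝒰 (Con q) (F q) K r (fin (Atoms.M at) m) n i))
      (X : SetN) (nc : ¬ Covered S (tot X) L k') (niceX : Nice (tot X ∷ˢ P (Atoms.t' at))) where

      open Atoms at renaming (t' to t₁; above to above₁; Y' to Y₁; fv' to fv₁)

      -- `X` joins the stack because the constraint added below, to stay in one piece and
      -- independent of the hypergraphs of `X`, has to be definable.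
      t₂ : St
      t₂ = record { P = tot X ∷ˢ P t₁ ; nice = niceX ; 𝓤 = 𝓤 t₁
                  ; 𝓤D = reD (λ _ → tt) suc (λ _ k x → refl) (𝓤D t₁) ; s = s t₁ ; bound = bound t₁ ; proper = proper t₁ ; base = base t₁ }

      above₂ : t₂ ⊒ t₁
      above₂ = (1 , λ k x → refl) , λ i m → m

      V : ℕ → SetN
      V ε y = X (pr 0 (pr ε y))

      piece : ℕ → SetN
      piece ε = chr (λ y → ε ∈ bit L × y ∈ V ε)

      thinX : ∀ l → l < k' → Thin (edges X l)
      thinX = ¬ViolThin X k' (λ v → nc (inj₁ v))

      cover : ∀ y → Σ ℕ λ ε → ε < L × y ∈ piece ε
      cover y = dne λ none → nc (inj₂ (inj₁ (y , λ ε m → cong just (not-true λ p → none (ε , bit< L ε m , chr⁺ (m , p))))))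

      avoid : ∀ ε j i → ε ∈ bit L → ε ≡ pr j i → ∀ E → bit E ⊆ V ε → (∀ l → l < k' → Ind (edges X l) E) → ¬ U< S i E
      avoid ε j i m e E sub ind u = nc (inj₂ (inj₂ (ε , E , j , i , m , e , (λ y p → cong just (sub y p))
        , (λ l lt d ne d⊆ → cong just (ind l lt d ne d⊆)) , u)))

      module Piece (t₃ : St) (above₃ : t₃ ⊒ t₂) (ε j i : ℕ) (ε∈ : ε ∈ bit L) (ε≡ : ε ≡ pr j i) (fv₃ : Fv t₃ (Y₁ ∩ V ε)) where

        above : t₃ ⊒ t q
        above = ⊒-trans {t q} {t₁} {t₃} (⊒-trans {t₁} {t₂} {t₃} above₃ above₂) above₁

        -- For an old promise `i`, the set `X` would witness that the piece is small, although the
        -- piece stays large.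
        not-old : ¬ i ∈ 𝒰
        not-old old = fv₃ t₃ (⊒-refl {t₃}) (small-one {𝓤 t₃} i k' (edges X) (proj₂ above i old) thinX
          λ E sub ind u → avoid ε j i ε∈ ε≡ E (λ y p → ∩ʳ y (sub y p)) ind
            (U⇒U< (λ r' n' T a e → <-≤-trans (bound (t q) i old r' n' T a e) (m≤m⊔n (s (t q)) (suc r))) u))

        module Fresh (T a E : ℕ) (i≡ : i ≡ idx r n T a) (T≡ : T ≡ uni (F q) E) (rbT : Rb T) (E∈ : E ∈ Con q)
          (ind : IndO (fin M m) K E) where

          E< : ∀ x → x ∈ bit E → x < m
          E< = proj₁ (finite-ind M m (k q) E ind)

          u₂ u : ℕ
          u₂ = proj₁ (unary-bounds k' (edges X) thinX)
          u = m ⊔ u₂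

          E<u : ∀ x → x ∈ bit E → x < u
          E<u x p = <-≤-trans (E< x p) (m≤m⊔n m u₂)

          rb' : Rb (uni (F q) E)
          rb' = subst Rb T≡ rbT

          clear : ∀ y → y ∈ Y₁ ∩ V ε → u ≤ y → ∀ l → l < k q → ∀ w → w ⊆ₑ E → ¬ ins w y ∈ H q l
          clear y my le = good E E< (proj₂ (finite-ind M m (k q) E ind)) y (∩ˡ y my) (≤-trans (m≤m⊔n m u₂) le)

          Spec : ℕ → Set
          Spec E' = (∀ y → y ∈ bit E' → cov (tot X) ε y true) × IndO (tot X) k' E'

          Con₂ : SetN
          Con₂ = chr Spec

          Con₂D : Enumerable (P t₃) Con₂
          Con₂D = liftSt {t₂} {t₃} above₃ (mapD (λ _ ρ → chr⁺ , chr⁻) (andD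
              (mapD (λ _ ρ → (λ { (_ , refl , h) → h }) , (λ h → ε , refl , h))
                (exD (andD (eqD (var 0) (lit ε)) (allInD 1 (at-X (covD {I = ⊤} {Ps = λ _ → P t₁} true 1 0))))))
              (at-X (indD {I = ⊤} {Ps = λ _ → P t₁} (lit k') 0))))
            where
              at-X : ∀ {A : PO × ⊤ → Env → Set} → Def true (λ Oi → proj₁ Oi ∷ˢ P t₁) A → Def true {⊤} (λ _ → tot X ∷ˢ P t₁) (λ _ ρ → A (tot X , tt) ρ)
              at-X d = reD (λ _ → tot X , tt) (λ k → k) (λ _ k x → refl) d

          -- Confinement to `V ε` as independence: each point outside becomes a singleton edge,
          -- which `WThin` tolerates.
          Outside : ℕ → Set
          Outside d = Σ ℕ λ y → d ≡ ins 0 y × ¬ y ∈ V ε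

          outside : ℕ → SetN
          outside _ = chr Outside

          G : ℕ → SetN
          G = cat 1 outside (edges X)

          weakG : ∀ l → l < 1 + k' → WThin (G l)
          weakG = cat-all WThin 1 k' outside (edges X)
            (λ _ _ → unary-weak λ d p → let (y , e , _) = chr⁻ {Outside} p in y , e)
            (λ l lt → thin⇒wthin {edges X l} (thinX l lt))

          con₂⇒ : ∀ E' → E' ∈ Con₂ → ∀ l → l < 1 + k' → Ind (G l) E'
          con₂⇒ E' p = cat-all (λ h → Ind h E') 1 k' outside (edges X)
              (λ _ _ d ne sub → not-true λ o → inside sub (chr⁻ {Outside} o))
              (λ l lt d ne sub → just-injective (proj₂ spec l lt d ne sub))
            where
              spec : Spec E'
              spec = chr⁻ p
              inside : ∀ {d} → d ⊆ₑ E' → ¬ Outside d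
              inside sub (y , refl , nv) = nv (just-injective (proj₁ spec y (sub y (ins-here 0 y))))

          con₂⇐ : ∀ E' → (∀ l → l < 1 + k' → Ind (G l) E') → E' ∈ Con₂
          con₂⇐ E' h = chr⁺ ((λ y p → cong just (dne λ nv → true≢false (chr⁺ {Outside} (y , refl , nv))
                (h 0 (s≤s z≤n) (ins 0 y) (nonempty⁻ (ins-here 0 y)) λ z m' → single y p z (ins⁻ m'))))
              , λ l lt d ne sub → cong just (cat-allʳ (λ h → Ind h E') 1 k' outside (edges X) h l lt d ne sub))
            where
              single : ∀ y → y ∈ bit E' → ∀ z → z ≡ y ⊎ z ∈ bit 0 → z ∈ bit E'
              single y p z (inj₁ refl) = p
              single y p z (inj₂ m') = ∅-empty m'

          clear₂ : ∀ y → y ∈ Y₁ ∩ V ε → u ≤ y → ∀ l → l < 1 + k' → ¬ ins 0 y ∈ G l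
          clear₂ y my le = cat-all (λ h → ¬ ins 0 y ∈ h) 1 k' outside (edges X)
              (λ _ _ o → hit (chr⁻ {Outside} o))
              (proj₂ (unary-bounds k' (edges X) thinX) y (≤-trans (m≤n⊔m m u₂) le))
            where
              hit : ¬ Outside (ins 0 y)
              hit (y' , e , nv) with ins⁻ {0} {y'} {y} (subst (λ c → y ∈ bit c) e (ins-here 0 y))
              ... | inj₁ refl = nv (∩ʳ {Y₁} {V ε} y my)
              ... | inj₂ z = ∅-empty z

          open Grow q t₃ above E u E∈ E<u rb' (Y₁ ∩ V ε) fv₃ clear Con₂ Con₂D (1 + k') G weakG con₂⇒ con₂⇐ clear₂

          refuted : Refuted n
          refuted = grown , grown-ext , a , neg
            where
              -- A violation by `E'` would fulfil the promise `i` inside its piece, against `avoid`.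
              neg : Neg grown r n a
              neg E' m' rbE v = avoid ε j i ε∈ ε≡ E' (λ y p → just-injective (proj₁ spec y p))
                  (λ l lt d ne sub → just-injective (proj₂ spec l lt d ne sub))
                  (r , n , T , a , uni T E' , i≡ , refl , subst (λ w → Rb (uni w E')) (sym T≡) rbE
                  , m≤n⊔m (s (t q)) (suc r) , subst (λ w → Vio r n a (uni w E')) (sym T≡) v)
                where
                  spec : Spec E'
                  spec = chr⁻ (proj₂ (proj₂ (grown-con E' m')))

        refuted : (i ∈ 𝒰 ⊎ New 𝒰 (Con q) (F q) K r (fin M m) n i) → Refuted n
        refuted (inj₁ old) = ⊥-elim (not-old old)
        refuted (inj₂ (T , a , E , i≡ , T≡ , rbT , E∈ , ind)) = Fresh.refuted T a E i≡ T≡ rbT E∈ ind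

      refuted : Refuted n
      refuted = go (split-cover L piece {t₂} {Y₁} (λ y _ → cover y) (fv-ext {t₁} {t₂} {Y₁} above₂ fv₁))
        where
          go : (Σ St λ t₃ → t₃ ⊒ t₂ × Σ ℕ λ ε → ε < L × Fv t₃ (Y₁ ∩ piece ε)) → Refuted n
          go (t₃ , e₃ , ε , lt , v) = let (j , i , e , c) = sub ε ε∈ in Piece.refuted t₃ e₃ ε j i ε∈ e v' c
            where
              ε∈ : ε ∈ bit L
              ε∈ = proj₁ (chr⁻ {λ y → ε ∈ bit L × y ∈ V ε} (∩ʳ {Y₁} _ (proj₂ (proj₂ (fv-inhabited {t₃} v 0)))))
              v' : Fv t₃ (Y₁ ∩ V ε)
              v' = fv-mono {t₃} (λ y p → chr⁺ (∩ˡ {Y₁} {piece ε} y p , proj₂ (chr⁻ {λ y → ε ∈ bit L × y ∈ V ε} (∩ʳ {Y₁} {piece ε} y p)))) v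

    private
      at-n : ℕ → Env
      at-n n = ext n ρ₀

    opaque
      no-case : ∀ n → ¬ W n → Promised n
      no-case n nw = go (basis P₀ (nice (t q)) (proj₁ φ) (at-n n)
          λ all → nw λ M → proj₂ (proj₂ φ (tot M , tt) (at-n n)) (all M))
        where
          go : (Σ SetN λ M → ¬ ⟦ proj₁ φ ⟧ (tot M ∷ˢ P₀) (at-n n) × Nice (tot M ∷ˢ P₀)) → Promised n
          go (M , neg , nice') = No.promised n M (λ h → neg (proj₁ (proj₂ φ (tot M , tt) (at-n n)) h)) nice'

      yes-case : ∀ n → W n → Refuted n
      yes-case n w = go (konig (proj₁ φ) P₀ (at-n n) (λ X → proj₁ (proj₂ φ (tot X , tt) (at-n n)) (w X)))
        where
          go : (Σ ℕ λ m → ∀ X → ⟦ proj₁ φ ⟧ (fin X m ∷ˢ P₀) (at-n n)) → Refuted n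
          go (m , h) = use-atoms (atoms q m)
            where
              use-atoms : Atoms q m → Refuted n
              use-atoms at = cases (proj₂ (proj₂ φ (fin M m , tt) (at-n n)) (h M))
                where
                  open Atoms at
                  cases : Quest (fin M m) n → Refuted n
                  cases (inj₁ vt) = ⊥-elim (Thin⇒¬ViolThin M K thin (ViolThin-mono {fin M m} {tot M} {K} (fin⊑tot M m) vt))
                  -- `fails` yields some witness only; the basis theorem, over the stack reached by
                  -- `atoms`, yields a nice one.
                  cases (inj₂ (L , k' , sub , fails)) = thinning (basis (P t') (nice t') (proj₁ ψ) ρ
                      λ all → fails λ X → proj₂ (proj₂ ψ (tot X , tt) ρ) (all X))
                    where
                      ρ : Env
                      ρ = ext L (ext k' ρ₀)
                      ψ : Def true {PO × ⊤} (λ Oi → proj₁ Oi ∷ˢ P t') (λ Oi ρ → Covered S (proj₁ Oi) (ρ 0) (ρ 1))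
                      ψ = coveredD {I = ⊤} {Ps = λ _ → P t'} S 0 1
                      thinning : (Σ SetN λ X → ¬ ⟦ proj₁ ψ ⟧ (tot X ∷ˢ P t') ρ × Nice (tot X ∷ˢ P t')) → Refuted n
                      thinning (X , nc , niceX) = Yes.refuted n m at L k' sub X (λ c → nc (proj₁ (proj₂ ψ (tot X , tt) ρ) c)) niceX

      require : Σ ℕ Outcome
      require = go (nice-diff {P₀} (nice (t q)) β nσ {W} tt (λ _ _ → refl) W-def ρ₀ (λ n → (λ w → w) , (λ w → w)))
        where
          go : (Σ ℕ λ n → (n ∈ target β × ¬ W n) ⊎ (¬ n ∈ target β × W n)) → Σ ℕ Outcome
          go (n , inj₁ (b , nw)) = n , inj₁ (b , no-case n nw)
          go (n , inj₂ (nb , w)) = n , inj₂ (nb , yes-case n w)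

-- The limit of the coloring

module Generic (em : ExcludedMiddle 0ℓ) (Z : SetN) (f : Coloring3) (f-comp : ComputableIn Z f) (f-two : TwoBounded f) where

  open Classical em
  open Definability em Z
  open Forcing em Z f f-comp

  Matched : ℕ → ℕ → Set
  Matched c z = Σ ℕ λ x → Σ ℕ λ y → Σ ℕ λ x' → Σ ℕ λ y' → c ≡ pr (pr x y) (pr x' y') ×
    ((x < y × y < z) × (x' < y' × y' < z)) × f x y z ≡ f x' y' z

  Realizes : (ℕ → Bool) → ℕ → ℕ → Set
  Realizes X m z = ∀ c → c < m → (X c ≡ true × Matched c z) ⊎ (X c ≡ false × ¬ Matched c z)

  Unbounded : (ℕ → Set) → Set
  Unbounded A = ∀ n → Σ ℕ λ m → n ≤ m × A m

  unbounded-split : ∀ {A : ℕ → Set} (D : ℕ → Set) → Unbounded A →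
    Unbounded (λ z → A z × D z) ⊎ Unbounded (λ z → A z × ¬ D z)
  unbounded-split {A} D inf = or-else λ n₁ → ¬∃⇒∀ λ { (b , none) → small-tail (¬∀⇒∃¬ n₁) b none }
    where
      small-tail : (Σ ℕ λ n → ¬ Σ ℕ λ m → n ≤ m × A m × D m) → ∀ b → ¬ (¬ Σ ℕ λ m → b ≤ m × A m × ¬ D m)
      small-tail (a , none₁) b none with inf (a ⊔ b)
      ... | z , le , az with em {D z}
      ...   | yes d = none₁ (z , ≤-trans (m≤m⊔n a b) le , az , d)
      ...   | no nd = none (z , ≤-trans (m≤n⊔m a b) le , az , nd)

  -- Truth values for the matchings are chosen one by one so that infinitely many z realize them.
  Chosen : SetN → ℕ → Set
  Chosen X m = Unbounded (Realizes X m)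

  choose-next : ∀ X m → Chosen X m → Σ Bool λ b → Chosen (upd X m b) (suc m)
  choose-next X m inf with unbounded-split (Matched m) inf
  ... | inj₁ h = true , λ n → let (z , le , rz , d) = h n in z , le , step z rz d
    where
      step : ∀ z → Realizes X m z → Matched m z → Realizes (upd X m true) (suc m) z
      step z rz d c lt with m<1+n⇒m<n∨m≡n lt
      ... | inj₂ refl = inj₁ (upd-here X m true , d)
      ... | inj₁ lt' with rz c lt'
      ...   | inj₁ (e , p) = inj₁ (trans (upd-there lt') e , p)
      ...   | inj₂ (e , p) = inj₂ (trans (upd-there lt') e , p)
  ... | inj₂ h = false , λ n → let (z , le , rz , d) = h n in z , le , step z rz d
    where
      step : ∀ z → Realizes X m z → ¬ Matched m z → Realizes (upd X m false) (suc m) z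
      step z rz d c lt with m<1+n⇒m<n∨m≡n lt
      ... | inj₂ refl = inj₂ (upd-here X m false , d)
      ... | inj₁ lt' with rz c lt'
      ...   | inj₁ (e , p) = inj₁ (trans (upd-there lt') e , p)
      ...   | inj₂ (e , p) = inj₂ (trans (upd-there lt') e , p)

  realizes-cong : ∀ {X Y m z} → (∀ c → c < m → X c ≡ Y c) → Realizes X m z → Realizes Y m z
  realizes-cong h rz c lt with rz c lt
  ... | inj₁ (e , p) = inj₁ (trans (sym (h c lt)) e , p)
  ... | inj₂ (e , p) = inj₂ (trans (sym (h c lt)) e , p)

  realizes-mono : ∀ {X m m' z} → m ≤ m' → Realizes X m' z → Realizes X m z
  realizes-mono le rz c lt = rz c (<-≤-trans lt le)

  chosen : Σ SetN λ X → ∀ m → Chosen X m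
  chosen = V , λ m n → let (z , le , rz) = proj₂ (seq m) n in z , le , realizes-cong (coh m) rz
    where
      seq : ∀ m → Σ SetN λ X → Chosen X m
      seq zero = (λ _ → true) , λ n → n , ≤-refl , λ c ()
      seq (suc m) = upd (proj₁ (seq m)) m (proj₁ (choose-next _ m (proj₂ (seq m)))) , proj₂ (choose-next _ m (proj₂ (seq m)))
      V : SetN
      V c = proj₁ (seq (suc c)) c
      coh : ∀ m c → c < m → proj₁ (seq m) c ≡ V c
      coh (suc m) c lt with m<1+n⇒m<n∨m≡n lt
      ... | inj₁ lt' = trans (upd-there lt') (coh m c lt')
      ... | inj₂ refl = refl

  module _ {l : Bool} {I : Set} {Ps : I → Stack} where

    pairsD : ∀ c x y x' y' → Def l Ps (λ _ ρ → ρ c ≡ pr (pr (ρ x) (ρ y)) (pr (ρ x') (ρ y')))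
    pairsD c x y x' y' = mapD (λ _ ρ → (λ { (_ , _ , refl , refl , e) → e }) , (λ e → _ , _ , refl , refl , e))
      (exD (exD (andD (prD (var 1) (var (2 + x)) (var (2 + y))) (andD (prD (var 0) (var (2 + x')) (var (2 + y')))
        (prD (var (2 + c)) (var 1) (var 0))))))

    matchedD : ∀ c z → Def l Ps (λ _ ρ → Matched (ρ c) (ρ z))
    matchedD c z = exD (exD (exD (exD (andD (pairsD (4 + c) 3 2 1 0) (feqD 3 2 (4 + z) 1 0 (4 + z))))))

    npairsD : ∀ c x y x' y' → Def l Ps (λ _ ρ → ¬ ρ c ≡ pr (pr (ρ x) (ρ y)) (pr (ρ x') (ρ y')))
    npairsD c x y x' y' = mapD (λ _ ρ → (λ { (d , e , ne) q → ne (trans q (sym e)) }) , (λ ne → _ , refl , λ q → ne q))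
      (exD (andD (pairsD 0 (suc x) (suc y) (suc x') (suc y')) (neD (var (suc c)) (var 0))))

    nmatchedD : ∀ c z → Def l Ps (λ _ ρ → ¬ Matched (ρ c) (ρ z))
    nmatchedD c z = mapD (λ _ ρ → fwd (ρ c) (ρ z) , bwd (ρ c) (ρ z))
        (alD (plus (lit 1) (var c)) (alD (plus (lit 1) (var (1 + c))) (alD (plus (lit 1) (var (2 + c))) (alD (plus (lit 1) (var (3 + c)))
          (orD (npairsD (4 + c) 3 2 1 0) (orD (orD (nincD 3 2 (4 + z)) (nincD 1 0 (4 + z))) (fneD 3 2 (4 + z) 1 0 (4 + z))))))))
      where
        Unlike : ℕ → ℕ → ℕ → ℕ → ℕ → ℕ → Set
        Unlike c z x y x' y' = (¬ c ≡ pr (pr x y) (pr x' y')) ⊎ ((((¬ x < y) ⊎ (¬ y < z)) ⊎ ((¬ x' < y') ⊎ (¬ y' < z))) ⊎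
          (((x < y × y < z) × (x' < y' × y' < z)) × (¬ f x y z ≡ f x' y' z)))
        All : ℕ → ℕ → Set
        All c z = ∀ x → x < suc c → ∀ y → y < suc c → ∀ x' → x' < suc c → ∀ y' → y' < suc c → Unlike c z x y x' y'
        refute : ∀ {c z x y x' y'} → c ≡ pr (pr x y) (pr x' y') → (x < y × y < z) × (x' < y' × y' < z) → f x y z ≡ f x' y' z →
          ¬ Unlike c z x y x' y'
        refute e o eq (inj₁ n) = n e
        refute e ((o , _) , _) eq (inj₂ (inj₁ (inj₁ (inj₁ n)))) = n o
        refute e ((_ , o) , _) eq (inj₂ (inj₁ (inj₁ (inj₂ n)))) = n o
        refute e (_ , (o , _)) eq (inj₂ (inj₁ (inj₂ (inj₁ n)))) = n o
        refute e (_ , (_ , o)) eq (inj₂ (inj₁ (inj₂ (inj₂ n)))) = n o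
        refute e o eq (inj₂ (inj₂ (_ , ne))) = ne eq
        fwd : ∀ c z → All c z → ¬ Matched c z
        fwd c z all (x , y , x' , y' , refl , o , eq) = refute refl o eq (all x (s≤s (≤-trans (x≤pr x y) l≤)) y (s≤s (≤-trans (y≤pr x y) l≤))
            x' (s≤s (≤-trans (x≤pr x' y') r≤)) y' (s≤s (≤-trans (y≤pr x' y') r≤)))
          where
            l≤ = x≤pr (pr x y) (pr x' y')
            r≤ = y≤pr (pr x y) (pr x' y')
        bwd : ∀ c z → ¬ Matched c z → All c z
        bwd c z nm x _ y _ x' _ y' _ with c ≟ pr (pr x y) (pr x' y') | x <? y | y <? z | x' <? y' | y' <? z
        ... | no n | _ | _ | _ | _ = inj₁ n
        ... | yes _ | no n | _ | _ | _ = inj₂ (inj₁ (inj₁ (inj₁ n)))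
        ... | yes _ | yes _ | no n | _ | _ = inj₂ (inj₁ (inj₁ (inj₂ n)))
        ... | yes _ | yes _ | yes _ | no n | _ = inj₂ (inj₁ (inj₂ (inj₁ n)))
        ... | yes _ | yes _ | yes _ | yes _ | no n = inj₂ (inj₁ (inj₂ (inj₂ n)))
        ... | yes e | yes a | yes b | yes a' | yes b' = inj₂ (inj₂ (((a , b) , (a' , b')) , λ eq → nm (x , y , x' , y' , e , ((a , b) , (a' , b')) , eq)))

    realizesD : ∀ d m z → Def l Ps (λ _ ρ → Realizes (bit (ρ d)) (ρ m) (ρ z))
    realizesD d m z = alD (var m) (orD (andD (memD (1 + d) 0) (matchedD 0 (1 + z))) (andD (nmemD (1 + d) 0) (nmatchedD 0 (1 + z))))

  Unrealized : PO → Set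
  Unrealized O = Σ ℕ λ m → Σ ℕ λ b → Σ ℕ λ d → (∀ c → c < m → (O c ≡ just true × bit d c ≡ true) ⊎ (O c ≡ just false × bit d c ≡ false)) ×
    ¬ (Σ ℕ λ z → ¬ z < b × Realizes (bit d) m z)

  opaque
    unrealizedD : Def true {PO × ⊤} (λ Oi → proj₁ Oi ∷ˢ ∅ˢ) (λ Oi ρ → Unrealized (proj₁ Oi))
    unrealizedD = exD (exD (exD (andD
      (alD (var 2) (orD (andD (opD 0 (var 0)) (memD 1 0)) (andD (onD 0 (var 0)) (nmemD 1 0))))
      (negD (exD (andD (nltD (var 0) (var 2)) (realizesD 1 3 0)))))))

    -- Not to be a limit means that some initial segment is realized by no `z` beyond some `b`, a
    -- Σ₂(Z) event. So the limits form a Π₁ class for the basis theorem, and `chosen` shows that it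
    -- is nonempty.
    limit : Σ SetN λ X → (∀ m → Chosen X m) × Nice (tot X ∷ˢ ∅ˢ)
    limit = go (basis ∅ˢ nice-∅ (proj₁ unrealizedD) ρ₀ λ all → realized (proj₂ (proj₂ unrealizedD (tot X₀ , tt) ρ₀) (all X₀)))
      where
        X₀ : SetN
        X₀ = proj₁ chosen
        agree : ∀ {m d} → (∀ c → c < m → (tot X₀ c ≡ just true × bit d c ≡ true) ⊎ (tot X₀ c ≡ just false × bit d c ≡ false)) →
          ∀ c → c < m → X₀ c ≡ bit d c
        agree h c lt with h c lt
        ... | inj₁ (e , e') = trans (just-injective e) (sym e')
        ... | inj₂ (e , e') = trans (just-injective e) (sym e')
        realized : ¬ Unrealized (tot X₀)
        realized (m , b , d , h , none) = let (z , le , rz) = proj₂ chosen m b in none (z , ≤⇒≯ le , realizes-cong (agree h) rz)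
        go : (Σ SetN λ X → ¬ ⟦ proj₁ unrealizedD ⟧ (tot X ∷ˢ ∅ˢ) ρ₀ × Nice (tot X ∷ˢ ∅ˢ)) → Σ SetN λ X → (∀ m → Chosen X m) × Nice (tot X ∷ˢ ∅ˢ)
        go (X , nu , nice) = X , inf , nice
          where
            inf : ∀ m → Chosen X m
            inf m b = dne λ none → nu (proj₁ (proj₂ unrealizedD (tot X , tt) ρ₀)
                (m , b , mk X m , same , λ { (z , nlt , rz) → none (z , ≮⇒≥ nlt , realizes-cong (mk-bit X m) rz) }))
              where
                same : ∀ c → c < m → (tot X c ≡ just true × bit (mk X m) c ≡ true) ⊎ (tot X c ≡ just false × bit (mk X m) c ≡ false)
                same c lt with bool-cases (X c)
                ... | inj₁ e = inj₁ (cong just e , trans (mk-bit X m c lt) e)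
                ... | inj₂ e = inj₂ (cong just e , trans (mk-bit X m c lt) e)

  -- The hypergraphs of partners

  tri : ℕ → ℕ → ℕ → ℕ
  tri a b c = ins (ins (ins 0 a) b) c

  tri⁻ : ∀ {a b c x} → x ∈ bit (tri a b c) → x ≡ a ⊎ (x ≡ b ⊎ x ≡ c)
  tri⁻ {a} {b} {c} {x} m with ins⁻ {ins (ins 0 a) b} {c} {x} m
  ... | inj₁ e = inj₂ (inj₂ e)
  ... | inj₂ m' with ins⁻ {ins 0 a} {b} {x} m'
  ...   | inj₁ e = inj₂ (inj₁ e)
  ...   | inj₂ m'' with ins⁻ {0} {a} {x} m''
  ...     | inj₁ e = inj₁ e
  ...     | inj₂ z = ∅-empty z

  tri₁ : ∀ a b c → a ∈ bit (tri a b c)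
  tri₁ a b c = ins-there (ins-there (ins-here 0 a))

  tri₂ : ∀ a b c → b ∈ bit (tri a b c)
  tri₂ a b c = ins-there (ins-here (ins 0 a) b)

  tri₃ : ∀ a b c → c ∈ bit (tri a b c)
  tri₃ a b c = ins-here (ins (ins 0 a) b) c

  tri-⊆ : ∀ {a b c e} → a ∈ bit e → b ∈ bit e → c ∈ bit e → tri a b c ⊆ₑ e
  tri-⊆ p q r x m with tri⁻ m
  ... | inj₁ refl = p
  ... | inj₂ (inj₁ refl) = q
  ... | inj₂ (inj₂ refl) = r

  -- (a , b) and (c , y) are matched in the limit.
  Sim : ℕ → ℕ → ℕ → ℕ → Set
  Sim a b c y = pr (pr a b) (pr c y) ∈ proj₁ limit

  pair-code : ℕ → ℕ → ℕ → ℕ → ℕ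
  pair-code a b c y = pr (pr a b) (pr c y)

  sim-at : ∀ m u → Σ ℕ λ z → u ≤ z × Realizes (proj₁ limit) m z
  sim-at m u = proj₁ (proj₂ limit) m u

  matched⁻ : ∀ {a b c y z} → Matched (pair-code a b c y) z → ((a < b × b < z) × (c < y × y < z)) × f a b z ≡ f c y z
  matched⁻ {a} {b} {c} {y} (x , x' , w , w' , e , o , eq) with pr-inj₁ {pr a b} {pr c y} {pr x x'} {pr w w'} e | pr-inj₂ {pr a b} {pr c y} {pr x x'} {pr w w'} e
  ... | p | p' with pr-inj₁ {a} {b} {x} {x'} p | pr-inj₂ {a} {b} {x} {x'} p | pr-inj₁ {c} {y} {w} {w'} p' | pr-inj₂ {c} {y} {w} {w'} p'
  ...   | refl | refl | refl | refl = o , eq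

  realized-sim : ∀ {m z a b c y} → Realizes (proj₁ limit) m z → pair-code a b c y < m → Sim a b c y → Matched (pair-code a b c y) z
  realized-sim rz lt s with rz _ lt
  ... | inj₁ (_ , p) = p
  ... | inj₂ (e , _) = true≢false s e

  realized-unsim : ∀ {m z a b c y} → Realizes (proj₁ limit) m z → pair-code a b c y < m → Matched (pair-code a b c y) z → Sim a b c y
  realized-unsim rz lt p with rz _ lt
  ... | inj₁ (e , _) = e
  ... | inj₂ (_ , n) = ⊥-elim (n p)

  sim-sym : ∀ {a b c y} → Sim a b c y → Sim c y a b
  sim-sym {a} {b} {c} {y} s = go (sim-at m 0)
    where
      m : ℕ
      m = suc (pair-code a b c y ⊔ pair-code c y a b)
      go : (Σ ℕ λ z → 0 ≤ z × Realizes (proj₁ limit) m z) → Sim c y a b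
      go (z , _ , rz) = let ((o , o') , e) = matched⁻ {a} {b} {c} {y} (realized-sim {m} {z} {a} {b} {c} {y} rz (s≤s (m≤m⊔n _ _)) s)
        in realized-unsim {m} {z} {c} {y} {a} {b} rz (s≤s (m≤n⊔m (pair-code a b c y) _)) (c , y , a , b , refl , (o' , o) , sym e)

  sim-< : ∀ {a b c y} → Sim a b c y → a < b × c < y
  sim-< {a} {b} {c} {y} s = go (sim-at (suc (pair-code a b c y)) 0)
    where
      go : (Σ ℕ λ z → 0 ≤ z × Realizes (proj₁ limit) (suc (pair-code a b c y)) z) → a < b × c < y
      go (z , _ , rz) = let (((p , _) , (q , _)) , _) = matched⁻ {a} {b} {c} {y} (realized-sim {a = a} {b} {c} {y} rz ≤-refl s) in p , q

  -- At a `z` realizing both matches the three pairs give triples of one color, and two-boundedness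
  -- identifies two of them.
  sim-unique : ∀ {a b c y c' y'} → Sim a b c y → Sim a b c' y' → ¬ (a ≡ c × b ≡ y) → ¬ (a ≡ c' × b ≡ y') → c ≡ c' × y ≡ y'
  sim-unique {a} {b} {c} {y} {c'} {y'} s s' d d' = go (sim-at m 0)
    where
      m : ℕ
      m = suc (pair-code a b c y ⊔ pair-code a b c' y')
      go : (Σ ℕ λ z → 0 ≤ z × Realizes (proj₁ limit) m z) → c ≡ c' × y ≡ y'
      go (z , _ , rz) with matched⁻ {a} {b} {c} {y} (realized-sim {m} {z} {a} {b} {c} {y} rz (s≤s (m≤m⊔n _ _)) s)
                         | matched⁻ {a} {b} {c'} {y'} (realized-sim {m} {z} {a} {b} {c'} {y'} rz (s≤s (m≤n⊔m (pair-code a b c y) _)) s')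
      ... | ((ab , bz) , (cy , yz)) , e | (_ , (cy' , yz')) , e' with f-two c y z a b z c' y' z cy yz ab bz cy' yz' (sym e) e'
      ...   | inj₁ (p , q , _) = ⊥-elim (d (sym p , sym q))
      ...   | inj₂ (inj₁ (p , q , _)) = p , q
      ...   | inj₂ (inj₂ (p , q , _)) = ⊥-elim (d' (p , q))

  -- In hA the last element belongs to the partner of a pair of earlier elements; in hB two pairs
  -- with the same last element are partners.
  EdgeA EdgeB : ℕ → Set
  EdgeA e = Σ ℕ λ a → Σ ℕ λ b → Σ ℕ λ c → Σ ℕ λ y → b < y × Sim a b c y × e ≡ tri a b y
  EdgeB e = Σ ℕ λ x → Σ ℕ λ x' → Σ ℕ λ y → ¬ x ≡ x' × Sim x y x' y × e ≡ tri x x' y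

  hA hB : SetN
  hA = chr EdgeA
  hB = chr EdgeB

  -- Since `c` is left out of the edge, `S` consists of `a < b` only and determines the pair; its
  -- partner is unique, and with it `y`.
  thin-hA : WThin hA
  thin-hA = inj₁ λ S y y' ne a a' p p' → determined S y y' a a' (chr⁻ {EdgeA} p) (chr⁻ {EdgeA} p')
    where
      shape : ∀ S y₁ a b y → a < b → b < y → Above S y₁ → ins S y₁ ≡ tri a b y →
        y₁ ≡ y × a ∈ bit S × b ∈ bit S × (∀ z → z ∈ bit S → z ≡ a ⊎ z ≡ b)
      shape S y₁ a b y ab by ab₁ e = y₁≡y , in-S a (tri₁ a b y) (<⇒≢ (<-trans ab by)) , in-S b (tri₂ a b y) (<⇒≢ by) , only
        where
          y₁≤y : y₁ ≤ y
          y₁≤y with tri⁻ {a} {b} {y} (subst (λ w → y₁ ∈ bit w) e (ins-here S y₁))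
          ... | inj₁ refl = <⇒≤ (<-trans ab by)
          ... | inj₂ (inj₁ refl) = <⇒≤ by
          ... | inj₂ (inj₂ refl) = ≤-refl
          y₁≡y : y₁ ≡ y
          y₁≡y with ins⁻ {S} {y₁} {y} (subst (λ w → y ∈ bit w) (sym e) (tri₃ a b y))
          ... | inj₁ q = sym q
          ... | inj₂ m = ⊥-elim (<⇒≱ (ab₁ y m) y₁≤y)
          in-S : ∀ z → z ∈ bit (tri a b y) → z ≢ y → z ∈ bit S
          in-S z m ne with ins⁻ {S} {y₁} {z} (subst (λ w → z ∈ bit w) (sym e) m)
          ... | inj₁ q = ⊥-elim (ne (trans q y₁≡y))
          ... | inj₂ m' = m'
          only : ∀ z → z ∈ bit S → z ≡ a ⊎ z ≡ b
          only z m with tri⁻ {a} {b} {y} (subst (λ w → z ∈ bit w) e (ins-there m))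
          ... | inj₁ q = inj₁ q
          ... | inj₂ (inj₁ q) = inj₂ q
          ... | inj₂ (inj₂ q) = ⊥-elim (<-irrefl (trans q (sym y₁≡y)) (ab₁ z m))
      same : ∀ {a b a' b'} → a < b → a' < b' → a ≡ a' ⊎ a ≡ b' → b ≡ a' ⊎ b ≡ b' → a ≡ a' × b ≡ b'
      same ab ab' (inj₁ p) (inj₂ q) = p , q
      same ab ab' (inj₁ refl) (inj₁ refl) = ⊥-elim (<-irrefl refl ab)
      same ab ab' (inj₂ refl) (inj₂ refl) = ⊥-elim (<-irrefl refl ab)
      same ab ab' (inj₂ refl) (inj₁ refl) = ⊥-elim (<-asym ab ab')
      determined : ∀ S y₁ y₂ → Above S y₁ → Above S y₂ → EdgeA (ins S y₁) → EdgeA (ins S y₂) → y₁ ≡ y₂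
      determined S y₁ y₂ ab₁ ab₂ (a , b , c , y , by , sm , e) (a' , b' , c' , y' , by' , sm' , e')
        with shape S y₁ a b y (proj₁ (sim-< {a} {b} {c} {y} sm)) by ab₁ e | shape S y₂ a' b' y' (proj₁ (sim-< {a'} {b'} {c'} {y'} sm')) by' ab₂ e'
      ... | refl , aS , bS , _ | refl , _ , _ , only' with same (proj₁ (sim-< {a} {b} {c} {y} sm)) (proj₁ (sim-< {a'} {b'} {c'} {y'} sm')) (only' a aS) (only' b bS)
      ...   | refl , refl = proj₂ (sim-unique {a} {b} {c} {y} {c'} {y'} sm sm' (λ d → <⇒≢ by (proj₂ d)) (λ d → <⇒≢ by' (proj₂ d)))

  -- `S` consists of its maximum `y` and one further `p`, and the missing element comes from the
  -- unique partner of `(p , y)`.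
  thin-hB : WThin hB
  thin-hB = inj₂ λ S x x' ne s s' p p' → determined S x x' ne s s' (chr⁻ {EdgeB} p) (chr⁻ {EdgeB} p')
    where
      Shape : ℕ → ℕ → ℕ → Set
      Shape S x₁ y = y ∈ bit S × (∀ z → z ∈ bit S → z ≤ y) ×
        Σ ℕ λ p → p ∈ bit S × p ≢ y × p ≢ x₁ × Sim p y x₁ y × (∀ z → z ∈ bit S → z ≢ y → z ≡ p)
      shape : ∀ S x₁ x x' y → S ≢ 0 → Side S x₁ → ¬ x ≡ x' → Sim x y x' y → ins S x₁ ≡ tri x x' y → Shape S x₁ y
      shape S x₁ x x' y ne (out , inj₁ z) _ _ _ = ⊥-elim (ne z)
      shape S x₁ x x' y ne (out , inj₂ (z , zS , lt)) xx' sm e = yS , top , other (tri⁻ {x} {x'} {y} (into x₁ (ins-here S x₁)))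
        where
          xy : x < y × x' < y
          xy = sim-< {x} {y} {x'} {y} sm
          into : ∀ w → w ∈ bit (ins S x₁) → w ∈ bit (tri x x' y)
          into w m = subst (λ v → w ∈ bit v) e m
          top : ∀ w → w ∈ bit S → w ≤ y
          top w m with tri⁻ {x} {x'} {y} (into w (ins-there m))
          ... | inj₁ refl = <⇒≤ (proj₁ xy)
          ... | inj₂ (inj₁ refl) = <⇒≤ (proj₂ xy)
          ... | inj₂ (inj₂ refl) = ≤-refl
          from : ∀ w → w ∈ bit (tri x x' y) → w ≢ x₁ → w ∈ bit S
          from w m ne' with ins⁻ {S} {x₁} {w} (subst (λ v → w ∈ bit v) (sym e) m)
          ... | inj₁ q = ⊥-elim (ne' q)
          ... | inj₂ m' = m'
          x₁<y : x₁ < y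
          x₁<y = <-≤-trans lt (top z zS)
          yS : y ∈ bit S
          yS = from y (tri₃ x x' y) (λ q → <⇒≢ x₁<y (sym q))
          not-x₁ : ∀ {w} → w ∈ bit S → w ≢ x₁
          not-x₁ m refl = true≢false m out
          other : x₁ ≡ x ⊎ (x₁ ≡ x' ⊎ x₁ ≡ y) →
            Σ ℕ λ p → p ∈ bit S × p ≢ y × p ≢ x₁ × Sim p y x₁ y × (∀ z → z ∈ bit S → z ≢ y → z ≡ p)
          other (inj₁ refl) = x' , from x' (tri₂ x x' y) (λ q → xx' (sym q)) , <⇒≢ (proj₂ xy) , (λ q → xx' (sym q)) , sim-sym {x} {y} {x'} {y} sm , only
            where
              only : ∀ z → z ∈ bit S → z ≢ y → z ≡ x'
              only z m ny with tri⁻ {x} {x'} {y} (into z (ins-there m))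
              ... | inj₁ q = ⊥-elim (not-x₁ m q)
              ... | inj₂ (inj₁ q) = q
              ... | inj₂ (inj₂ q) = ⊥-elim (ny q)
          other (inj₂ (inj₁ refl)) = x , from x (tri₁ x x' y) xx' , <⇒≢ (proj₁ xy) , xx' , sm , only
            where
              only : ∀ z → z ∈ bit S → z ≢ y → z ≡ x
              only z m ny with tri⁻ {x} {x'} {y} (into z (ins-there m))
              ... | inj₁ q = q
              ... | inj₂ (inj₁ q) = ⊥-elim (not-x₁ m q)
              ... | inj₂ (inj₂ q) = ⊥-elim (ny q)
          other (inj₂ (inj₂ refl)) = ⊥-elim (<-irrefl refl x₁<y)
      determined : ∀ S x₁ x₂ → S ≢ 0 → Side S x₁ → Side S x₂ → EdgeB (ins S x₁) → EdgeB (ins S x₂) → x₁ ≡ x₂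
      determined S x₁ x₂ ne s₁ s₂ (x , x' , y , d , sm , e) (w , w' , y' , d' , sm' , e')
        with shape S x₁ x x' y ne s₁ d sm e | shape S x₂ w w' y' ne s₂ d' sm' e'
      ... | yS , top , p , pS , py , px , sp , only | yS' , top' , p' , pS' , py' , px' , sp' , _ with ≤-antisym (top' y yS) (top y' yS')
      ...   | refl with only p' pS' py'
      ...     | refl = proj₁ (sim-unique {p} {y} {x₁} {y} {x₂} {y} sp sp' (λ q → px (proj₁ q)) (λ q → px' (proj₁ q)))

  unary-no-edge : ∀ y → ¬ EdgeA (ins 0 y) × ¬ EdgeB (ins 0 y)
  unary-no-edge y = (λ { (a , b , c , y' , by , sm , e) →
        <⇒≢ by (trans (single e (tri₂ a b y')) (sym (single e (tri₃ a b y')))) })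
    , (λ { (x , x' , y' , d , sm , e) → d (trans (single e (tri₁ x x' y')) (sym (single e (tri₂ x x' y')))) })
    where
      single : ∀ {a b c w} → ins 0 y ≡ tri a b c → w ∈ bit (tri a b c) → w ≡ y
      single {w = w} e m with ins⁻ {0} {y} {w} (subst (λ v → w ∈ bit v) (sym e) m)
      ... | inj₁ q = q
      ... | inj₂ z = ∅-empty z

  H₀ : ℕ → SetN
  H₀ zero = hA
  H₀ (suc _) = hB

  Con₀ : SetN
  Con₀ = chr (λ E → ∀ l → l < 2 → Ind (H₀ l) E)

  con₀-indep : ∀ {T a b c y} → T ∈ Con₀ → a ∈ bit T → b ∈ bit T → c ∈ bit T → y ∈ bit T → Sim a b c y → a ≡ c × b ≡ y
  con₀-indep {T} {a} {b} {c} {y} m aT bT cT yT sm with <-cmp b y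
  ... | tri< by _ _ = true≢false (chr⁺ {EdgeA} (a , b , c , y , by , sm , refl))
        (chr⁻ {λ E → ∀ l → l < 2 → Ind (H₀ l) E} m 0 (s≤s z≤n) (tri a b y) (nonempty⁻ (tri₁ a b y)) (tri-⊆ aT bT yT))
  ... | tri> _ _ yb = true≢false (chr⁺ {EdgeA} (c , y , a , b , yb , sim-sym {a} {b} {c} {y} sm , refl))
        (chr⁻ {λ E → ∀ l → l < 2 → Ind (H₀ l) E} m 0 (s≤s z≤n) (tri c y b) (nonempty⁻ (tri₁ c y b)) (tri-⊆ cT yT bT))
  ... | tri≈ _ refl _ = dne (λ d → true≢false (chr⁺ {EdgeB} (a , c , b , (λ q → d (q , refl)) , sm , refl))
        (chr⁻ {λ E → ∀ l → l < 2 → Ind (H₀ l) E} m 1 (s≤s (s≤s z≤n)) (tri a c b) (nonempty⁻ (tri₁ a c b)) (tri-⊆ aT cT bT)))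

  con₀-intro : ∀ {T} → (∀ a b c y → a ∈ bit T → b ∈ bit T → y ∈ bit T → b < y → ¬ Sim a b c y) →
    (∀ x x' y → x ∈ bit T → x' ∈ bit T → y ∈ bit T → ¬ x ≡ x' → ¬ Sim x y x' y) → T ∈ Con₀
  con₀-intro {T} nA nB = chr⁺ ind
    where
      ind : ∀ l → l < 2 → Ind (H₀ l) T
      ind zero _ e _ sub = not-true λ p → badA (chr⁻ {EdgeA} p)
        where
          badA : ¬ EdgeA e
          badA (a , b , c , y , by , sm , refl) = nA a b c y (sub a (tri₁ a b y)) (sub b (tri₂ a b y)) (sub y (tri₃ a b y)) by sm
      ind (suc l) _ e _ sub = not-true λ p → badB (chr⁻ {EdgeB} p)
        where
          badB : ¬ EdgeB e
          badB (x , x' , y , d , sm , refl) = nB x x' y (sub x (tri₁ x x' y)) (sub x' (tri₂ x x' y)) (sub y (tri₃ x x' y)) d sm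

  P₀ : Stack
  P₀ = tot (proj₁ limit) ∷ˢ ∅ˢ

  nsimD : ∀ a b c y → Def true {⊤} (λ _ → P₀) (λ _ ρ → ¬ Sim (ρ a) (ρ b) (ρ c) (ρ y))
  nsimD a b c y = mapD (λ _ ρ → (λ { (_ , refl , h) p → true≢false p (just-injective h) }) , (λ n → _ , refl , cong just (not-true n)))
    (exD (andD (pairsD 0 (suc a) (suc b) (suc c) (suc y)) (onD 0 (var 0))))

  -- `EdgeA` quantifies over all `c`, but partners are increasing pairs, so `c < y` turns the
  -- negation into a bounded statement.
  Con₀D : Enumerable P₀ Con₀
  Con₀D = mapD (λ _ ρ → fwd (ρ 0) , bwd (ρ 0))
      (andD (allInD 0 (allInD 1 (allInD 2 (orD (nltD (var 1) (var 0)) (alD (var 0) (nsimD 3 2 0 1))))))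
            (allInD 0 (allInD 1 (allInD 2 (orD (eqD (var 2) (var 1)) (nsimD 2 0 1 0))))))
    where
      CA CB : ℕ → Set
      CA T = ∀ a → a ∈ bit T → ∀ b → b ∈ bit T → ∀ y → y ∈ bit T → (¬ b < y) ⊎ (∀ c → c < y → ¬ Sim a b c y)
      CB T = ∀ x → x ∈ bit T → ∀ x' → x' ∈ bit T → ∀ y → y ∈ bit T → x ≡ x' ⊎ (¬ Sim x y x' y)
      useA : ∀ {T} → CA T → ∀ a b c y → a ∈ bit T → b ∈ bit T → y ∈ bit T → b < y → ¬ Sim a b c y
      useA h a b c y p q r lt sm with h a p b q y r
      ... | inj₁ n = n lt
      ... | inj₂ n = n c (proj₂ (sim-< {a} {b} {c} {y} sm)) sm
      useB : ∀ {T} → CB T → ∀ x x' y → x ∈ bit T → x' ∈ bit T → y ∈ bit T → ¬ x ≡ x' → ¬ Sim x y x' y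
      useB h x x' y p q r d sm with h x p x' q y r
      ... | inj₁ e = d e
      ... | inj₂ n = n sm
      fwd : ∀ T → CA T × CB T → T ∈ Con₀
      fwd T (a , b) = con₀-intro {T} (useA a) (useB b)
      bwd : ∀ T → T ∈ Con₀ → CA T × CB T
      bwd T m = (λ a p b q y r → or-else λ lt c c<y sm → <⇒≢ (dne lt) (proj₂ (indA a b c y p q r (dne lt) sm)))
              , (λ x p x' q y r → or-else λ d sm → d (proj₁ (con₀-indep {T} m p r q r sm)))
        where
          indA : ∀ a b c y → a ∈ bit T → b ∈ bit T → y ∈ bit T → b < y → Sim a b c y → a ≡ c × b ≡ y
          indA a b c y p q r by sm = true≢false (chr⁺ {EdgeA} (a , b , c , y , by , sm , refl))
            (chr⁻ {λ E → ∀ l → l < 2 → Ind (H₀ l) E} m 0 (s≤s z≤n) (tri a b y) (nonempty⁻ (tri₁ a b y)) (tri-⊆ p q r))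

  -- Extending rainbows and starting the construction

  -- At most one other triple has the color of a given one, so its last element supplies the bound.
  partner-bound : ∀ x y z → Σ ℕ λ u → ∀ x' y' z' → x < y → y < z → x' < y' → y' < z' → f x y z ≡ f x' y' z' →
    ¬ (x ≡ x' × y ≡ y' × z ≡ z') → z' < u
  partner-bound x y z with em {Σ ℕ λ x' → Σ ℕ λ y' → Σ ℕ λ z' → (x < y × y < z) × (x' < y' × y' < z') × f x y z ≡ f x' y' z' ×
    ¬ (x ≡ x' × y ≡ y' × z ≡ z')}
  ... | no none = 0 , λ x' y' z' p q p' q' e d → ⊥-elim (none (x' , y' , z' , (p , q) , (p' , q') , e , d))
  ... | yes (x₁ , y₁ , z₁ , (p , q) , (p₁ , q₁) , e₁ , d₁) = suc z₁ , bound₁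
    where
      bound₁ : ∀ x' y' z' → x < y → y < z → x' < y' → y' < z' → f x y z ≡ f x' y' z' → ¬ (x ≡ x' × y ≡ y' × z ≡ z') → z' < suc z₁
      bound₁ x' y' z' _ _ p' q' e d with f-two x' y' z' x y z x₁ y₁ z₁ p' q' p q p₁ q₁ (sym e) e₁
      ... | inj₁ (a , b , c) = ⊥-elim (d (sym a , sym b , sym c))
      ... | inj₂ (inj₁ (_ , _ , c)) = s≤s (≤-reflexive c)
      ... | inj₂ (inj₂ eq) = ⊥-elim (d₁ eq)

  PBound : ℕ → ℕ → ℕ → ℕ → Set
  PBound x y z u = ∀ x' y' z' → x < y → y < z → x' < y' → y' < z' → f x y z ≡ f x' y' z' → ¬ (x ≡ x' × y ≡ y' × z ≡ z') → z' < u

  partner-bounds : ∀ T → Σ ℕ λ u → ∀ x → x < T → ∀ y → y < T → ∀ z → z < T → PBound x y z u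
  partner-bounds T = bounded (λ le h y ly z lz x' y' z' p q p' q' e d → <-≤-trans (h y ly z lz x' y' z' p q p' q' e d) le) T λ x _ →
    bounded (λ le h z lz x' y' z' p q p' q' e d → <-≤-trans (h z lz x' y' z' p q p' q' e d) le) T λ y _ →
    bounded (λ le h x' y' z' p q p' q' e d → <-≤-trans (h x' y' z' p q p' q' e d) le) T λ z _ → partner-bound x y z

  Extends : ℕ → ℕ → Set
  Extends T u = ∀ z → u ≤ z → Realizes (proj₁ limit) u z → Rb (uni T (ins 0 z))

  -- Equally colored triples that both end in `z` are partners in the limit, which `Con₀` forbids
  -- inside `T`; a triple of `T` has its only possible rival below `u₁`.
  rainbow-extends : ∀ T → Rb T → T ∈ Con₀ → Σ ℕ (Extends T)
  rainbow-extends T rbT cT = u , extends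
    where
      u₁ u₂ u : ℕ
      u₁ = proj₁ (partner-bounds T)
      u₂ = suc (pr (pr T T) (pr T T))
      u = u₁ ⊔ u₂ ⊔ T
      extends : Extends T u
      extends z u≤z rz x y w x' y' w' xm ym wm xm' ym' wm' xy yw xy' yw' e =
          cases (old-or-z (mem wm)) (old-or-z (mem wm'))
        where
          T≤z : T ≤ z
          T≤z = ≤-trans (m≤n⊔m (u₁ ⊔ u₂) T) u≤z
          u₁≤z : u₁ ≤ z
          u₁≤z = ≤-trans (≤-trans (m≤m⊔n u₁ u₂) (m≤m⊔n (u₁ ⊔ u₂) T)) u≤z
          mem : ∀ {v} → v ∈ bit (uni T (ins 0 z)) → v ∈ bit T ⊎ v ∈ bit (ins 0 z)
          mem m = uni⁻ {T} {ins 0 z} m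
          old-or-z : ∀ {v} → v ∈ bit T ⊎ v ∈ bit (ins 0 z) → v ∈ bit T ⊎ v ≡ z
          old-or-z (inj₁ m) = inj₁ m
          old-or-z {v} (inj₂ m) with ins⁻ {0} {z} {v} m
          ... | inj₁ q = inj₂ q
          ... | inj₂ n = ∅-empty n
          ≤z : ∀ {v} → v ∈ bit T ⊎ v ≡ z → v ≤ z
          ≤z {v} (inj₁ m) = ≤-trans (<⇒≤ (bit< T v m)) T≤z
          ≤z (inj₂ refl) = ≤-refl
          old : ∀ {v v'} → v < v' → v' ∈ bit (uni T (ins 0 z)) → v ∈ bit (uni T (ins 0 z)) → v ∈ bit T
          old lt m' m with old-or-z (mem m)
          ... | inj₁ p = p
          ... | inj₂ refl = ⊥-elim (<⇒≱ lt (≤z (old-or-z (mem m'))))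
          xT = old xy ym xm
          yT = old yw wm ym
          xT' = old xy' ym' xm'
          yT' = old yw' wm' ym'
          top : w ≡ z → w' ≡ z → x ≡ x' × y ≡ y' × w ≡ w'
          top refl refl = let (p , q) = con₀-indep {T} {x} {y} {x'} {y'} cT xT yT xT' yT'
                                  (realized-unsim {u} {w} {x} {y} {x'} {y'} rz code< (x , y , x' , y' , refl , ((xy , yw) , (xy' , yw')) , e))
                          in p , q , refl
            where
              ≤T : ∀ {v} → v ∈ bit T → v ≤ T
              ≤T {v} m = <⇒≤ (bit< T v m)
              code< : pair-code x y x' y' < u
              code< = ≤-trans (s≤s (pr-mono (pr-mono (≤T xT) (≤T yT)) (pr-mono (≤T xT') (≤T yT'))))
                              (≤-trans (m≤n⊔m u₁ u₂) (m≤m⊔n (u₁ ⊔ u₂) T))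
          cases : w ∈ bit T ⊎ w ≡ z → w' ∈ bit T ⊎ w' ≡ z → x ≡ x' × y ≡ y' × w ≡ w'
          cases (inj₁ m) (inj₁ m') = rbT x y w x' y' w' xT yT m xT' yT' m' xy yw xy' yw' e
          cases (inj₁ m) (inj₂ refl) = dne λ d → <⇒≱ (proj₂ (partner-bounds T) x (bit< T x xT) y (bit< T y yT) w (bit< T w m)
            x' y' w' xy yw xy' yw' e d) u₁≤z
          cases (inj₂ refl) (inj₁ m') = dne λ d → <⇒≱ (proj₂ (partner-bounds T) x' (bit< T x' xT') y' (bit< T y' yT') w' (bit< T w' m')
            x y w xy' yw' xy yw (sym e) λ { (p , q , s) → d (sym p , sym q , sym s) }) u₁≤z
          cases (inj₂ p) (inj₂ p') = top p p'

  -- The initial condition: every set in Con₀ is promised to have larger elements added to it.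

  Initial : ℕ → Set
  Initial i = Σ ℕ λ T → Σ ℕ λ a → i ≡ idx 0 0 T a × Rb T × T ∈ Con₀

  𝓤₀ : SetN
  𝓤₀ = chr Initial

  𝓤₀D : Enumerable P₀ 𝓤₀
  𝓤₀D = mapD (λ _ ρ → (λ { (T , a , _ , refl , h) → chr⁺ (T , a , h) })
                     , (λ m → let (T , a , h) = chr⁻ {Initial} m in T , a , 0 , refl , h))
    (exD (exD (exD (andD (eqD (var 0) (lit 0)) (andD (idxD 3 0 0 2 1) (andD (rbD 2) (subD (pair (var 2) (var 2)) Con₀D)))))))

  singleton : ∀ {x z} → x ∈ bit (ins 0 z) → x ≡ z
  singleton {x} {z} m with ins⁻ {0} {z} {x} m
  ... | inj₁ q = q
  ... | inj₂ n = ∅-empty n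

  -- A far enough `z` that realizes the limit lies in some piece. Its singleton is independent,
  -- because singleton edges are bounded, and fulfils the promise of that piece by
  -- `rainbow-extends`.
  proper₀ : ¬ Small 𝓤₀ all-true
  proper₀ (c , W , k , H , th , cover , av) = contradict
      (bounded {Good} (λ le h z le' rz → h z (≤-trans le le') (realizes-mono le rz)) c good) (unary-bounds k H th)
    where
      Good : ℕ → ℕ → Set
      Good j u = ∀ z → u ≤ z → Realizes (proj₁ limit) u z → U (proj₁ (W j)) (ins 0 z)
      good : ∀ j → j < c → Σ ℕ (Good j)
      good j lt with chr⁻ {Initial} (proj₁ (av j lt))
      ... | T , a , e , rbT , cT with rainbow-extends T rbT cT
      ...   | u , ext-T = u ⊔ a , λ z le rz → 0 , 0 , T , a , e
                , ext-T z (≤-trans (m≤m⊔n u a) le) (realizes-mono (m≤m⊔n u a) rz)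
                , z , proj₂ (instance₀ {bit (uni T (ins 0 z))}) (uniʳ {T} (ins-here 0 z) , ≤⇒≯ (≤-trans (m≤n⊔m u a) le))
      contradict : (Σ ℕ λ u₁ → ∀ j → j < c → Good j u₁) → (Σ ℕ λ u₂ → ∀ y → u₂ ≤ y → ∀ l → l < k → ¬ ins 0 y ∈ H l) → ⊥
      contradict (u₁ , g) (u₂ , no-unary) = go (sim-at (u₁ ⊔ u₂) (u₁ ⊔ u₂))
        where
          ind : ∀ z → u₂ ≤ z → ∀ l → l < k → Ind (H l) (ins 0 z)
          ind z le l lt d ne sub = not-true λ hm → no-unary z le l lt (subst (_∈ H l) (⊆-antisym sub back) hm)
            where
              back : ins 0 z ⊆ₑ d
              back x m = let (y , m') = nonempty d ne
                in subst (λ w → w ∈ bit d) (trans (singleton (sub y m')) (sym (singleton m))) m'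
          hit : ∀ z → u₁ ⊔ u₂ ≤ z → Realizes (proj₁ limit) (u₁ ⊔ u₂) z → (Σ ℕ λ j → j < c × z ∈ proj₂ (W j)) → ⊥
          hit z le rz (j , lt , zW) = proj₂ (av j lt) (ins 0 z) (λ x m → subst (_∈ proj₂ (W j)) (sym (singleton m)) zW)
            (ind z (≤-trans (m≤n⊔m u₁ u₂) le)) (g j lt z (≤-trans (m≤m⊔n u₁ u₂) le) (realizes-mono (m≤m⊔n u₁ u₂) rz))
          go : (Σ ℕ λ z → u₁ ⊔ u₂ ≤ z × Realizes (proj₁ limit) (u₁ ⊔ u₂) z) → ⊥
          go (z , le , rz) = hit z le rz (cover z refl)

  rb-∅ : Rb 0
  rb-∅ x y z x' y' z' m = ∅-empty m

  ∅∈Con₀ : 0 ∈ Con₀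
  ∅∈Con₀ = con₀-intro {0} (λ a b c y m → ∅-empty m) (λ x x' y m → ∅-empty m)

  t₀ : St
  t₀ = record { P = P₀ ; nice = proj₂ (proj₂ limit) ; 𝓤 = 𝓤₀ ; 𝓤D = 𝓤₀D ; s = 1 ; bound = bound₀ ; proper = proper₀
              ; base = λ a → chr⁺ (0 , a , refl , rb-∅ , ∅∈Con₀) }
    where
      bound₀ : ∀ i → i ∈ 𝓤₀ → Below 1 i
      bound₀ i m r n T a e with chr⁻ {Initial} m
      ... | T' , a' , e' , _ with idx-inj (trans (sym e') e)
      ...   | refl , _ = s≤s z≤n

  q₀ : Cond
  q₀ = record { t = t₀ ; F = 0 ; rb = rb-∅ ; Con = Con₀ ; ConD = Con₀D ; k = 2 ; H = H₀ ; weak = weak₀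
              ; con⇒ = λ E m → chr⁻ {λ E → ∀ l → l < 2 → Ind (H₀ l) E} m ; con⇐ = λ E h → chr⁺ h
              -- Every state is proper, so the whole space stays large.
              ; Y = all-true ; fv = λ t' _ → proper t' ; sing = sing₀ }
    where
      weak₀ : ∀ l → l < 2 → WThin (H₀ l)
      weak₀ zero _ = thin-hA
      weak₀ (suc l) _ = thin-hB
      sing₀ : ∀ y → y ∈ all-true → ∀ l → l < 2 → ¬ ins 0 y ∈ H₀ l
      sing₀ y _ zero _ m = proj₁ (unary-no-edge y) (chr⁻ {EdgeA} m)
      sing₀ y _ (suc l) _ m = proj₂ (unary-no-edge y) (chr⁻ {EdgeB} m)

  prm₀ : Prm q₀ 0 0
  prm₀ E T a m refl rbT = chr⁺ (uni 0 E , a , refl , rbT , subst (_∈ Con₀) (sym (uni-∅ E)) m)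

  -- The generic sequence

  prm-ext : ∀ {q q' r n} → Ext q' q → Prm q r n → Prm q' r n
  prm-ext {q} {q'} (e , E , m , Fe , c) prm E' T a m' eT rbT =
    proj₂ e _ (prm (uni E E') T a (c E' m') (trans eT (trans (cong (λ w → uni w E') Fe) (uni-assoc (F q) E E'))) rbT)

  Settled : Cond → Req → ℕ → Set
  Settled q β r = Σ ℕ λ n → (n ∈ target β × Prm q r n) ⊎ (¬ n ∈ target β × Σ ℕ λ a → Neg q r n a)

  opaque
    settle : ∀ q β r → Σ Cond λ q' → Ext q' q × (¬ Sigma2 Z (target β) → Settled q' β r)
    settle q β r = cases em
      where
        Result : Set
        Result = Σ Cond λ q' → Ext q' q × (¬ Sigma2 Z (target β) → Settled q' β r)
        cases : Dec (Sigma2 Z (target β)) → Result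
        cases (yes σ₂) = q , ext-refl q , λ nσ → ⊥-elim (nσ σ₂)
        cases (no nσ) = go (Requiring.require q β nσ r)
          where
            go : Σ ℕ (Requiring.Outcome q β nσ r) → Result
            go (n , inj₁ (b , q' , e , prm)) = q' , e , λ _ → n , inj₁ (b , prm)
            go (n , inj₂ (nb , q' , e , a , neg)) = q' , e , λ _ → n , inj₂ (nb , a , neg)

    fulfil : ∀ q r n a → Σ Cond λ q' → Ext q' q × (Prm q r n → Met q' r n a)
    fulfil q r n a = cases em
      where
        Result : Set
        Result = Σ Cond λ q' → Ext q' q × (Prm q r n → Met q' r n a)
        cases : Dec (idx r n (F q) a ∈ 𝓤 (t q)) → Result
        cases (yes m) = let (q' , e , met) = meet q r n a m in q' , e , λ _ → met
        cases (no nm) = q , ext-refl q , λ prm → ⊥-elim (nm (prm 0 (F q) a (∅∈Con q) (sym (uni-∅ʳ (F q))) (rb q)))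

  reqOf : ℕ → Req
  reqOf c = enum decB (left (left c)) , par (right (left c))

  req-onto : ∀ β r → ∃ λ c → reqOf c ≡ β × right c ≡ r
  req-onto (φ , b) r with enum-onto (decB-onto φ)
  ... | i , refl = pr (pr i (b2n b)) r
    , cong₂ _,_ (cong (enum decB) (trans (cong left (left-pr _ r)) (left-pr i _)))
                (trans (cong par (trans (cong right (left-pr _ r)) (right-pr i _))) (par-double 0 b))
    , right-pr _ r

  act : Cond → ℕ → ℕ → Cond
  act q zero c = proj₁ (settle q (reqOf c) (right c))
  act q (suc _) c = proj₁ (fulfil q (left (right c)) (left (right (right c))) (right (right (right c))))

  act-ext : ∀ q tag c → Ext (act q tag c) q
  act-ext q zero c = proj₁ (proj₂ (settle q (reqOf c) (right c)))
  act-ext q (suc _) c = proj₁ (proj₂ (fulfil q (left (right c)) (left (right (right c))) (right (right (right c)))))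

  act-settles : ∀ q {tag} c {β r} → tag ≡ 0 → reqOf c ≡ β → right c ≡ r → ¬ Sigma2 Z (target β) → Settled (act q tag c) β r
  act-settles q c refl refl refl = proj₂ (proj₂ (settle q (reqOf c) (right c)))

  act-fulfils : ∀ q {tag} c {r n a} → tag ≡ 1 → left (right c) ≡ r → left (right (right c)) ≡ n → right (right (right c)) ≡ a →
    Prm q r n → Met (act q tag c) r n a
  act-fulfils q c refl refl refl refl = proj₂ (proj₂ (fulfil q (left (right c)) (left (right (right c))) (right (right (right c)))))

  opaque
    seq : ℕ → Cond
    seq zero = q₀
    seq (suc s) = act (seq s) (left s) (right s)

    seq-ext : ∀ s k → Ext (seq (k + s)) (seq s)
    seq-ext s zero = ext-refl (seq s)
    seq-ext s (suc k) = ext-trans {seq s} {seq (k + s)} {seq (suc k + s)}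
      (act-ext (seq (k + s)) (left (k + s)) (right (k + s))) (seq-ext s k)

    seq-promise : Prm (seq 0) 0 0
    seq-promise = prm₀

    settled-stage : ∀ β r → Σ ℕ λ s → ¬ Sigma2 Z (target β) → Settled (seq s) β r
    settled-stage β r = let (c , e , e') = req-onto β r in suc (pr 0 c)
      , act-settles (seq (pr 0 c)) (right (pr 0 c)) (left-pr 0 c) (trans (cong reqOf (right-pr 0 c)) e) (trans (cong right (right-pr 0 c)) e')

    -- The number `j` is padding: it makes every promise come up at arbitrarily late stages.
    met-stage : ∀ j r n a → Prm (seq (pr 1 (pr j (pr r (pr n a))))) r n → Met (seq (suc (pr 1 (pr j (pr r (pr n a)))))) r n a
    met-stage j r n a = act-fulfils (seq (pr 1 c)) (right (pr 1 c)) (left-pr 1 c) (trans (cong left e) (left-pr r _))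
        (trans (cong left (trans (cong right e) (right-pr r _))) (left-pr n a)) (trans (cong right (trans (cong right e) (right-pr r _))) (right-pr n a))
      where
        c : ℕ
        c = pr j (pr r (pr n a))
        e : right (right (pr 1 c)) ≡ pr r (pr n a)
        e = trans (cong right (right-pr 1 c)) (right-pr j _)

  seq-mono : ∀ {s s'} → s ≤ s' → Ext (seq s') (seq s)
  seq-mono {s} {s'} le = subst (λ k → Ext (seq k) (seq s)) (m∸n+n≡m le) (seq-ext s (s' ∸ s))

  F-mono : ∀ {s s'} → s ≤ s' → F (seq s) ⊆ₑ F (seq s')
  F-mono {s} le x m = let (_ , E , _ , e , _) = seq-mono le in subst (λ w → x ∈ bit w) (sym e) (uniˡ {F (seq s)} {E} m)

  InG : ℕ → Set
  InG x = Σ ℕ λ s → x ∈ bit (F (seq s))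

  G : SetN
  G = chr InG

  agree-below : ∀ s u → Σ ℕ λ s' → s ≤ s' × (∀ x → x < u → bit (F (seq s')) x ≡ G x)
  agree-below s u = s ⊔ s₁ , m≤m⊔n s s₁ , λ x lt → bool-ext (λ m → chr⁺ (s ⊔ s₁ , m))
      (λ m → F-mono (m≤n⊔m s s₁) x (proj₂ stages x lt (chr⁻ {InG} m)))
    where
      stages : Σ ℕ λ s₁ → ∀ x → x < u → InG x → x ∈ bit (F (seq s₁))
      stages = bounded {λ x s₁ → InG x → x ∈ bit (F (seq s₁))} (λ {x} le h g → F-mono le x (h g)) u λ x _ → stage x em
        where
          stage : ∀ x → Dec (InG x) → Σ ℕ λ s₁ → InG x → x ∈ bit (F (seq s₁))
          stage x (yes (s₁ , m)) = s₁ , λ _ → m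
          stage x (no n) = 0 , λ g → ⊥-elim (n g)
      s₁ : ℕ
      s₁ = proj₁ stages

  transfer : ∀ s r n a b → Σ ℕ λ s' → s ≤ s' × (instance₂ G r n a b ↔ instance₂ (bit (F (seq s'))) r n a b)
  transfer s r n a b = let (u , h) = use (fm r) (ext b (ext a (ext n ρ₀))) ; (s' , le , agree) = agree-below s u
    in s' , le , h G (bit (F (seq s'))) (λ x lt → sym (agree x lt)) , h (bit (F (seq s'))) G agree

  neg-final : ∀ s r n a → Neg (seq s) r n a → ∀ b → instance₂ G r n a b
  neg-final s r n a neg b = let (s' , le , to , from) = transfer s r n a b ; (_ , E , m , e , _) = seq-mono le
    in from (dne λ ni → neg E m (subst Rb e (rb (seq s'))) (b , subst (λ w → ¬ instance₂ (bit w) r n a b) e ni))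

  met-final : ∀ s r n a → Met (seq s) r n a → ∃ λ b → ¬ instance₂ G r n a b
  met-final s r n a (b , met) = let (s' , le , to , from) = transfer s r n a b ; (_ , E , m , e , _) = seq-mono le
    in b , λ i → met E m (subst (λ w → instance₂ (bit w) r n a b) e (to i))

  prm-final : ∀ s r n → Prm (seq s) r n → ∀ a → ∃ λ b → ¬ instance₂ G r n a b
  prm-final s r n prm a = met-final (suc s') r n a (met-stage s r n a (prm-ext {seq s} {seq s'} (seq-mono s≤s') prm))
    where
      s' : ℕ
      s' = pr 1 (pr s (pr r (pr n a)))
      s≤s' : s ≤ s'
      s≤s' = ≤-trans (x≤pr s (pr r (pr n a))) (y≤pr 1 _)

  G-infinite : Infinite G
  G-infinite a = let (b , ni) = prm-final 0 0 0 seq-promise a ; (m , nlt) = proj₁ (instance₀ {G} {a} {b}) ni in b , ≮⇒≥ nlt , m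

  G-rainbow : Rainbow f G
  G-rainbow x y z x' y' z' xm ym zm xm' ym' zm' = rb (seq (proj₁ stage)) x y z x' y' z'
      (at x xm (s≤s (≤-trans (≤-trans (≤-trans (≤-trans (m≤m+n x y) (m≤m+n _ z)) (m≤m+n _ x')) (m≤m+n _ y')) (m≤m+n _ z'))))
      (at y ym (s≤s (≤-trans (≤-trans (≤-trans (≤-trans (m≤n+m y x) (m≤m+n _ z)) (m≤m+n _ x')) (m≤m+n _ y')) (m≤m+n _ z'))))
      (at z zm (s≤s (≤-trans (≤-trans (≤-trans (m≤n+m z (x + y)) (m≤m+n _ x')) (m≤m+n _ y')) (m≤m+n _ z'))))
      (at x' xm' (s≤s (≤-trans (≤-trans (m≤n+m x' (x + y + z)) (m≤m+n _ y')) (m≤m+n _ z'))))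
      (at y' ym' (s≤s (≤-trans (m≤n+m y' (x + y + z + x')) (m≤m+n _ z'))))
      (at z' zm' (s≤s (m≤n+m z' (x + y + z + x' + y'))))
    where
      stage : Σ ℕ λ k → 0 ≤ k × (∀ v → v < suc (x + y + z + x' + y' + z') → bit (F (seq k)) v ≡ G v)
      stage = agree-below 0 (suc (x + y + z + x' + y' + z'))
      at : ∀ v → v ∈ G → v < suc (x + y + z + x' + y' + z') → v ∈ bit (F (seq (proj₁ stage)))
      at v m lt = trans (proj₂ (proj₂ stage) v lt) m

  G-avoids : ∀ β → ¬ Sigma2 Z (target β) → ¬ Sigma2 (join Z G) (target β)
  G-avoids β nσ (ψ , h) = go (fm-onto ψ)
    where
      go : (∃ λ r → fm r ≡ ψ) → ⊥
      go (r , refl) = let (s , settled) = settled-stage β r in clash s (settled nσ)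
        where
          clash : ∀ s → Settled (seq s) β r → ⊥
          clash s (n , inj₁ (m , prm)) = let (a , all) = proj₁ (h n) m ; (b , ni) = prm-final s r n prm a in ni (all b)
          clash s (n , inj₂ (nm , a , neg)) = nm (proj₂ (h n) (a , neg-final s r n a neg))

  -- From the avoided Σ₂ definitions to preservation of Δ₃ definitions

  embed : BForm → BForm
  embed (eqF s t) = eqF s t
  embed (ltF s t) = ltF s t
  embed (inX t) = inX (plus t t)
  embed (negF φ) = negF (embed φ)
  embed (andF φ ψ) = andF (embed φ) (embed ψ)
  embed (orF φ ψ) = orF (embed φ) (embed ψ)
  embed (allLt t φ) = allLt t (embed φ)
  embed (exLt t φ) = exLt t (embed φ)

  embed-ok : ∀ φ ρ → Sat (join Z G) ρ (embed φ) ↔ Sat Z ρ φ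
  embed-ok (eqF s t) ρ = id , id
  embed-ok (ltF s t) ρ = id , id
  embed-ok (inX t) ρ = trans (sym (join-even Z G (evalT ρ t))) , trans (join-even Z G (evalT ρ t))
  embed-ok (negF φ) ρ = ¬↔ (embed-ok φ ρ)
  embed-ok (andF φ ψ) ρ = embed-ok φ ρ ×↔ embed-ok ψ ρ
  embed-ok (orF φ ψ) ρ = embed-ok φ ρ ⊎↔ embed-ok ψ ρ
  embed-ok (allLt t φ) ρ = (λ h x lt → proj₁ (embed-ok φ (ext x ρ)) (h x lt)) , (λ h x lt → proj₂ (embed-ok φ (ext x ρ)) (h x lt))
  embed-ok (exLt t φ) ρ = (λ { (x , lt , p) → x , lt , proj₁ (embed-ok φ (ext x ρ)) p })
                        , (λ { (x , lt , p) → x , lt , proj₂ (embed-ok φ (ext x ρ)) p })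

  delta₃-up : ∀ A → Delta3 Z A → Delta3 (join Z G) A
  delta₃-up A ((φ , h) , (ψ , k)) =
      (embed φ , λ n → (λ m → let (a , p) = proj₁ (h n) m in a , λ b → let (c , q) = p b in c , proj₂ (embed-ok φ _) q)
                     , (λ { (a , p) → proj₂ (h n) (a , λ b → let (c , q) = p b in c , proj₁ (embed-ok φ _) q) }))
    , (embed ψ , λ n → (λ m a → let (b , p) = proj₁ (k n) m a in b , λ c → proj₂ (embed-ok ψ _) (p c))
                     , (λ p → proj₂ (k n) λ a → let (b , q) = p a in b , λ c → proj₁ (embed-ok ψ _) (q c)))

  complement : SetN → SetN
  complement A n = not (A n)

  comp⁺ : ∀ {A n} → ¬ n ∈ A → n ∈ complement A
  comp⁺ {A} {n} h with A n
  ... | true = ⊥-elim (h refl)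
  ... | false = refl

  comp⁻ : ∀ {A n} → n ∈ complement A → ¬ n ∈ A
  comp⁻ {A} {n} m p with A n
  comp⁻ () p | true
  comp⁻ m () | false

  pi₂⇒sigma₂ : ∀ {X A} → Pi2 X A → Sigma2 X (complement A)
  pi₂⇒sigma₂ {X} {A} (φ , h) = negF φ , λ n →
      (λ m → let (a , na) = ¬∀⇒∃¬ (λ all → comp⁻ {A} m (proj₂ (h n) all)) in a , λ b s → na (b , s))
    , (λ { (a , all) → comp⁺ {A} λ m → let (b , s) = proj₁ (h n) m a in all b s })

  sigma₂⇒pi₂ : ∀ {X A} → Sigma2 X (complement A) → Pi2 X A
  sigma₂⇒pi₂ {X} {A} (φ , h) = negF φ , λ n →
      (λ m a → ¬∀⇒∃¬ λ all → comp⁻ {A} (proj₂ (h n) (a , all)) m)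
    , (λ p → dne λ nm → let (a , all) = proj₁ (h n) (comp⁺ {A} nm) ; (b , ns) = p a in ns (all b))

  sigma₂-cong : ∀ {X A B} → (∀ n → n ∈ A ↔ n ∈ B) → Sigma2 X A → Sigma2 X B
  sigma₂-cong e (φ , h) = φ , λ n → (λ m → proj₁ (h n) (proj₂ (e n) m)) , (λ p → proj₁ (e n) (proj₂ (h n) p))

  -- Its Σ₃ definition makes a properly Δ₃ set and its complement two of the targets, and to be Π₂
  -- is to have a Σ₂ complement.
  G-preserves : PreservesDelta3 Z G
  G-preserves A (δ@((φ , h) , _) , nσ , nπ) = delta₃-up A δ
    , (λ σ → G-avoids (φ , true) (λ σ' → nσ (sigma₂-cong back σ')) (sigma₂-cong forth σ))
    , (λ π → G-avoids (φ , false) (λ σ' → nπ (sigma₂⇒pi₂ {Z} {A} (sigma₂-cong backᶜ σ'))) (sigma₂-cong forthᶜ (pi₂⇒sigma₂ {join Z G} {A} π)))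
    where
      forth : ∀ n → n ∈ A ↔ n ∈ target (φ , true)
      forth n = (λ m → chr⁺ (proj₁ (h n) m)) , (λ m → proj₂ (h n) (chr⁻ {Σ₃-sat φ} m))
      back : ∀ n → n ∈ target (φ , true) ↔ n ∈ A
      back n = proj₂ (forth n) , proj₁ (forth n)
      forthᶜ : ∀ n → n ∈ complement A ↔ n ∈ target (φ , false)
      forthᶜ n = (λ m → chr⁺ λ p → comp⁻ {A} m (proj₂ (h n) p)) , (λ m → comp⁺ {A} λ p → chr⁻ {λ n → ¬ Σ₃-sat φ n} m (proj₁ (h n) p))
      backᶜ : ∀ n → n ∈ target (φ , false) ↔ n ∈ complement A
      backᶜ n = proj₂ (forthᶜ n) , proj₁ (forthᶜ n)

theorem3p23 : ExcludedMiddle 0ℓ →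
    (Z : SetN) (f : Coloring3) → ComputableIn Z f → TwoBounded f →
    Σ SetN (λ G → Infinite G × Rainbow f G × PreservesDelta3 Z G)
theorem3p23 em Z f f-comp f-two = G , G-infinite , G-rainbow , G-preserves
  where open Generic em Z f f-comp f-two
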